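{- Let $G$ be a finite undirected graph with $n$ vertices and $m$ edges, rooted at an edge $e$. Then $G$ has a cycle basis that is rooted at $e$ if and only if $e$ belongs to the $2$-core of $G$ and the $2$-core of $G$ is $2$-vertex-connected. Moreover, when a rooted cycle basis exists, one can be constructed in time $O(mn)$, and the constructed basis has total length (sum over its cycles of the number of edges) $O(mn)$.
   Context: A rooted graph is an undirected graph with a designated root edge $e$. A cycle is a connected $2$-regular subgraph; it is rooted if it contains $e$. The cycle space of $G$ is the subspace of the $\mathbb{F}_2$-vector space $\mathbb{F}_2^{E}$ (subsets of edges, with symmetric difference as addition) spanned by the edge sets of cycles; equivalently, the set of edge subsets having even degree at every vertex. A cycle basis is a set of cycles whose edge sets form a basis of the cycle space; it is rooted (at $e$) if every cycle in it contains $e$. The $2$-core of $G$ is the subgraph obtained by repeatedly removing vertices of degree at most one until all remaining vertices have degree at least $2$. A graph is $2$-vertex-connected if it is connected and no deletion of a single vertex disconnects it.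
   Formalization: The "only if" direction assumes that G has at least one cycle: a forest has the empty cycle basis, vacuously rooted at e, while its 2-core is empty and does not contain e. Graphs have no loops (a triangle with an added loop is a counterexample); parallel edges are allowed. -}

module Defs where

open import Algebra.Bundles using (CommutativeRing)
import Algebra.Properties.Monoid.Sum as MonoidSum
open import Data.Bool.Base using (Bool; false; _∧_; _∨_; if_then_else_)
open import Data.Bool.Properties using (∨-zeroʳ; xor-∧-commutativeRing)
open import Data.Fin.Base using (Fin; toℕ; fromℕ<)
import Data.Fin.Properties as Fin
open import Data.Fin.Subset using (Subset; _∈_; _∩_; ∁; _-_; ∣_∣; ⊤; ⊥; Nonempty)
open import Data.Fin.Subset.Properties using (∈⊤; x∈p∧x≢y⇒x∈p-y; x∈∁p⇒x∉p; x∈p∩q⁻)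
open import Data.List.Base as List using (List; []; _∷_; _∷ʳ_; length; map; concatMap)
open import Data.List.Membership.Propositional using () renaming (_∈_ to _∈ˡ_)
open import Data.List.Relation.Binary.Pointwise using (Pointwise)
open import Data.List.Relation.Unary.All using (All)
open import Data.List.Relation.Unary.Unique.Propositional using (Unique)
open import Data.Nat.Base using (ℕ; suc; _+_; _∸_; _≤_; _<_; _≮_; _≡ᵇ_)
open import Data.Nat.ListAction using (sum)
open import Data.Nat.Properties using (_<?_)
open import Data.Product using (_×_; _,_; ∃-syntax)
open import Data.Sum.Base using (_⊎_)
open import Data.Vec.Base as Vec using ()
open import Data.Vec.Functional using (Vector)
open import Data.Vec.Properties using (lookup⇒[]=; lookup∘tabulate)
open import Function.Base using (_∘_)
open import Function.Bundles using (_⇔_)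
open import Relation.Binary.Construct.Closure.ReflexiveTransitive using (Star)
open import Relation.Binary.PropositionalEquality using (_≡_; _≢_; cong; trans)
open import Relation.Nullary using (does; yes; no)
open import Relation.Nullary.Decidable using (dec-true)

------------------------------------------------------------------------
-- Graphs

-- The two ends of an edge are stored in some order, on which no notion
-- about the graph depends.  Parallel edges are permitted; simple graphs
-- are the instances in which distinct edges have distinct pairs of ends.
-- Loops are not permitted: a loop is by itself an element of the cycle
-- space but leaves vertex-connectivity unchanged.
record Graph (n m : ℕ) : Set where
  field
    end₁ end₂ : Fin m → Fin n
    loopless  : ∀ f → end₁ f ≢ end₂ f

  incident : Fin n → Subset m
  incident v = Vec.tabulate λ f →
    does (end₁ f Fin.≟ v) ∨ does (end₂ f Fin.≟ v)

  end₁∈incident : ∀ {v f} → end₁ f ≡ v → f ∈ incident v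
  end₁∈incident {v} {f} eq = lookup⇒[]= f _
    (trans (lookup∘tabulate _ f)
           (cong (_∨ does (end₂ f Fin.≟ v)) (dec-true (end₁ f Fin.≟ v) eq)))

  end₂∈incident : ∀ {v f} → end₂ f ≡ v → f ∈ incident v
  end₂∈incident {v} {f} eq = lookup⇒[]= f _
    (trans (lookup∘tabulate _ f)
    (trans (cong (does (end₁ f Fin.≟ v) ∨_) (dec-true (end₂ f Fin.≟ v) eq))
           (∨-zeroʳ _)))

open Graph public

record Subgraph {n m : ℕ} (G : Graph n m) : Set where
  field
    vertices : Subset n
    edges    : Subset m
    closed   : ∀ {f} → f ∈ edges → end₁ G f ∈ vertices × end₂ G f ∈ vertices

open Subgraph public

module _ {n m : ℕ} {G : Graph n m} where

  degree : Subgraph G → Fin n → ℕ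
  degree H v = ∣ edges H ∩ incident G v ∣

  Adjacent : Subgraph G → Fin n → Fin n → Set
  Adjacent H u v = ∃[ f ] f ∈ edges H ×
    ((end₁ G f ≡ u × end₂ G f ≡ v) ⊎ (end₁ G f ≡ v × end₂ G f ≡ u))

  Linked : Subgraph G → Set
  Linked H = ∀ {u v} → u ∈ vertices H → v ∈ vertices H → Star (Adjacent H) u v

  Connected : Subgraph G → Set
  Connected H = Nonempty (vertices H) × Linked H

  delete : Subgraph G → Fin n → Subgraph G
  delete H v = record
    { vertices = vertices H - v
    ; edges    = edges H ∩ ∁ (incident G v)
    ; closed   = λ f∈ →
        let f∈H , f∈∁ = x∈p∩q⁻ _ _ f∈
            f∉v       = x∈∁p⇒x∉p f∈∁
            a∈H , b∈H = closed H f∈H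
        in  x∈p∧x≢y⇒x∈p-y a∈H (f∉v ∘ end₁∈incident G)
          , x∈p∧x≢y⇒x∈p-y b∈H (f∉v ∘ end₂∈incident G)
    }

  TwoVertexConnected : Subgraph G → Set
  TwoVertexConnected H =
    Connected H × (∀ v → v ∈ vertices H → Linked (delete H v))

  data _⟶_ : Subgraph G → Subgraph G → Set where
    prune : ∀ {H v} → v ∈ vertices H → degree H v ≤ 1 → H ⟶ delete H v

module _ {n m : ℕ} (G : Graph n m) where

  whole : Subgraph G
  whole = record { vertices = ⊤ ; edges = ⊤ ; closed = λ _ → ∈⊤ , ∈⊤ }

  IsTwoCore : Subgraph G → Set
  IsTwoCore H = Star _⟶_ whole H × (∀ v → v ∈ vertices H → 2 ≤ degree H v)

  record Cycle : Set where
    field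
      subgraph  : Subgraph G
      connected : Connected subgraph
      regular   : ∀ v → v ∈ vertices subgraph → degree subgraph v ≡ 2

    cycleEdges : Subset m
    cycleEdges = edges subgraph

open Cycle public

------------------------------------------------------------------------
-- Linear algebra over 𝔽₂ = (Bool, xor, ∧) in 𝔽₂ᵐ = Subset m

module 𝔽₂ = CommutativeRing xor-∧-commutativeRing
open MonoidSum 𝔽₂.+-monoid using () renaming (sum to sum𝔽₂)

module _ {m : ℕ} where

  combination : ∀ {k} → Vector Bool k → Vector (Subset m) k → Subset m
  combination c b = Vec.tabulate λ f → sum𝔽₂ λ i → c i ∧ Vec.lookup (b i) f

  Span : (Subset m → Set) → (Subset m → Set)
  Span P x = ∃[ k ] ∃[ b ] ∃[ c ]
    (∀ (i : Fin k) → P (b i)) × combination c b ≡ x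

  LinearlyIndependent : ∀ {k} → Vector (Subset m) k → Set
  LinearlyIndependent b = ∀ c → combination c b ≡ ⊥ → ∀ i → c i ≡ false

  IsBasisOf : ∀ {k} → (Subset m → Set) → Vector (Subset m) k → Set
  IsBasisOf W b =
    (∀ i → W (b i)) ×
    LinearlyIndependent b ×
    (∀ x → W x → ∃[ c ] combination c b ≡ x)

------------------------------------------------------------------------
-- Cycle bases

module _ {n m : ℕ} (G : Graph n m) where

  CycleSpace : Subset m → Set
  CycleSpace = Span λ x → ∃[ Z ] cycleEdges {G = G} Z ≡ x

  -- Independence rules out repetitions, so the list represents a set.
  IsCycleBasis : List (Cycle G) → Set
  IsCycleBasis B = IsBasisOf CycleSpace (cycleEdges ∘ List.lookup B)

  IsRootedCycleBasis : Fin m → List (Cycle G) → Set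
  IsRootedCycleBasis e B = IsCycleBasis B × All (λ Z → e ∈ cycleEdges Z) B

  HasRootedCycleBasis : Fin m → Set
  HasRootedCycleBasis e = ∃[ B ] IsRootedCycleBasis e B

  totalLength : List (Cycle G) → ℕ
  totalLength B = sum (map (∣_∣ ∘ cycleEdges) B)

  RootInTwoConnectedCore : Fin m → Set
  RootInTwoConnectedCore e =
    ∃[ H ] IsTwoCore G H × e ∈ edges H × TwoVertexConnected H

------------------------------------------------------------------------
-- Random access machine

-- Registers and arrays are named by numerals, so a program uses finitely
-- many of each; every register and array cell holds a natural number.  The
-- only arithmetic is successor and truncated subtraction, so a run of
-- length t on numbers at most x creates numbers at most x + t plus a
-- constant of the program.  For polynomial running times words of O(log x)
-- bits therefore suffice, and unit cost per operation is no more generous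
-- than on a word RAM.  Having several arrays replaces address arithmetic.

data Expr : Set where
  lit  : ℕ → Expr
  reg  : ℕ → Expr
  cell : ℕ → Expr → Expr
  succ : Expr → Expr
  _⊖_  : Expr → Expr → Expr

data Program : Set where
  skip      : Program
  setReg    : ℕ → Expr → Program
  setCell   : ℕ → Expr → Expr → Program
  emit      : Expr → Program
  _⨾_       : Program → Program → Program
  ifLess    : Expr → Expr → Program → Program → Program
  whileLess : Expr → Expr → Program → Program

infixr 5 _⨾_

record State : Set where
  constructor ⟨_,_,_⟩
  field
    regs   : ℕ → ℕ
    arrays : ℕ → ℕ → ℕ
    output : List ℕ

open State public

_[_≔_] : ∀ {A : Set} → (ℕ → A) → ℕ → A → (ℕ → A)
(g [ x ≔ a ]) y = if x ≡ᵇ y then a else g y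

⟦_⟧ : Expr → State → ℕ
⟦ lit k    ⟧ s = k
⟦ reg r    ⟧ s = regs s r
⟦ cell a x ⟧ s = arrays s a (⟦ x ⟧ s)
⟦ succ x   ⟧ s = suc (⟦ x ⟧ s)
⟦ x ⊖ y    ⟧ s = ⟦ x ⟧ s ∸ ⟦ y ⟧ s

cost : Expr → ℕ
cost (lit k)    = 1
cost (reg r)    = 1
cost (cell a x) = 1 + cost x
cost (succ x)   = 1 + cost x
cost (x ⊖ y)    = 1 + cost x + cost y

-- P ∣ s ⇓[ t ] s′ : started in s, the program P halts in s′ after time t.
data _∣_⇓[_]_ : Program → State → ℕ → State → Set where

  skip⇓ : ∀ {s} → skip ∣ s ⇓[ 1 ] s

  setReg⇓ : ∀ {s r x} →
    setReg r x ∣ s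
      ⇓[ 1 + cost x ]
    ⟨ regs s [ r ≔ ⟦ x ⟧ s ] , arrays s , output s ⟩

  setCell⇓ : ∀ {s a x y} →
    setCell a x y ∣ s
      ⇓[ 1 + cost x + cost y ]
    ⟨ regs s
    , arrays s [ a ≔ arrays s a [ ⟦ x ⟧ s ≔ ⟦ y ⟧ s ] ]
    , output s ⟩

  emit⇓ : ∀ {s x} →
    emit x ∣ s
      ⇓[ 1 + cost x ]
    ⟨ regs s , arrays s , output s ∷ʳ ⟦ x ⟧ s ⟩

  ⨾⇓ : ∀ {P Q s s′ s″ t u} →
    P ∣ s ⇓[ t ] s′ → Q ∣ s′ ⇓[ u ] s″ →
    (P ⨾ Q) ∣ s ⇓[ t + u ] s″

  then⇓ : ∀ {x y P Q s s′ t} →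
    ⟦ x ⟧ s < ⟦ y ⟧ s → P ∣ s ⇓[ t ] s′ →
    ifLess x y P Q ∣ s ⇓[ 1 + cost x + cost y + t ] s′

  else⇓ : ∀ {x y P Q s s′ t} →
    ⟦ x ⟧ s ≮ ⟦ y ⟧ s → Q ∣ s ⇓[ t ] s′ →
    ifLess x y P Q ∣ s ⇓[ 1 + cost x + cost y + t ] s′

  loop⇓ : ∀ {x y P s s′ s″ t u} →
    ⟦ x ⟧ s < ⟦ y ⟧ s →
    P ∣ s ⇓[ t ] s′ → whileLess x y P ∣ s′ ⇓[ u ] s″ →
    whileLess x y P ∣ s ⇓[ 1 + cost x + cost y + t + u ] s″

  exit⇓ : ∀ {x y P s} →
    ⟦ x ⟧ s ≮ ⟦ y ⟧ s →
    whileLess x y P ∣ s ⇓[ 1 + cost x + cost y ] s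

------------------------------------------------------------------------
-- Input and output format

zeroPadded : ∀ {m} → (Fin m → ℕ) → (ℕ → ℕ)
zeroPadded {m} g i with i <? m
... | yes i<m = g (fromℕ< i<m)
... | no  _   = 0

-- A rooted graph is presented as an edge list: registers 0, 1, 2 hold the
-- number of vertices, the number of edges and the root edge, and arrays
-- 0 and 1 hold the ends of the edges.  All other memory is zero.
inputState : ∀ {n m} → Graph n m → Fin m → State
inputState {n} {m} G e = ⟨ registers , memory , [] ⟩
  where
  registers : ℕ → ℕ
  registers 0 = n
  registers 1 = m
  registers 2 = toℕ e
  registers _ = 0

  memory : ℕ → ℕ → ℕ
  memory 0 = zeroPadded (toℕ ∘ end₁ G)
  memory 1 = zeroPadded (toℕ ∘ end₂ G)
  memory _ = λ _ → 0

module _ {m : ℕ} where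

  Enumerates : List (Fin m) → Subset m → Set
  Enumerates fs x = Unique fs × (∀ f → f ∈ˡ fs ⇔ f ∈ x)

  encode : List (List (Fin m)) → List ℕ
  encode = concatMap λ fs → length fs ∷ map toℕ fs

-- Every cycle is written out as its number of edges followed by its edges.
Describes : ∀ {n m} {G : Graph n m} → List ℕ → List (Cycle G) → Set
Describes out B = ∃[ fss ]
  Pointwise (λ fs Z → Enumerates fs (cycleEdges Z)) fss B × out ≡ encode fss

{-# OPTIONS --safe #-}
-- Let H be the 2-core.  Suppose there is a rooted cycle basis and deleting a
-- vertex v from H cuts off a component K avoiding e.  By handshaking, the edges
-- of a rooted cycle that touch K form an even set, and an even part of a cycle
-- is all of it or empty, so rooted cycles avoid K.  But the degrees in H being
-- at least 2, some cycle touches K, so rooted cycles do not span.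
--
-- Conversely, let e = st and take an st-numbering of H: every vertex but s has
-- a lower neighbour, along its low edge, and every vertex but t a higher one.
-- A chord is an edge xy, x below y, that is not a low edge; it closes to a
-- rooted cycle by going down from x to s and up from y to t.  All other chords
-- on this cycle start above x, so these cycles are independent, and they span
-- because the low edges form a tree.
--
-- The numbering is built by ears.  Grow a spanning forest from s and t and call
-- the nearest ranked ancestor of a vertex its anchor.  An edge xy whose ends
-- have anchors a below b gives the ear a … x y … b, whose inner vertices are
-- inserted into the numbering between a and b; each inserted vertex pays
-- O(m + n) for the shifting of ranks, the new anchors and the restarted scan.
-- Once no such edge is left, everything unranked hangs at a single anchor, so
-- no 2-connected core reaches beyond the ranked vertices.

module Submission where

open import Defs
open import Algebra.Properties.Semiring.Sum 𝔽₂.semiring using (*-distribˡ-sum; sum-cong-≗; sum-remove; sum-replicate-zero; ∑-comm; ∑-distrib-+) renaming (sum to ∑)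
open import Data.Bool.Base using (Bool; T; _xor_; _∧_; _∨_; false; if_then_else_; not; true)
open import Data.Bool.Properties using (xor-assoc; xor-identityʳ; xor-same; ∧-assoc; ∧-comm; ∧-distribʳ-xor; ∧-distribˡ-xor; ∧-identityʳ; ∧-zeroʳ; ∨-zeroʳ)
open import Data.Empty using () renaming (⊥ to Absurd; ⊥-elim to absurd)
open import Data.Fin.Base using (Fin; fromℕ<; punchIn; suc; toℕ; zero)
import Data.Fin.Properties as Fin
open import Data.Fin.Subset using (Nonempty; Subset; _-_; _∈_; _∉_; _∩_; _∪_; _⊆_; ⁅_⁆; ∣_∣; ⊥)
open import Data.Fin.Subset.Properties using (Empty-unique; _∈?_; nonempty?; p⊂q⇒∣p∣<∣q∣; p⊆q⇒∣p∣≤∣q∣; p─q⊆p; x∈p⇒∣p-x∣<∣p∣; x∈p∧x≢y⇒x∈p-y; x∈p∩q⁺; x∈p∩q⁻; x∈p∪q⁺; x∈p∪q⁻; x∈⁅x⁆; x∈⁅y⁆⇒x≡y; x∉p⇒x∈∁p; ∈⊤; ∉⊥; ∣p∣≤n; ∣⁅x⁆∣≡1; ∣⊥∣≡0; ∪-identityˡ)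
open import Data.List.Base as List using (List; []; _++_; _∷_; foldr; length; map)
import Data.List.Membership.DecPropositional as DecMembership
open import Data.List.Membership.Propositional using () renaming (_∈_ to _∈ˡ_; _∉_ to _∉ˡ_)
open import Data.List.Membership.Propositional.Properties using (∈-++⁺ʳ; ∈-++⁺ˡ; ∈-++⁻; ∈-lookup)
open import Data.List.Properties using (++-assoc; ++-identityʳ; concatMap-++; length-++; length-map; map-++)
open import Data.List.Relation.Binary.Disjoint.Propositional using (Disjoint)
open import Data.List.Relation.Binary.Pointwise using (Pointwise; []; _∷_)
open import Data.List.Relation.Unary.All as All using (All; []; _∷_)
open import Data.List.Relation.Unary.All.Properties using (All¬⇒¬Any; ¬Any⇒All¬)
open import Data.List.Relation.Unary.AllPairs using ([]; _∷_)
open import Data.List.Relation.Unary.Any using (here; there)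
open import Data.List.Relation.Unary.Unique.Propositional using (Unique)
open import Data.List.Relation.Unary.Unique.Propositional.Properties using (++⁺)
open import Data.Nat.Base using (_*_; _+_; _<_; _∸_; _≡ᵇ_; _≤_; _≤ᵇ_; _≮_; suc; s≤s; zero; z≤n; ℕ)
open import Data.Nat.Properties
open import Data.Nat.Tactic.RingSolver using (solve-∀)
open import Data.Product as Product using (_,_; _×_; proj₁; proj₂; ∃-syntax)
open import Data.Sum.Base as Sum using ([_,_]′; _⊎_; inj₁; inj₂; swap)
open import Data.Unit.Base using (tt; ⊤)
open import Data.Vec.Base as Vec using ([]; _∷_; here; lookup; there)
open import Data.Vec.Functional using (Vector)
open import Data.Vec.Properties using ([]=⇒lookup; lookup-replicate; lookup-zipWith; lookup⇒[]=; lookup∘tabulate; tabulate-cong; tabulate∘lookup)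
open import Function.Base using (_$_; _∘_; id)
open import Function.Bundles using (mk⇔)
open import Relation.Binary.Construct.Closure.ReflexiveTransitive using (Star; _◅_; _◅◅_; reverse; ε)
open import Relation.Binary.Definitions using (tri<; tri>; tri≈)
open import Relation.Binary.PropositionalEquality using (_≗_; _≡_; _≢_; cong; cong₂; module ≡-Reasoning; refl; subst; subst₂; sym; trans)
open import Relation.Nullary using (contradiction; does; no; yes; ¬_)
open import Relation.Nullary.Decidable using (_×-dec_; _⊎-dec_; dec-false; dec-true; ¬?)

-- Linear algebra over 𝔽₂

-- An acyclic graph has the empty basis, which is vacuously rooted although the 2-core has no edge.
-- The forward direction therefore assumes a cycle, and the program is proved correct whenever the
-- core is as required or there is no cycle at all. Either case supplies what the basis proof asks
-- of the numbering beyond its order: every edge of every cycle has ranked ends.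
--
-- The program never computes the core. Anchors alone drive the ranking, and the core enters only in
-- the argument that no cycle leaves the ranked vertices.
--
-- `G` may be disconnected, so `n` may exceed `m`, and a bound of order n² would be too weak. Each
-- insertion shifts an array of `n` ranks, but at most `2 + m` vertices are ever reached, all but
-- two of them through a parent edge of their own.
--
-- The total length is not counted separately: every number emitted costs time, so the running time
-- bounds the output and with it the cycles written.

≢true⇒≡false : ∀ {b} → b ≢ true → b ≡ false
≢true⇒≡false {false} _ = refl
≢true⇒≡false {true}  p = contradiction refl p

module _ {m : ℕ} where

  ∈⇒lookup : ∀ {f} {x : Subset m} → f ∈ x → lookup x f ≡ true
  ∈⇒lookup = []=⇒lookup

  lookup⇒∈ : ∀ {f} {x : Subset m} → lookup x f ≡ true → f ∈ x
  lookup⇒∈ = lookup⇒[]= _ _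

  ∉⇒lookup : ∀ {f} {x : Subset m} → f ∉ x → lookup x f ≡ false
  ∉⇒lookup f∉x = ≢true⇒≡false (f∉x ∘ lookup⇒∈)

  lookup⇒∉ : ∀ {f} {x : Subset m} → lookup x f ≡ false → f ∉ x
  lookup⇒∉ eq f∈x with () ← trans (sym eq) (∈⇒lookup f∈x)

  subset-ext : {x y : Subset m} → lookup x ≗ lookup y → x ≡ y
  subset-ext {x} {y} eq =
    trans (sym (tabulate∘lookup x)) (trans (tabulate-cong eq) (tabulate∘lookup y))

  lookup-⊥ : ∀ f → lookup (⊥ {m}) f ≡ false
  lookup-⊥ f = lookup-replicate f false

  infixl 6 _⊕_
  _⊕_ : Subset m → Subset m → Subset m
  _⊕_ = Vec.zipWith _xor_

  lookup-⊕ : ∀ x y f → lookup (x ⊕ y) f ≡ lookup x f xor lookup y f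
  lookup-⊕ x y f = lookup-zipWith _xor_ f x y

∑-zero : ∀ {k} (t : Vector Bool k) → (∀ j → t j ≡ false) → ∑ t ≡ false
∑-zero {k} t t≡0 = trans (sum-cong-≗ t≡0) (sum-replicate-zero k)

∑-single : ∀ {k} (i : Fin k) (t : Vector Bool k) →
           (∀ j → j ≢ i → t j ≡ false) → ∑ t ≡ t i
∑-single {suc k} i t t≡0 = trans (sum-remove t)
  (trans (cong (t i xor_) (∑-zero _ λ j → t≡0 (punchIn i j) (Fin.punchInᵢ≢i i j)))
         (xor-identityʳ _))

odd : ℕ → Bool
odd zero    = false
odd (suc n) = not (odd n)

∑-lookup : ∀ {m} (p : Subset m) → ∑ (lookup p) ≡ odd ∣ p ∣
∑-lookup []          = refl
∑-lookup (false ∷ p) = ∑-lookup p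
∑-lookup (true  ∷ p) = cong not (∑-lookup p)

module _ {m k : ℕ} where

  lookup-combination : ∀ (c : Vector Bool k) (b : Vector (Subset m) k) f →
    lookup (combination c b) f ≡ ∑ (λ i → c i ∧ lookup (b i) f)
  lookup-combination c b f = lookup∘tabulate _ f

  combination-⊕ : ∀ (c d : Vector Bool k) (b : Vector (Subset m) k) →
    combination (λ i → c i xor d i) b ≡ combination c b ⊕ combination d b
  combination-⊕ c d b = subset-ext λ f → begin
    lookup (combination (λ i → c i xor d i) b) f
      ≡⟨ lookup-combination _ b f ⟩
    ∑ (λ i → (c i xor d i) ∧ lookup (b i) f)
      ≡⟨ sum-cong-≗ (λ i → ∧-distribʳ-xor (lookup (b i) f) (c i) (d i)) ⟩
    ∑ (λ i → (c i ∧ lookup (b i) f) xor (d i ∧ lookup (b i) f))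
      ≡⟨ ∑-distrib-+ (λ i → c i ∧ lookup (b i) f) (λ i → d i ∧ lookup (b i) f) ⟩
    ∑ (λ i → c i ∧ lookup (b i) f) xor ∑ (λ i → d i ∧ lookup (b i) f)
      ≡⟨ cong₂ _xor_ (lookup-combination c b f) (lookup-combination d b f) ⟨
    lookup (combination c b) f xor lookup (combination d b) f
      ≡⟨ lookup-⊕ (combination c b) (combination d b) f ⟨
    lookup (combination c b ⊕ combination d b) f ∎
    where open ≡-Reasoning

  combination-avoids : ∀ (c : Vector Bool k) (b : Vector (Subset m) k) f →
    (∀ i → f ∉ b i) → f ∉ combination c b
  combination-avoids c b f f∉ = lookup⇒∉
    (trans (lookup-combination c b f)
           (∑-zero _ λ i → trans (cong (c i ∧_) (∉⇒lookup (f∉ i))) (∧-zeroʳ _)))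

combination-single : ∀ {m} (x : Subset m) → combination {k = 1} (λ _ → true) (λ _ → x) ≡ x
combination-single x = subset-ext λ f →
  trans (lookup-combination (λ (_ : Fin 1) → true) (λ _ → x) f) (xor-identityʳ (lookup x f))

-- Even edge sets and handshaking

module _ {n m : ℕ} (G : Graph n m) where

  _meets_ : Fin m → Fin n → Set
  f meets v = end₁ G f ≡ v ⊎ end₂ G f ≡ v

  meets⇒incident : ∀ {f v} → f meets v → f ∈ incident G v
  meets⇒incident (inj₁ eq) = end₁∈incident G eq
  meets⇒incident (inj₂ eq) = end₂∈incident G eq

  lookup-incident : ∀ v f →
    lookup (incident G v) f ≡ does (end₁ G f Fin.≟ v) ∨ does (end₂ G f Fin.≟ v)
  lookup-incident v f = lookup∘tabulate _ f

  incident⇒meets : ∀ {f v} → f ∈ incident G v → f meets v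
  incident⇒meets {f} {v} f∈ with end₁ G f Fin.≟ v | end₂ G f Fin.≟ v | trans (sym (lookup-incident v f)) (∈⇒lookup f∈)
  ... | yes p | _     | _ = inj₁ p
  ... | no _  | yes q | _ = inj₂ q
  ... | no _  | no _  | ()

  parity : Fin n → Subset m → Bool
  parity v x = ∑ λ f → lookup (incident G v) f ∧ lookup x f

  Even : Subset m → Set
  Even x = ∀ v → parity v x ≡ false

  parity-⊕ : ∀ v x y → parity v (x ⊕ y) ≡ parity v x xor parity v y
  parity-⊕ v x y = trans
    (sum-cong-≗ λ f → trans (cong (lookup (incident G v) f ∧_) (lookup-⊕ x y f))
                            (∧-distribˡ-xor (lookup (incident G v) f) _ _))
    (∑-distrib-+ (λ f → lookup (incident G v) f ∧ lookup x f)
                 (λ f → lookup (incident G v) f ∧ lookup y f))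

  Even-⊕ : ∀ {x y} → Even x → Even y → Even (x ⊕ y)
  Even-⊕ {x} {y} ex ey v = trans (parity-⊕ v x y) (cong₂ _xor_ (ex v) (ey v))

  parity-combination : ∀ {k} v (c : Vector Bool k) b →
    parity v (combination c b) ≡ ∑ (λ i → c i ∧ parity v (b i))
  parity-combination v c b = begin
    ∑ (λ f → inc f ∧ lookup (combination c b) f)
      ≡⟨ sum-cong-≗ (λ f → cong (inc f ∧_) (lookup-combination c b f)) ⟩
    ∑ (λ f → inc f ∧ ∑ (λ i → c i ∧ lookup (b i) f))
      ≡⟨ sum-cong-≗ (λ f → *-distribˡ-sum (inc f) (λ i → c i ∧ lookup (b i) f)) ⟩
    ∑ (λ f → ∑ (λ i → inc f ∧ (c i ∧ lookup (b i) f)))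
      ≡⟨ ∑-comm (λ f i → inc f ∧ (c i ∧ lookup (b i) f)) ⟩
    ∑ (λ i → ∑ (λ f → inc f ∧ (c i ∧ lookup (b i) f)))
      ≡⟨ sum-cong-≗ (λ i → sum-cong-≗ λ f → ∧-swap (inc f) (c i) (lookup (b i) f)) ⟩
    ∑ (λ i → ∑ (λ f → c i ∧ (inc f ∧ lookup (b i) f)))
      ≡⟨ sum-cong-≗ (λ i → *-distribˡ-sum (c i) (λ f → inc f ∧ lookup (b i) f)) ⟨
    ∑ (λ i → c i ∧ parity v (b i)) ∎
    where
    open ≡-Reasoning
    inc = lookup (incident G v)
    ∧-swap : ∀ a b c → a ∧ (b ∧ c) ≡ b ∧ (a ∧ c)
    ∧-swap a b c = trans (sym (∧-assoc a b c)) (trans (cong (_∧ c) (∧-comm a b)) (∧-assoc b a c))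

  Even-combination : ∀ {k} (c : Vector Bool k) b → (∀ i → Even (b i)) → Even (combination c b)
  Even-combination c b ev v = trans (parity-combination v c b)
    (∑-zero _ λ i → trans (cong (c i ∧_) (ev i v)) (∧-zeroʳ _))

  parity-degree : ∀ v x → parity v x ≡ odd ∣ x ∩ incident G v ∣
  parity-degree v x = trans
    (sum-cong-≗ λ f → trans (∧-comm (lookup (incident G v) f) _)
                            (sym (lookup-zipWith _∧_ f x (incident G v))))
    (∑-lookup (x ∩ incident G v))

  -- An edge has two different ends, so it is counted twice.
  ends-cancel : ∀ f → ∑ (λ v → lookup (incident G v) f) ≡ false
  ends-cancel f = begin
    ∑ (λ v → lookup (incident G v) f)
      ≡⟨ sum-cong-≗ (λ v → trans (lookup-incident v f) (∨≡xor v)) ⟩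
    ∑ (λ v → does (end₁ G f Fin.≟ v) xor does (end₂ G f Fin.≟ v))
      ≡⟨ ∑-distrib-+ (λ v → does (end₁ G f Fin.≟ v)) (λ v → does (end₂ G f Fin.≟ v)) ⟩
    ∑ (λ v → does (end₁ G f Fin.≟ v)) xor ∑ (λ v → does (end₂ G f Fin.≟ v))
      ≡⟨ cong₂ _xor_ (∑-δ (end₁ G f)) (∑-δ (end₂ G f)) ⟩
    false ∎
    where
    open ≡-Reasoning
    ∑-δ : ∀ u → ∑ (λ v → does (u Fin.≟ v)) ≡ true
    ∑-δ u = trans (∑-single u _ λ v v≢u → dec-false (u Fin.≟ v) (v≢u ∘ sym))
                  (dec-true (u Fin.≟ u) refl)
    ∨≡xor : ∀ v → does (end₁ G f Fin.≟ v) ∨ does (end₂ G f Fin.≟ v)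
                ≡ does (end₁ G f Fin.≟ v) xor does (end₂ G f Fin.≟ v)
    ∨≡xor v with end₁ G f Fin.≟ v | end₂ G f Fin.≟ v
    ... | yes p | yes q = contradiction (trans p (sym q)) (loopless G f)
    ... | yes _ | no _  = refl
    ... | no _  | _     = refl

  handshake : ∀ x → ∑ (λ v → parity v x) ≡ false
  handshake x = trans (∑-comm (λ v f → lookup (incident G v) f ∧ lookup x f))
    (∑-zero _ λ f → begin
      ∑ (λ v → lookup (incident G v) f ∧ lookup x f)
        ≡⟨ sum-cong-≗ (λ v → ∧-comm (lookup (incident G v) f) (lookup x f)) ⟩
      ∑ (λ v → lookup x f ∧ lookup (incident G v) f)
        ≡⟨ *-distribˡ-sum (lookup x f) (λ v → lookup (incident G v) f) ⟨
      lookup x f ∧ ∑ (λ v → lookup (incident G v) f)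
        ≡⟨ cong (lookup x f ∧_) (ends-cancel f) ⟩
      lookup x f ∧ false
        ≡⟨ ∧-zeroʳ _ ⟩
      false ∎)
    where open ≡-Reasoning

  -- By `handshake` the parities add up to zero, so the last one is forced. This settles the
  -- separating vertex, where nothing is known directly.
  Even-except-one : ∀ {x} v → (∀ u → u ≢ v → parity u x ≡ false) → Even x
  Even-except-one {x} v even-off u with u Fin.≟ v
  ... | no u≢v   = even-off u u≢v
  ... | yes refl = trans (sym (∑-single v (λ u → parity u x) even-off)) (handshake x)

  parity-avoids : ∀ {x} v → (∀ {f} → f ∈ x → ¬ f meets v) → parity v x ≡ false
  parity-avoids {x} v avoid = ∑-zero _ λ f → ≢true⇒≡false λ eq →
    avoid {f} (lookup⇒∈ (∧-true₂ _ eq)) (incident⇒meets (lookup⇒∈ (∧-true₁ _ eq)))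
    where
    ∧-true₁ : ∀ a {b} → a ∧ b ≡ true → a ≡ true
    ∧-true₁ true _ = refl
    ∧-true₂ : ∀ a {b} → a ∧ b ≡ true → b ≡ true
    ∧-true₂ true eq = eq

  parity-cong : ∀ {x y} v → (∀ {f} → f meets v → lookup x f ≡ lookup y f) → parity v x ≡ parity v y
  parity-cong {x} {y} v agree = sum-cong-≗ λ f → helper f (lookup (incident G v) f) refl
    where
    helper : ∀ f b → lookup (incident G v) f ≡ b → b ∧ lookup x f ≡ b ∧ lookup y f
    helper f false _  = refl
    helper f true  eq = agree (incident⇒meets (lookup⇒∈ eq))

  cycle-even : (Z : Cycle G) → Even (cycleEdges Z)
  cycle-even Z v with v ∈? vertices (subgraph Z)
  ... | yes v∈Z = trans (parity-degree v (cycleEdges Z)) (cong odd (regular Z v v∈Z))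
  ... | no v∉Z  = parity-avoids v λ f∈Z → λ where
    (inj₁ refl) → v∉Z (proj₁ (closed (subgraph Z) f∈Z))
    (inj₂ refl) → v∉Z (proj₂ (closed (subgraph Z) f∈Z))

  CycleSpace-even : ∀ {x} → CycleSpace G x → Even x
  CycleSpace-even (k , b , c , Zs , refl) = Even-combination c b λ i →
    subst Even (proj₂ (Zs i)) (cycle-even (proj₁ (Zs i)))

  cycle∈CycleSpace : (Z : Cycle G) → CycleSpace G (cycleEdges Z)
  cycle∈CycleSpace Z = 1 , (λ _ → cycleEdges Z) , (λ _ → true) , (λ _ → Z , refl)
    , combination-single (cycleEdges Z)

-- Paths and cycles

ι : Bool → ℕ
ι b = if b then 1 else 0

module _ {k : ℕ} where

  fromList : List (Fin k) → Subset k
  fromList = foldr (λ f x → ⁅ f ⁆ ∪ x) ⊥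

  ∈-fromList⁺ : ∀ {f fs} → f ∈ˡ fs → f ∈ fromList fs
  ∈-fromList⁺ (here refl) = x∈p∪q⁺ (inj₁ (x∈⁅x⁆ _))
  ∈-fromList⁺ (there f∈)  = x∈p∪q⁺ (inj₂ (∈-fromList⁺ f∈))

  ∈-fromList⁻ : ∀ {f} fs → f ∈ fromList fs → f ∈ˡ fs
  ∈-fromList⁻ []       f∈ = contradiction f∈ ∉⊥
  ∈-fromList⁻ (g ∷ fs) f∈ with x∈p∪q⁻ ⁅ g ⁆ (fromList fs) f∈
  ... | inj₁ f∈g  = here (x∈⁅y⁆⇒x≡y g f∈g)
  ... | inj₂ f∈fs = there (∈-fromList⁻ fs f∈fs)

∣insert∩∣ : ∀ {k} (f : Fin k) x q → f ∉ x →
  ∣ (⁅ f ⁆ ∪ x) ∩ q ∣ ≡ ι (lookup q f) + ∣ x ∩ q ∣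
∣insert∩∣ zero (true  ∷ x) q f∉x = contradiction here f∉x
∣insert∩∣ zero (false ∷ x) (b ∷ q) f∉x rewrite ∪-identityˡ x with b
... | true  = refl
... | false = refl
∣insert∩∣ (suc f) (a ∷ x) (b ∷ q) f∉x with a ∧ b | ∣insert∩∣ f x q (f∉x ∘ there)
... | false | eq = eq
... | true  | eq = trans (cong suc eq) (sym (+-suc _ _))

∣insert∣ : ∀ {k} (f : Fin k) x → f ∉ x → ∣ ⁅ f ⁆ ∪ x ∣ ≡ suc ∣ x ∣
∣insert∣ zero    (true  ∷ x) f∉x = contradiction here f∉x
∣insert∣ zero    (false ∷ x) f∉x = cong (suc ∘ ∣_∣) (∪-identityˡ x)
∣insert∣ (suc f) (true  ∷ x) f∉x = cong suc (∣insert∣ f x (f∉x ∘ there))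
∣insert∣ (suc f) (false ∷ x) f∉x = ∣insert∣ f x (f∉x ∘ there)

∣fromList∣ : ∀ {k} {fs : List (Fin k)} → Unique fs → ∣ fromList fs ∣ ≡ length fs
∣fromList∣ {k} {[]}     _         = ∣⊥∣≡0 k
∣fromList∣ {k} {f ∷ fs} (f∉ ∷ un) =
  trans (∣insert∣ f _ (All¬⇒¬Any f∉ ∘ ∈-fromList⁻ fs)) (cong suc (∣fromList∣ un))

unique-length : ∀ {k} {fs : List (Fin k)} → Unique fs → length fs ≤ k
unique-length {fs = fs} un = ≤-trans (≤-reflexive (sym (∣fromList∣ un))) (∣p∣≤n (fromList fs))

occurrences : ∀ {k} → Subset k → List (Fin k) → ℕ
occurrences q []       = 0
occurrences q (f ∷ fs) = ι (lookup q f) + occurrences q fs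

occurrences-++ : ∀ {k} (q : Subset k) fs gs →
  occurrences q (fs ++ gs) ≡ occurrences q fs + occurrences q gs
occurrences-++ q []       gs = refl
occurrences-++ q (f ∷ fs) gs = trans (cong (ι (lookup q f) +_) (occurrences-++ q fs gs))
                                     (sym (+-assoc (ι (lookup q f)) _ _))

∣fromList∩∣ : ∀ {k} {fs : List (Fin k)} q → Unique fs → ∣ fromList fs ∩ q ∣ ≡ occurrences q fs
∣fromList∩∣ {fs = []} q _ = ∣⊥∩∣ q
  where
  ∣⊥∩∣ : ∀ {k} (q : Subset k) → ∣ ⊥ ∩ q ∣ ≡ 0
  ∣⊥∩∣ []      = refl
  ∣⊥∩∣ (_ ∷ q) = ∣⊥∩∣ q
∣fromList∩∣ {fs = f ∷ fs} q (f∉ ∷ un) =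
  trans (∣insert∩∣ f _ q (All¬⇒¬Any f∉ ∘ ∈-fromList⁻ fs)) (cong (ι (lookup q f) +_) (∣fromList∩∣ q un))

occurrences-∉ : ∀ {k} (v : Fin k) vs → v ∉ˡ vs → occurrences ⁅ v ⁆ vs ≡ 0
occurrences-∉ v []       _  = refl
occurrences-∉ v (w ∷ vs) v∉ = cong₂ _+_
  (cong ι (∉⇒lookup (λ w∈ → v∉ (here (sym (x∈⁅y⁆⇒x≡y v w∈)))))) (occurrences-∉ v vs (v∉ ∘ there))

occurrences-∈ : ∀ {k} {v : Fin k} {vs} → Unique vs → v ∈ˡ vs → occurrences ⁅ v ⁆ vs ≡ 1
occurrences-∈ {v = v} {vs = w ∷ vs} (w∉ ∷ un) (here refl) = cong₂ _+_
  (cong ι (∈⇒lookup (x∈⁅x⁆ v))) (occurrences-∉ v vs (All¬⇒¬Any w∉))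
occurrences-∈ {v = v} {vs = w ∷ vs} (w∉ ∷ un) (there v∈) = cong₂ _+_
  (cong ι (∉⇒lookup λ w∈ → All¬⇒¬Any w∉ (subst (_∈ˡ vs) (sym (x∈⁅y⁆⇒x≡y v w∈)) v∈)))
  (occurrences-∈ un v∈)

module Paths {n m : ℕ} (G : Graph n m) where

  Joins : Fin m → Fin n → Fin n → Set
  Joins f u v = (end₁ G f ≡ u × end₂ G f ≡ v) ⊎ (end₁ G f ≡ v × end₂ G f ≡ u)

  joins-sym : ∀ {f u v} → Joins f u v → Joins f v u
  joins-sym = swap

  joins-ends : ∀ f → Joins f (end₁ G f) (end₂ G f)
  joins-ends f = inj₁ (refl , refl)

  joins-≢ : ∀ {f u v} → Joins f u v → u ≢ v
  joins-≢ {f} (inj₁ (refl , q)) eq = loopless G f (trans eq (sym q))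
  joins-≢ {f} (inj₂ (refl , q)) eq = loopless G f (sym (trans q eq))

  joins-meetsˡ : ∀ {f u v} → Joins f u v → _meets_ G f u
  joins-meetsˡ (inj₁ (p , q)) = inj₁ p
  joins-meetsˡ (inj₂ (p , q)) = inj₂ q

  joins-meetsʳ : ∀ {f u v} → Joins f u v → _meets_ G f v
  joins-meetsʳ = joins-meetsˡ ∘ joins-sym

  joins-end : ∀ {f u v w} → Joins f u v → _meets_ G f w → w ≡ u ⊎ w ≡ v
  joins-end (inj₁ (refl , q)) (inj₁ refl) = inj₁ refl
  joins-end (inj₁ (p , refl)) (inj₂ refl) = inj₂ refl
  joins-end (inj₂ (refl , q)) (inj₁ refl) = inj₂ refl
  joins-end (inj₂ (p , refl)) (inj₂ refl) = inj₁ refl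

  other-end : ∀ {f u} → _meets_ G f u → ∃[ v ] Joins f u v
  other-end {f} (inj₁ refl) = end₂ G f , inj₁ (refl , refl)
  other-end {f} (inj₂ refl) = end₁ G f , inj₂ (refl , refl)

  incidence : ∀ {f u v} z → Joins f u v →
    ι (lookup (incident G z) f) ≡ ι (lookup ⁅ z ⁆ u) + ι (lookup ⁅ z ⁆ v)
  incidence {f} {u} {v} z j with u Fin.≟ z | v Fin.≟ z
  ... | yes refl | yes refl = contradiction refl (joins-≢ j)
  ... | yes refl | no v≢z = begin
    ι (lookup (incident G u) f) ≡⟨ cong ι (∈⇒lookup (meets⇒incident G (joins-meetsˡ j))) ⟩
    1 ≡⟨ cong₂ (λ a b → ι a + ι b) (∈⇒lookup (x∈⁅x⁆ u)) (∉⇒lookup (v≢z ∘ x∈⁅y⁆⇒x≡y u)) ⟨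
    _ ∎
    where open ≡-Reasoning
  ... | no u≢z | yes refl = begin
    ι (lookup (incident G v) f) ≡⟨ cong ι (∈⇒lookup (meets⇒incident G (joins-meetsʳ j))) ⟩
    1 ≡⟨ cong₂ (λ a b → ι a + ι b) (∉⇒lookup (u≢z ∘ x∈⁅y⁆⇒x≡y v)) (∈⇒lookup (x∈⁅x⁆ v)) ⟨
    _ ∎
    where open ≡-Reasoning
  ... | no u≢z | no v≢z = begin
    ι (lookup (incident G z) f)
      ≡⟨ cong ι (∉⇒lookup λ f∈ → [ u≢z ∘ sym , v≢z ∘ sym ]′ (joins-end j (incident⇒meets G f∈))) ⟩
    0 ≡⟨ cong₂ (λ a b → ι a + ι b) (∉⇒lookup (u≢z ∘ x∈⁅y⁆⇒x≡y z)) (∉⇒lookup (v≢z ∘ x∈⁅y⁆⇒x≡y z)) ⟨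
    _ ∎
    where open ≡-Reasoning

  data Path (root : Fin n) : Fin n → List (Fin m) → List (Fin n) → Set where
    stop : Path root root [] (root ∷ [])
    step : ∀ {v w f fs vs} → Joins f w v → w ∉ˡ vs → Path root v fs vs → Path root w (f ∷ fs) (w ∷ vs)

  head∈path : ∀ {r v fs vs} → Path r v fs vs → v ∈ˡ vs
  head∈path stop         = here refl
  head∈path (step _ _ _) = here refl

  root∈path : ∀ {r v fs vs} → Path r v fs vs → r ∈ˡ vs
  root∈path stop         = here refl
  root∈path (step _ _ p) = there (root∈path p)

  path-unique : ∀ {r v fs vs} → Path r v fs vs → Unique vs
  path-unique stop          = [] ∷ []
  path-unique (step _ w∉ p) = ¬Any⇒All¬ _ w∉ ∷ path-unique p

  path-ends : ∀ {r v fs vs} → Path r v fs vs → ∀ {f u} → f ∈ˡ fs → _meets_ G f u → u ∈ˡ vs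
  path-ends (step j _ p) (here refl) meets with joins-end j meets
  ... | inj₁ refl = here refl
  ... | inj₂ refl = there (head∈path p)
  path-ends (step _ _ p) (there f∈) meets = there (path-ends p f∈ meets)

  path-unique-edges : ∀ {r v fs vs} → Path r v fs vs → Unique fs
  path-unique-edges stop = []
  path-unique-edges (step j w∉ p) =
    ¬Any⇒All¬ _ (λ f∈ → w∉ (path-ends p f∈ (joins-meetsˡ j))) ∷ path-unique-edges p

  -- An inner vertex of a path meets two of its edges, an end only one. The two indicator terms
  -- supply the missing halves, also for the one-vertex path, where both fall on the same vertex.
  -- When two paths are closed to a cycle, the two cut edges take the place of these terms.
  path-occurrences : ∀ {r v fs vs} z → Path r v fs vs →
    occurrences (incident G z) fs + (ι (lookup ⁅ z ⁆ r) + ι (lookup ⁅ z ⁆ v))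
      ≡ occurrences ⁅ z ⁆ vs + occurrences ⁅ z ⁆ vs
  path-occurrences {r} z stop = doubled (ι (lookup ⁅ z ⁆ r))
    where
    doubled : ∀ a → a + a ≡ (a + 0) + (a + 0)
    doubled = solve-∀
  path-occurrences {r} z (step {v} {w} {f} {fs} {vs} j _ p) = begin
    (i + o) + (δ r + δ w)         ≡⟨ cong (λ i → (i + o) + (δ r + δ w)) (incidence z j) ⟩
    ((δ w + δ v) + o) + (δ r + δ w) ≡⟨ rearrange (δ w) (δ v) o (δ r) ⟩
    (o + (δ r + δ v)) + (δ w + δ w) ≡⟨ cong (_+ (δ w + δ w)) (path-occurrences z p) ⟩
    (ov + ov) + (δ w + δ w)         ≡⟨ rearrange′ ov (δ w) ⟩
    (δ w + ov) + (δ w + ov) ∎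
    where
    open ≡-Reasoning
    δ = λ u → ι (lookup ⁅ z ⁆ u)
    i = ι (lookup (incident G z) f)
    o = occurrences (incident G z) fs
    ov = occurrences ⁅ z ⁆ vs
    rearrange : ∀ w v o r → ((w + v) + o) + (r + w) ≡ (o + (r + v)) + (w + w)
    rearrange = solve-∀
    rearrange′ : ∀ o w → (o + o) + (w + w) ≡ (w + o) + (w + o)
    rearrange′ = solve-∀

  adjacent-sym : ∀ {H : Subgraph G} {u v} → Adjacent H u v → Adjacent H v u
  adjacent-sym (f , f∈ , j) = f , f∈ , joins-sym j

  path-linked : ∀ (H : Subgraph G) {r v fs vs} → Path r v fs vs →
    (∀ {f} → f ∈ˡ fs → f ∈ edges H) → ∀ {u} → u ∈ˡ vs → Star (Adjacent H) u r
  path-linked H stop fs⊆ (here refl) = ε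
  path-linked H (step j _ p) fs⊆ (here refl) =
    (_ , fs⊆ (here refl) , j) ◅ path-linked H p (fs⊆ ∘ there) (head∈path p)
  path-linked H (step j _ p) fs⊆ (there u∈) = path-linked H p (fs⊆ ∘ there) u∈

  truncate : ∀ {r v fs vs z} → Path r v fs vs → z ∈ˡ vs →
    ∃[ fs′ ] ∃[ vs′ ] Path z v fs′ vs′ × (∀ {f} → f ∈ˡ fs′ → f ∈ˡ fs) × (∀ {u} → u ∈ˡ vs′ → u ∈ˡ vs)
  truncate stop (here refl) = _ , _ , stop , id , id
  truncate (step j w∉ p) (here refl) = [] , _ , stop , (λ ()) , λ where (here refl) → here refl
  truncate (step {f = f} j w∉ p) (there z∈) with fs′ , vs′ , q , fs⊆ , vs⊆ ← truncate p z∈ =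
    f ∷ fs′ , _ , step j (w∉ ∘ vs⊆) q
    , (λ where (here refl) → here refl ; (there f∈) → there (fs⊆ f∈))
    , (λ where (here refl) → here refl ; (there u∈) → there (vs⊆ u∈))

  -- A cycle cut at two of its edges, e = ab and f = xy.
  record CutCycle (e f : Fin m) : Set where
    field
      {a b x y} : Fin n
      {fs gs}   : List (Fin m)
      {vs ws}   : List (Fin n)
      path₁     : Path a x fs vs
      path₂     : Path b y gs ws
      joins-e   : Joins e a b
      joins-f   : Joins f x y
      disjoint  : Disjoint vs ws
      e≢f       : e ≢ f

    edgeList : List (Fin m)
    edgeList = f ∷ e ∷ fs ++ gs

    vertexList : List (Fin n)
    vertexList = vs ++ ws

    f∉ : f ∉ˡ fs ++ gs
    f∉ f∈ with ∈-++⁻ fs f∈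
    ... | inj₁ f∈fs = disjoint (path-ends path₁ f∈fs (joins-meetsʳ joins-f) , head∈path path₂)
    ... | inj₂ f∈gs = disjoint (head∈path path₁ , path-ends path₂ f∈gs (joins-meetsˡ joins-f))

    e∉ : e ∉ˡ fs ++ gs
    e∉ e∈ with ∈-++⁻ fs e∈
    ... | inj₁ e∈fs = disjoint (path-ends path₁ e∈fs (joins-meetsʳ joins-e) , root∈path path₂)
    ... | inj₂ e∈gs = disjoint (root∈path path₁ , path-ends path₂ e∈gs (joins-meetsˡ joins-e))

    unique-edgeList : Unique edgeList
    unique-edgeList =
      ((λ f≡e → e≢f (sym f≡e)) ∷ ¬Any⇒All¬ _ f∉) ∷ ¬Any⇒All¬ _ e∉ ∷
      ++⁺ (path-unique-edges path₁) (path-unique-edges path₂) λ (g∈fs , g∈gs) →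
        disjoint (path-ends path₁ g∈fs (inj₁ refl) , path-ends path₂ g∈gs (inj₁ refl))

    private
      open ≡-Reasoning

      twice : ∀ z → occurrences (incident G z) edgeList
                  ≡ occurrences ⁅ z ⁆ vertexList + occurrences ⁅ z ⁆ vertexList
      twice z = begin
        ι (lookup (incident G z) f) + (ι (lookup (incident G z) e) + occurrences (incident G z) (fs ++ gs))
          ≡⟨ cong₂ _+_ (incidence z joins-f)
               (cong₂ _+_ (incidence z joins-e) (occurrences-++ (incident G z) fs gs)) ⟩
        (δ x + δ y) + ((δ a + δ b) + (o₁ + o₂))
          ≡⟨ rearrange (δ x) (δ y) (δ a) (δ b) o₁ o₂ ⟩
        (o₁ + (δ a + δ x)) + (o₂ + (δ b + δ y))
          ≡⟨ cong₂ _+_ (path-occurrences z path₁) (path-occurrences z path₂) ⟩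
        (v₁ + v₁) + (v₂ + v₂)
          ≡⟨ rearrange′ v₁ v₂ ⟩
        (v₁ + v₂) + (v₁ + v₂)
          ≡⟨ cong₂ _+_ (occurrences-++ ⁅ z ⁆ vs ws) (occurrences-++ ⁅ z ⁆ vs ws) ⟨
        _ ∎
        where
        δ = λ u → ι (lookup ⁅ z ⁆ u)
        o₁ = occurrences (incident G z) fs
        o₂ = occurrences (incident G z) gs
        v₁ = occurrences ⁅ z ⁆ vs
        v₂ = occurrences ⁅ z ⁆ ws
        rearrange : ∀ x y a b o₁ o₂ →
          (x + y) + ((a + b) + (o₁ + o₂)) ≡ (o₁ + (a + x)) + (o₂ + (b + y))
        rearrange = solve-∀
        rearrange′ : ∀ v₁ v₂ → (v₁ + v₁) + (v₂ + v₂) ≡ (v₁ + v₂) + (v₁ + v₂)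
        rearrange′ = solve-∀

      endsIn : ∀ {g u} → g ∈ˡ edgeList → _meets_ G g u → u ∈ˡ vertexList
      endsIn (here refl) meets with joins-end joins-f meets
      ... | inj₁ refl = ∈-++⁺ˡ (head∈path path₁)
      ... | inj₂ refl = ∈-++⁺ʳ vs (head∈path path₂)
      endsIn (there (here refl)) meets with joins-end joins-e meets
      ... | inj₁ refl = ∈-++⁺ˡ (root∈path path₁)
      ... | inj₂ refl = ∈-++⁺ʳ vs (root∈path path₂)
      endsIn (there (there g∈)) meets with ∈-++⁻ fs g∈
      ... | inj₁ g∈fs = ∈-++⁺ˡ (path-ends path₁ g∈fs meets)
      ... | inj₂ g∈gs = ∈-++⁺ʳ vs (path-ends path₂ g∈gs meets)

      H : Subgraph G
      H = record
        { vertices = fromList vertexList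
        ; edges    = fromList edgeList
        ; closed   = λ g∈ → let g∈′ = ∈-fromList⁻ edgeList g∈ in
            ∈-fromList⁺ (endsIn g∈′ (inj₁ refl)) , ∈-fromList⁺ (endsIn g∈′ (inj₂ refl))
        }

      rest⊆ : ∀ {g} → g ∈ˡ fs ++ gs → g ∈ edges H
      rest⊆ g∈ = ∈-fromList⁺ {fs = edgeList} (there (there g∈))

      to-a : ∀ {u} → u ∈ vertices H → Star (Adjacent H) u a
      to-a u∈ with ∈-++⁻ vs (∈-fromList⁻ vertexList u∈)
      ... | inj₁ u∈vs = path-linked H path₁ (λ g∈ → rest⊆ (∈-++⁺ˡ g∈)) u∈vs
      ... | inj₂ u∈ws = path-linked H path₂ (λ g∈ → rest⊆ (∈-++⁺ʳ fs g∈)) u∈ws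
                        ◅◅ (e , ∈-fromList⁺ {fs = edgeList} (there (here refl)) , joins-sym joins-e) ◅ ε

    cycle : Cycle G
    cycle = record
      { subgraph  = H
      ; connected = (a , ∈-fromList⁺ (∈-++⁺ˡ (root∈path path₁)))
                  , λ u∈ v∈ → to-a u∈ ◅◅ reverse (adjacent-sym {H}) (to-a v∈)
      ; regular   = λ v v∈ → trans (∣fromList∩∣ (incident G v) unique-edgeList)
          (trans (twice v) (cong (λ k → k + k) (occurrences-∈
            (++⁺ (path-unique path₁) (path-unique path₂) disjoint) (∈-fromList⁻ vertexList v∈))))
      }

    cycle-enumerated : Enumerates edgeList (cycleEdges cycle)
    cycle-enumerated = unique-edgeList , λ g → mk⇔ ∈-fromList⁺ (∈-fromList⁻ edgeList)

  -- Cycles in an edge set with at most one dead end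

  module _ (W : Subset m) (x₀ : Fin n)
           (extend : ∀ {z g} → z ≢ x₀ → g ∈ W → _meets_ G g z → ∃[ h ] h ∈ W × h ≢ g × _meets_ G h z)
           where

    private
      grow : ∀ k {w g fs vs} → suc n ≤ k + length vs →
        Path x₀ w (g ∷ fs) vs → (∀ {f} → f ∈ˡ g ∷ fs → f ∈ W) → ∃[ Z ] (∀ {f} → f ∈ cycleEdges {G = G} Z → f ∈ W)
      grow zero bound p fs⊆ = contradiction (≤-trans bound (unique-length (path-unique p))) 1+n≰n
      grow (suc k) {w} {g} {fs} bound p@(step {v} {vs = vs} j w∉ q) fs⊆
        with h , h∈W , h≢g , h-w ← extend {w} (λ where refl → w∉ (root∈path q)) (fs⊆ (here refl)) (joins-meetsˡ j)
        with z , jz ← other-end h-w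
        with DecMembership._∈?_ Fin._≟_ z vs
      -- The walk returns to `z`. The piece of path from `v` to `z` is closed by `g` and `h` through
      -- `w`; the second path of the cut consists of `w` alone.
      ... | yes z∈ with fs′ , vs′ , q′ , fs′⊆ , vs′⊆ ← truncate q z∈ = CutCycle.cycle cut , edges⊆
        where
        cut : CutCycle h g
        cut = record
          { path₁ = q′ ; path₂ = stop {w} ; joins-e = joins-sym jz ; joins-f = joins-sym j
          ; disjoint = λ where (u∈ , here refl) → w∉ (vs′⊆ u∈)
          ; e≢f = h≢g }
        edges⊆ : ∀ {f} → f ∈ cycleEdges (CutCycle.cycle cut) → f ∈ W
        edges⊆ f∈ with ∈-fromList⁻ (CutCycle.edgeList cut) f∈
        ... | here refl = fs⊆ (here refl)
        ... | there (here refl) = h∈W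
        ... | there (there f∈′) with ∈-++⁻ fs′ f∈′
        ...   | inj₁ f∈fs′ = fs⊆ (there (fs′⊆ f∈fs′))
      grow (suc k) {w} {g} {fs} bound p@(step {v} {vs = vs} j w∉ q) fs⊆ | no z∉ =
        grow k (≤-trans bound (≤-reflexive (sym (+-suc k _))))
          (step (joins-sym jz) (λ where (here refl) → joins-≢ jz refl
                                        (there z∈) → z∉ z∈) p)
          (λ where (here refl) → h∈W ; (there f∈) → fs⊆ f∈)

    -- A path from `x₀` can be prolonged inside `W` at its other end until it meets itself, which
    -- happens within `n` steps. Only `x₀` may be a dead end, and the path never has to continue
    -- there.
    cycle-within : ∀ {g} → g ∈ W → _meets_ G g x₀ → ∃[ Z ] (∀ {f} → f ∈ cycleEdges {G = G} Z → f ∈ W)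
    cycle-within g∈W g-x₀ with v , j ← other-end g-x₀ =
      grow n (≤-trans (m≤n⇒m≤1+n (≤-reflexive (+-comm 1 n))) (≤-reflexive (sym (+-suc n 1))))
        (step (joins-sym j) (λ where (here refl) → joins-≢ j refl) stop)
        (λ where (here refl) → g∈W)

-- The 2-core

∈⇒∣∣>0 : ∀ {k} {x : Fin k} {p} → x ∈ p → 0 < ∣ p ∣
∈⇒∣∣>0 x∈p = ≤-trans (s≤s z≤n) (x∈p⇒∣p-x∣<∣p∣ x∈p)

∣∣>0⇒nonempty : ∀ {k} (p : Subset k) → 0 < ∣ p ∣ → Nonempty p
∣∣>0⇒nonempty {k} p 0<∣p∣ with nonempty? p
... | yes ne = ne
... | no em  = contradiction (subst (0 <_) (trans (cong ∣_∣ (Empty-unique em)) (∣⊥∣≡0 k)) 0<∣p∣) λ ()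

x∉p-x : ∀ {k} {x : Fin k} {p} → x ∉ p - x
x∉p-x {x = zero}  {_ Vec.∷ _} ()
x∉p-x {x = suc x} {_ Vec.∷ _} (Vec.there x∈) = x∉p-x x∈

second-element : ∀ {k} {g : Fin k} (p : Subset k) → 2 ≤ ∣ p ∣ → ∃[ h ] h ∈ p × h ≢ g
second-element {g = g} p 2≤ with Fin.any? (λ h → (h ∈? p) ×-dec ¬? (h Fin.≟ g))
... | yes found = found
... | no none   = contradiction (≤-trans 2≤ (≤-trans (p⊆q⇒∣p∣≤∣q∣ p⊆⁅g⁆) (≤-reflexive (∣⁅x⁆∣≡1 g)))) 1+n≰n
  where
  p⊆⁅g⁆ : p ⊆ ⁅ g ⁆
  p⊆⁅g⁆ {h} h∈p with h Fin.≟ g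
  ... | yes refl = x∈⁅x⁆ g
  ... | no h≢g   = contradiction (h , h∈p , h≢g) none

module Core {n m : ℕ} (G : Graph n m) where
  open Paths G

  private
    infix 4 _∙_
    _∙_ : Fin m → Fin n → Set
    f ∙ v = _meets_ G f v

  cycle-nonempty : (Z : Cycle G) → Nonempty (cycleEdges Z)
  cycle-nonempty Z =
    let v , v∈Z = proj₁ (connected Z)
        f , f∈  = ∣∣>0⇒nonempty _ (≤-trans (s≤s z≤n) (≤-reflexive (sym (regular Z v v∈Z))))
    in  f , proj₁ (x∈p∩q⁻ _ _ f∈)

  meets∈vertices : (H : Subgraph G) → ∀ {f v} → f ∈ edges H → f ∙ v → v ∈ vertices H
  meets∈vertices H f∈H (inj₁ refl) = proj₁ (closed H f∈H)
  meets∈vertices H f∈H (inj₂ refl) = proj₂ (closed H f∈H)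

  module _ (Z : Cycle G) {x : Subset m} (x⊆Z : x ⊆ cycleEdges Z) (even : Even G x) where

    private
      Touched : Fin n → Set
      Touched u = ∃[ f ] f ∈ x × f ∙ u

      full : ∀ {u} → Touched u → ∀ {g} → g ∈ cycleEdges Z → g ∙ u → g ∈ x
      full {u} (f , f∈x , f∙u) {g} g∈Z g∙u with g ∈? x
      ... | yes g∈x = g∈x
      ... | no g∉x  = contradiction (trans (sym (parity-degree G u x)) (even u))
                                    (odd-one (∈⇒∣∣>0 (x∈p∩q⁺ (f∈x , meets⇒incident G f∙u))) small)
        where
        odd-one : ∀ {k} → 0 < k → k < 2 → odd k ≢ false
        odd-one (s≤s z≤n) (s≤s (s≤s z≤n)) ()
        small : ∣ x ∩ incident G u ∣ < 2
        small = <-≤-trans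
          (p⊂q⇒∣p∣<∣q∣ ( (λ h∈ → let h∈x , h∈u = x∈p∩q⁻ _ _ h∈ in x∈p∩q⁺ (x⊆Z h∈x , h∈u))
                       , g , x∈p∩q⁺ (g∈Z , meets⇒incident G g∙u) , g∉x ∘ proj₁ ∘ x∈p∩q⁻ _ _))
          (≤-reflexive (regular Z u (meets∈vertices (subgraph Z) g∈Z g∙u)))

      spread : ∀ {u w} → Star (Adjacent (subgraph Z)) u w → Touched u → Touched w
      spread ε                     tu = tu
      spread ((h , h∈Z , j) ◅ path) tu =
        spread path (h , full tu h∈Z (joins-meetsˡ j) , joins-meetsʳ j)

    -- At a vertex touched by `x` the cycle has two edges, at least one of them in `x`, so evenness
    -- forces both into `x`. Connectedness carries this around the cycle.
    even-part-of-cycle : Nonempty x → cycleEdges Z ⊆ x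
    even-part-of-cycle (f , f∈x) {g} g∈Z = full
      (spread (proj₂ (connected Z) (proj₁ (closed (subgraph Z) (x⊆Z f∈x)))
                                   (proj₁ (closed (subgraph Z) g∈Z)))
              (f , f∈x , inj₁ refl))
      g∈Z (inj₁ refl)

  -- Vertex sets separated by one vertex

  touching : Subset n → Subset m
  touching K = Vec.tabulate λ f → lookup K (end₁ G f) ∨ lookup K (end₂ G f)

  touching⁺ : ∀ {K f u} → u ∈ K → f ∙ u → f ∈ touching K
  touching⁺ {K} {f} u∈K (inj₁ refl) = lookup⇒∈ (trans (lookup∘tabulate _ f)
    (cong (_∨ lookup K (end₂ G f)) (∈⇒lookup u∈K)))
  touching⁺ {K} {f} u∈K (inj₂ refl) = lookup⇒∈ (trans (lookup∘tabulate _ f)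
    (trans (cong (lookup K (end₁ G f) ∨_) (∈⇒lookup u∈K)) (∨-zeroʳ _)))

  touching⁻ : ∀ {K f} → f ∈ touching K → ∃[ u ] u ∈ K × f ∙ u
  touching⁻ {K} {f} f∈ with lookup K (end₁ G f) in eq₁ | lookup K (end₂ G f) in eq₂
                        | trans (sym (lookup∘tabulate (λ f → lookup K (end₁ G f) ∨ lookup K (end₂ G f)) f)) (∈⇒lookup f∈)
  ... | true  | _    | _ = _ , lookup⇒∈ eq₁ , inj₁ refl
  ... | false | true | _ = _ , lookup⇒∈ eq₂ , inj₂ refl
  ... | false | false | ()

  -- `v` separates `K` from the rest of `H`. Edges to `v` may be missing altogether, so the same
  -- notion refutes both disconnectedness of `H` and a cut vertex.
  AttachedAt : Subgraph G → Subset n → Fin n → Set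
  AttachedAt H K v = ∀ {f u w} → f ∈ edges H → u ∈ K → f ∙ u → f ∙ w → w ∈ K ⊎ w ≡ v

  module _ {H : Subgraph G} {K : Subset n} {v : Fin n} (attached : AttachedAt H K v) where

    rooted-avoids : ∀ {e r} → e ∙ r → r ∉ K → r ≢ v →
      (Z : Cycle G) → cycleEdges Z ⊆ edges H → e ∈ cycleEdges Z →
      ∀ {f} → f ∈ touching K → f ∉ cycleEdges Z
    rooted-avoids {e} e∙r r∉K r≢v Z Z⊆H e∈Z {f} f∈K f∈Z =
      let u , u∈K , e∙u = touching⁻ (x⊆K (even-part-of-cycle Z x⊆Z x-even (f , x∈p∩q⁺ (f∈Z , f∈K)) e∈Z))
      in  [ r∉K , r≢v ]′ (attached (Z⊆H e∈Z) u∈K e∙u e∙r)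
      where
      x = cycleEdges Z ∩ touching K
      x⊆Z : x ⊆ cycleEdges Z
      x⊆Z = proj₁ ∘ x∈p∩q⁻ _ _
      x⊆K : x ⊆ touching K
      x⊆K = proj₂ ∘ x∈p∩q⁻ (cycleEdges Z) _
      -- In `K` the parities are those of `Z`; outside `K` and away from `v` no edge of `x` arrives;
      -- `v` itself is left to handshaking.
      x-even : Even G x
      x-even = Even-except-one G {x} v λ u u≢v → off u u≢v
        where
        off : ∀ u → u ≢ v → parity G u x ≡ false
        off u u≢v with u ∈? K
        ... | yes u∈K = trans (parity-cong G {x} {cycleEdges Z} u λ {g} g∙u → agree g (touching⁺ u∈K g∙u)) (cycle-even G Z u)
          where
          agree : ∀ g → g ∈ touching K → lookup x g ≡ lookup (cycleEdges Z) g
          agree g g∈ with g ∈? cycleEdges Z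
          ... | yes g∈Z = trans (∈⇒lookup (x∈p∩q⁺ (g∈Z , g∈))) (sym (∈⇒lookup g∈Z))
          ... | no g∉Z  = trans (∉⇒lookup (g∉Z ∘ x⊆Z)) (sym (∉⇒lookup g∉Z))
        ... | no u∉K = parity-avoids G {x} u λ g∈x g∙u →
          let w , w∈K , g∙w = touching⁻ (x⊆K g∈x)
          in  [ u∉K , u≢v ]′ (attached (Z⊆H (x⊆Z g∈x)) w∈K g∙w g∙u)

    -- The edges of `H` touching `K` can have a dead end only at `v`. If one of them meets `v`, the
    -- walk starts there; otherwise all their ends lie in `K` and any start will do.
    cycle-touching : (∀ u → u ∈ vertices H → 2 ≤ degree H u) → K ⊆ vertices H → Nonempty K →
      ∃[ Z ] (∀ {f} → f ∈ cycleEdges {G = G} Z → f ∈ edges H ∩ touching K)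
    cycle-touching deg K⊆H (u , u∈K) with Fin.any? (λ g → (g ∈? W) ×-dec (g ∈? incident G v))
      where W = edges H ∩ touching K
    ... | yes (g , g∈W , g∈v) = cycle-within W v extend g∈W (incident⇒meets G g∈v)
      where
      W = edges H ∩ touching K
      extend : ∀ {z g} → z ≢ v → g ∈ W → g ∙ z → ∃[ h ] h ∈ W × h ≢ g × h ∙ z
      extend {z} {g} z≢v g∈W g∙z with g∈H , g∈K ← x∈p∩q⁻ _ _ g∈W
        with w , w∈K , g∙w ← touching⁻ g∈K with attached g∈H w∈K g∙w g∙z
      ... | inj₂ z≡v = contradiction z≡v z≢v
      ... | inj₁ z∈K =
        let h , h∈ , h≢g = second-element (edges H ∩ incident G z) (deg z (K⊆H z∈K))
            h∈H , h∈z = x∈p∩q⁻ _ _ h∈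
            h∙z = incident⇒meets G h∈z
        in  h , x∈p∩q⁺ (h∈H , touching⁺ z∈K h∙z) , h≢g , h∙z
    ... | no none =
        let g , g∈ = ∣∣>0⇒nonempty (edges H ∩ incident G u) (≤-trans (n≤1+n 1) (deg u (K⊆H u∈K)))
            g∈H , g∈u = x∈p∩q⁻ _ _ g∈
            g∙u = incident⇒meets G g∈u
        in  cycle-within W u extend (x∈p∩q⁺ (g∈H , touching⁺ u∈K g∙u)) g∙u
      where
      W = edges H ∩ touching K
      extend : ∀ {z g} → z ≢ u → g ∈ W → g ∙ z → ∃[ h ] h ∈ W × h ≢ g × h ∙ z
      extend {z} {g} _ g∈W g∙z with g∈H , g∈K ← x∈p∩q⁻ _ _ g∈W
        with w , w∈K , g∙w ← touching⁻ g∈K with attached g∈H w∈K g∙w g∙z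
      ... | inj₂ refl = contradiction (g , g∈W , meets⇒incident G g∙z) none
      ... | inj₁ z∈K =
        let h , h∈ , h≢g = second-element (edges H ∩ incident G z) (deg z (K⊆H z∈K))
            h∈H , h∈z = x∈p∩q⁻ _ _ h∈
            h∙z = incident⇒meets G h∈z
        in  h , x∈p∩q⁺ (h∈H , touching⁺ z∈K h∙z) , h≢g , h∙z

  record Component (D : Subgraph G) (u : Fin n) : Set where
    field
      members   : Subset n
      root∈     : u ∈ members
      inside    : members ⊆ vertices D
      saturated : ∀ {f w z} → f ∈ edges D → w ∈ members → f ∙ w → f ∙ z → z ∈ members
      linked    : ∀ {w} → w ∈ members → Star (Adjacent D) u w

  component : (D : Subgraph G) → ∀ {u} → u ∈ vertices D → Component D u
  component D {u} u∈D = grow n ⁅ u ⁆ (≤-trans (≤-reflexive (+-comm 1 n)) (≤-reflexive (cong (n +_) (sym (∣⁅x⁆∣≡1 u)))))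
      (x∈⁅x⁆ u) (λ w∈ → subst (_∈ vertices D) (sym (x∈⁅y⁆⇒x≡y u w∈)) u∈D)
      (λ w∈ → subst (Star (Adjacent D) u) (sym (x∈⁅y⁆⇒x≡y u w∈)) ε)
    where
    Leaves : Subset n → Fin m → Set
    Leaves K f = f ∈ edges D × ((end₁ G f ∈ K × end₂ G f ∉ K) ⊎ (end₂ G f ∈ K × end₁ G f ∉ K))
    grow : ∀ k K → suc n ≤ k + ∣ K ∣ → u ∈ K → K ⊆ vertices D →
      (∀ {w} → w ∈ K → Star (Adjacent D) u w) → Component D u
    grow zero K bound _ _ _ = contradiction (≤-trans bound (∣p∣≤n K)) 1+n≰n
    grow (suc k) K bound u∈K K⊆D links
      with Fin.any? {P = Leaves K} (λ f → (f ∈? edges D) ×-dec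
             (((end₁ G f ∈? K) ×-dec ¬? (end₂ G f ∈? K)) ⊎-dec ((end₂ G f ∈? K) ×-dec ¬? (end₁ G f ∈? K))))
    ... | no none = record
      { members = K ; root∈ = u∈K ; inside = K⊆D ; linked = links
      ; saturated = λ {f} {w} {z} → stays {f} {w} {z} }
      where
      stays : ∀ {f w z} → f ∈ edges D → w ∈ K → f ∙ w → f ∙ z → z ∈ K
      stays {f} {w} {z} f∈D w∈K f∙w f∙z with z ∈? K
      ... | yes z∈K = z∈K
      ... | no z∉K with f∙w | f∙z
      ...   | inj₁ refl | inj₁ refl = w∈K
      ...   | inj₂ refl | inj₂ refl = w∈K
      ...   | inj₁ refl | inj₂ refl = contradiction (f , f∈D , inj₁ (w∈K , z∉K)) none
      ...   | inj₂ refl | inj₁ refl = contradiction (f , f∈D , inj₂ (w∈K , z∉K)) none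
    ... | yes (f , f∈D , leaves) = absorb leaves
      where
      add : ∀ {w z} → w ∈ K → z ∉ K → Joins f w z → Component D u
      add {w} {z} w∈K z∉K j = grow k (⁅ z ⁆ ∪ K)
        (≤-trans bound (≤-reflexive (trans (sym (+-suc k _)) (cong (k +_) (sym (∣insert∣ z K z∉K))))))
        (x∈p∪q⁺ (inj₂ u∈K))
        (λ y∈ → [ (λ y∈z → subst (_∈ vertices D) (sym (x∈⁅y⁆⇒x≡y z y∈z)) (meets∈vertices D f∈D (joins-meetsʳ j)))
                , K⊆D ]′ (x∈p∪q⁻ ⁅ z ⁆ K y∈))
        (λ y∈ → [ (λ y∈z → subst (Star (Adjacent D) u) (sym (x∈⁅y⁆⇒x≡y z y∈z)) (links w∈K ◅◅ (f , f∈D , j) ◅ ε))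
                , links ]′ (x∈p∪q⁻ ⁅ z ⁆ K y∈))
      absorb : (end₁ G f ∈ K × end₂ G f ∉ K) ⊎ (end₂ G f ∈ K × end₁ G f ∉ K) → Component D u
      absorb (inj₁ (w∈K , z∉K)) = add w∈K z∉K (joins-ends f)
      absorb (inj₂ (w∈K , z∉K)) = add w∈K z∉K (joins-sym (joins-ends f))

  -- A rooted basis makes the core 2-connected

  two-core : ∃[ H ] IsTwoCore G H
  two-core = prune-all (suc ∣ vertices (whole G) ∣) (whole G) ≤-refl ε
    where
    prune-all : ∀ k H → ∣ vertices H ∣ < k → Star _⟶_ (whole G) H → ∃[ H ] IsTwoCore G H
    prune-all (suc k) H bound pruned
      with Fin.any? (λ v → (v ∈? vertices H) ×-dec (degree H v ≤? 1))
    ... | no none = H , pruned , λ v v∈H → ≰⇒> λ d≤1 → none (v , v∈H , d≤1)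
    ... | yes (v , v∈H , d≤1) = prune-all k (delete H v)
      (≤-trans (x∈p⇒∣p-x∣<∣p∣ v∈H) (≤-pred bound)) (pruned ◅◅ prune v∈H d≤1 ◅ ε)

  -- A vertex of `Z` has degree at least two in every subgraph that still contains `Z`, so pruning
  -- never takes it.
  cycle-survives : (Z : Cycle G) → ∀ {H H′ : Subgraph G} → Star _⟶_ H H′ →
    cycleEdges Z ⊆ edges H → cycleEdges Z ⊆ edges H′
  cycle-survives Z ε Z⊆H = Z⊆H
  cycle-survives Z {H} (prune {v = v} v∈H d≤1 ◅ rest) Z⊆H = cycle-survives Z rest λ {f} f∈Z →
    x∈p∩q⁺ (Z⊆H f∈Z , x∉p⇒x∈∁p λ f∈v →
      1+n≰n (≤-trans (≤-reflexive (sym (regular Z v (meets∈vertices (subgraph Z) f∈Z (incident⇒meets G f∈v)))))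
        (≤-trans (p⊆q⇒∣p∣≤∣q∣ λ g∈ → let g∈Z , g∈v = x∈p∩q⁻ _ _ g∈ in x∈p∩q⁺ (Z⊆H g∈Z , g∈v)) d≤1)))

  cycle⊆core : (Z : Cycle G) → ∀ {H : Subgraph G} → IsTwoCore G H → cycleEdges Z ⊆ edges H
  cycle⊆core Z (pruned , _) = cycle-survives Z pruned (λ _ → ∈⊤)

  module _ (e : Fin m) (B : List (Cycle G)) (basis : IsRootedCycleBasis G e B)
           {H : Subgraph G} (core : IsTwoCore G H) where

    private
      spans = proj₂ (proj₂ (proj₁ basis))
      rooted : ∀ i → e ∈ cycleEdges (List.lookup B i)
      rooted i = All.lookup (proj₂ basis) (∈-lookup i)

    no-component : ∀ {K v r} → AttachedAt H K v → e ∙ r → r ∉ K → r ≢ v → K ⊆ vertices H → ¬ Nonempty K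
    no-component {K} {v} attached e∙r r∉K r≢v K⊆H nonempty
      with Z , Z⊆ ← cycle-touching {H = H} attached (proj₂ core) K⊆H nonempty
      with f , f∈Z ← cycle-nonempty Z
      with c , eq ← spans (cycleEdges Z) (cycle∈CycleSpace G Z) =
      combination-avoids c _ f
        (λ i → rooted-avoids {H = H} attached e∙r r∉K r≢v (List.lookup B i)
                 (cycle⊆core (List.lookup B i) core) (rooted i) (proj₂ (x∈p∩q⁻ _ _ (Z⊆ f∈Z))))
        (subst (f ∈_) (sym eq) f∈Z)

    -- Stated for `D` so as to serve the core and the core without `v` alike. By `cover`, edges of
    -- `H` missing in `D` lead to `v`; hence a component of `D` that misses the end `r` of `e` would
    -- be attached at `v`.
    linked-avoiding : ∀ {v r} (D : Subgraph G) → vertices D ⊆ vertices H →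
      (∀ {u f} → u ∈ vertices D → f ∈ edges H → f ∙ u → f ∈ edges D ⊎ (f ∙ v × u ≢ v)) →
      e ∙ r → r ≢ v → Linked D
    linked-avoiding {v} {r} D D⊆H cover e∙r r≢v u∈D w∈D =
      to-r u∈D ◅◅ reverse (adjacent-sym {D}) (to-r w∈D)
      where
      to-r : ∀ {u} → u ∈ vertices D → Star (Adjacent D) u r
      to-r {u} u∈D with r ∈? Component.members (component D u∈D)
      ... | yes r∈K = Component.linked (component D u∈D) r∈K
      ... | no r∉K = contradiction (u , root∈) (no-component attached e∙r r∉K r≢v (D⊆H ∘ inside))
        where
        open Component (component D u∈D)
        attached : AttachedAt H members v
        attached {f} {u} {w} f∈H u∈K f∙u f∙w with cover (inside u∈K) f∈H f∙u
        ... | inj₁ f∈D = inj₁ (saturated f∈D u∈K f∙u f∙w)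
        ... | inj₂ (f∙v , u≢v) with u′ , j ← other-end f∙u with joins-end j f∙w | joins-end j f∙v
        ...   | inj₁ refl | _         = inj₁ u∈K
        ...   | inj₂ refl | inj₂ refl = inj₂ refl
        ...   | inj₂ refl | inj₁ refl = contradiction refl u≢v

    core-two-connected : e ∈ edges H → TwoVertexConnected H
    core-two-connected e∈H =
      ((end₁ G e , proj₁ (closed H e∈H)) ,
       -- Nothing is deleted, so any vertex other than `r` can stand for `v`; the other end of `e`
       -- is at hand.
       linked-avoiding H id (λ _ f∈H _ → inj₁ f∈H) (inj₁ refl) (loopless G e)) ,
      λ v v∈H → linked-delete v
      where
      module _ (v : Fin n) where
        cover : ∀ {u f} → u ∈ vertices (delete H v) → f ∈ edges H → f ∙ u →
          f ∈ edges (delete H v) ⊎ (f ∙ v × u ≢ v)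
        cover {u} {f} u∈ f∈H f∙u with f ∈? incident G v
        ... | no f∉v  = inj₁ (x∈p∩q⁺ (f∈H , x∉p⇒x∈∁p f∉v))
        ... | yes f∈v = inj₂ (incident⇒meets G f∈v , λ where refl → x∉p-x u∈)
        linked-delete : Linked (delete H v)
        -- As `e` is not a loop, one of its ends survives the deletion and can serve as `r`.
        linked-delete with end₁ G e Fin.≟ v
        ... | no s≢v   = linked-avoiding (delete H v) (p─q⊆p _ _) cover (inj₁ refl) s≢v
        ... | yes refl = linked-avoiding (delete H v) (p─q⊆p _ _) cover (inj₂ refl) (loopless G e ∘ sym)

  empty-basis⇒acyclic : IsCycleBasis G [] → ¬ Cycle G
  empty-basis⇒acyclic (_ , _ , spans) Z with f , f∈Z ← cycle-nonempty Z
    with c , eq ← spans (cycleEdges Z) (cycle∈CycleSpace G Z) =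
    contradiction (subst (f ∈_) (sym eq) f∈Z) (combination-avoids c (cycleEdges ∘ List.lookup {A = Cycle G} []) f λ ())

  rooted-basis⇒two-connected-core : ∀ e → Cycle G → HasRootedCycleBasis G e → RootInTwoConnectedCore G e
  rooted-basis⇒two-connected-core e Z ([] , basis) = contradiction Z (empty-basis⇒acyclic (proj₁ basis))
  rooted-basis⇒two-connected-core e _ (B@(Z ∷ _) , basis) with H , core ← two-core =
    H , core , e∈H , core-two-connected e B basis core e∈H
    where e∈H = cycle⊆core Z core (All.head (proj₂ basis))

  core-or-acyclic : ∀ e → HasRootedCycleBasis G e → RootInTwoConnectedCore G e ⊎ ¬ Cycle G
  core-or-acyclic e ([] , basis)           = inj₂ (empty-basis⇒acyclic (proj₁ basis))
  core-or-acyclic e basis@((Z ∷ _) , _) = inj₁ (rooted-basis⇒two-connected-core e Z basis)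

-- st-numberings

module _ {n m : ℕ} (G : Graph n m) where
  open Paths G

  -- The walk as the machine performs it, by following pointers. `Path` forgets that its edges come
  -- from pointers, `Chase` forgets the vertices passed, so a `Descent` carries both.
  data Chase (next : Fin n → Fin n) (nextEdge : Fin n → Fin m) (root : Fin n) :
             Fin n → List (Fin m) → Set where
    stop : Chase next nextEdge root root []
    step : ∀ {v fs} → v ≢ root → Chase next nextEdge root (next v) fs →
           Chase next nextEdge root v (nextEdge v ∷ fs)

  -- The strict fall of `μ` gives termination, distinct vertices and the bound on the length at
  -- once. It is used with ranks towards `s` and with heights towards `t`.
  module Descend (next : Fin n → Fin n) (nextEdge : Fin n → Fin m) (root : Fin n)
                 (Ok : Fin n → Set) (μ : Fin n → ℕ)
                 (descends : ∀ v → Ok v → v ≢ root →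
                    Joins (nextEdge v) v (next v) × Ok (next v) × μ (next v) < μ v) where

    record Descent (v : Fin n) : Set where
      field
        {fs}       : List (Fin m)
        {vs}       : List (Fin n)
        chase      : Chase next nextEdge root v fs
        path       : Path root v fs vs
        below      : ∀ {u} → u ∈ˡ vs → Ok u × μ u ≤ μ v
        from-below : ∀ {f} → f ∈ˡ fs → ∃[ u ] u ∈ˡ vs × u ≢ root × f ≡ nextEdge u
        short      : length fs ≤ μ v

    private
      descend-within : ∀ k v → μ v < k → Ok v → Descent v
      descend-within (suc k) v μ<k ok with v Fin.≟ root
      ... | yes refl = record
        { chase = stop ; path = stop ; below = λ where (here refl) → ok , ≤-refl
        ; from-below = λ () ; short = z≤n }
      ... | no v≢root with j , ok′ , μ′< ← descends v ok v≢root
        with d ← descend-within k (next v) (<-≤-trans μ′< (≤-pred μ<k)) ok′ = record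
        { chase = step v≢root (Descent.chase d)
        ; path  = step j (λ v∈ → n≮n _ (<-≤-trans μ′< (proj₂ (Descent.below d v∈)))) (Descent.path d)
        ; below = λ where
            (here refl) → ok , ≤-refl
            (there u∈)  → let ok-u , μ≤ = Descent.below d u∈ in ok-u , ≤-trans μ≤ (<⇒≤ μ′<)
        ; from-below = λ where
            (here refl) → v , here refl , v≢root , refl
            (there f∈)  → let u , u∈ , rest = Descent.from-below d f∈ in u , there u∈ , rest
        ; short = ≤-trans (s≤s (Descent.short d)) μ′< }

    descend : ∀ v → Ok v → Descent v
    descend v = descend-within (suc (μ v)) v ≤-refl

  -- An st-numbering of part of the graph: rank 0 marks the vertices left out.
  record Numbering (e : Fin m) : Set where
    field
      rank              : Fin n → ℕ
      low high          : Fin n → Fin n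
      lowEdge highEdge  : Fin n → Fin m
      rank-s         : rank (end₁ G e) ≡ 1
      rank-injective : ∀ {u v} → 0 < rank u → rank u ≡ rank v → u ≡ v
      rank≤rank-t    : ∀ v → rank v ≤ rank (end₂ G e)
      low-joins      : ∀ v → 0 < rank v → v ≢ end₁ G e →
                       Joins (lowEdge v) v (low v) × 0 < rank (low v) × rank (low v) < rank v
      high-joins     : ∀ v → 0 < rank v → v ≢ end₂ G e →
                       Joins (highEdge v) v (high v) × 0 < rank (high v) × rank v < rank (high v)
      lowEdge-t      : lowEdge (end₂ G e) ≡ e

  -- Chords and the basis made of their cycles

  module Chords {e : Fin m} (numbering : Numbering e) where
    open Numbering numbering

    s t : Fin n
    s = end₁ G e
    t = end₂ G e

    Member : Fin n → Set
    Member v = 0 < rank v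

    height : Fin n → ℕ
    height v = rank t ∸ rank v

    rises : ∀ v → Member v → v ≢ t →
      Joins (highEdge v) v (high v) × Member (high v) × height (high v) < height v
    rises v 0<v v≢t = let j , 0<h , v<h = high-joins v 0<v v≢t in
      j , 0<h , ∸-monoʳ-< v<h (rank≤rank-t _)

    module Down = Descend low lowEdge s Member rank low-joins
    module Up = Descend high highEdge t Member height rises

    record Chord : Set where
      field
        edge      : Fin m
        lower upper : Fin n
        joins     : Joins edge lower upper
        0<lower   : 0 < rank lower
        lower<upper : rank lower < rank upper
        not-low   : edge ≢ lowEdge upper

      0<upper : 0 < rank upper
      0<upper = <-trans 0<lower lower<upper

      -- This is where `lowEdge-t` counts: `e` ends in `t`, which is too high to be a lower end and,
      -- as an upper end, has `e` for its low edge.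
      e≢edge : e ≢ edge
      e≢edge e≡ with joins-end joins (subst (λ f → _meets_ G f t) e≡ (inj₂ refl))
      ... | inj₁ t≡lower = n≮n _ (<-≤-trans (subst (λ v → rank v < rank upper) (sym t≡lower) lower<upper) (rank≤rank-t upper))
      ... | inj₂ t≡upper = not-low (trans (sym e≡) (trans (sym lowEdge-t) (cong lowEdge t≡upper)))

      down : Down.Descent lower
      down = Down.descend lower 0<lower
      up : Up.Descent upper
      up = Up.descend upper 0<upper

      upper≤ : ∀ {u} → u ∈ˡ Up.Descent.vs up → rank upper ≤ rank u
      upper≤ u∈ = ∸-cancelʳ-≤ (rank≤rank-t upper) (proj₂ (Up.Descent.below up u∈))

      cut : CutCycle e edge
      cut = record
        { path₁ = Down.Descent.path down
        ; path₂ = Up.Descent.path up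
        ; joins-e = joins-ends e
        ; joins-f = joins
        ; disjoint = λ (u∈ , u∈′) → n≮n _
            (≤-<-trans (proj₂ (Down.Descent.below down u∈)) (<-≤-trans lower<upper (upper≤ u∈′)))
        ; e≢f = e≢edge }

      cycleOf : Cycle G
      cycleOf = CutCycle.cycle cut

      edgeListOf : List (Fin m)
      edgeListOf = CutCycle.edgeList cut

      edgeListOf-enumerates : Enumerates edgeListOf (cycleEdges cycleOf)
      edgeListOf-enumerates = CutCycle.cycle-enumerated cut

    open Chord

    edge∈cycleOf : ∀ c → edge c ∈ cycleEdges (cycleOf c)
    edge∈cycleOf c = ∈-fromList⁺ {fs = edgeListOf c} (here refl)

    e∈cycleOf : ∀ c → e ∈ cycleEdges (cycleOf c)
    e∈cycleOf c = ∈-fromList⁺ {fs = edgeListOf c} (there (here refl))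

    -- An edge on the way down is the low edge of its upper end, hence no chord. A chord on the way
    -- up has both ends at or above `upper c`.
    triangular : ∀ c d → edge d ∈ cycleEdges (cycleOf c) → edge d ≡ edge c ⊎ rank (lower c) < rank (lower d)
    triangular c d d∈ with ∈-fromList⁻ (edgeListOf c) d∈
    ... | here eq = inj₁ eq
    ... | there (here eq) = contradiction (sym eq) (e≢edge d)
    ... | there (there d∈′) with ∈-++⁻ (Down.Descent.fs (down c)) d∈′
    ...   | inj₁ d∈down with u , u∈ , u≢s , eq ← Down.Descent.from-below (down c) d∈down
          with j , _ , low<u ← low-joins u (proj₁ (Down.Descent.below (down c) u∈)) u≢s
          with joins-end j (subst (λ f → _meets_ G f (upper d)) eq (joins-meetsʳ (joins d)))
             | joins-end j (subst (λ f → _meets_ G f (lower d)) eq (joins-meetsˡ (joins d)))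
    ...     | inj₁ refl | _         = contradiction eq (not-low d)
    ...     | inj₂ refl | inj₁ refl = contradiction low<u (<-asym (lower<upper d))
    ...     | inj₂ refl | inj₂ eq′  = contradiction (cong rank eq′) (<⇒≢ (lower<upper d))
    triangular c d d∈ | there (there d∈′) | inj₂ d∈up
      with u , u∈ , u≢t , eq ← Up.Descent.from-below (up c) d∈up
      with j , _ , u<high ← high-joins u (proj₁ (Up.Descent.below (up c) u∈)) u≢t
      with joins-end j (subst (λ f → _meets_ G f (lower d)) eq (joins-meetsˡ (joins d)))
    ... | inj₁ refl = inj₂ (<-≤-trans (lower<upper c) (upper≤ c u∈))
    ... | inj₂ refl = inj₂ (<-trans (<-≤-trans (lower<upper c) (upper≤ c u∈)) u<high)

    Supported : Subset m → Set
    Supported x = ∀ {f} → f ∈ x → 0 < rank (end₁ G f) × 0 < rank (end₂ G f)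

    Supported-⊕ : ∀ {x y} → Supported x → Supported y → Supported (x ⊕ y)
    Supported-⊕ {x} {y} sx sy {f} f∈ with f ∈? x | f ∈? y
    ... | yes f∈x | _       = sx f∈x
    ... | no _    | yes f∈y = sy f∈y
    ... | no f∉x  | no f∉y  = contradiction f∈
      (lookup⇒∉ (trans (lookup-⊕ x y f) (cong₂ _xor_ (∉⇒lookup f∉x) (∉⇒lookup f∉y))))

    Supported-combination : ∀ {k} (c : Vector Bool k) b → (∀ i → Supported (b i)) → Supported (combination c b)
    Supported-combination c b sb {f} f∈ with Fin.any? (λ i → f ∈? b i)
    ... | yes (i , f∈bᵢ) = sb i f∈bᵢ
    ... | no none = contradiction f∈ (combination-avoids c b f λ i f∈bᵢ → none (i , f∈bᵢ))

    -- The low edges form a tree, which contains no nonempty even set.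
    module _ {x : Subset m} (even : Even G x) (supported : Supported x)
             (no-chord : ∀ c → edge c ∉ x) where

      private
        LowEnd : Fin m → Set
        LowEnd f = ∃[ u ] ∃[ v ] Joins f u v × 0 < rank v × v ≢ s × rank u < rank v × f ≡ lowEdge v

        upper-end : ∀ {f} → f ∈ x → LowEnd f
        upper-end {f} f∈x with 0<₁ , 0<₂ ← supported f∈x =
          go (joins-ends f) 0<₁ 0<₂ 
          where
          ordered : ∀ {u v} → Joins f u v → 0 < rank u → rank u < rank v → LowEnd f
          ordered {u} {v} j 0<u u<v with f Fin.≟ lowEdge v
          ... | yes eq = u , v , j , <-trans 0<u u<v
                , (λ where refl → contradiction 0<u (<⇒≱ (subst (rank u <_) rank-s u<v)))
                , u<v , eq
          ... | no neq = contradiction f∈x (no-chord record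
            { edge = f ; lower = u ; upper = v ; joins = j ; 0<lower = 0<u ; lower<upper = u<v ; not-low = neq })
          go : ∀ {u v} → Joins f u v → 0 < rank u → 0 < rank v → LowEnd f
          go {u} {v} j 0<u 0<v with <-cmp (rank u) (rank v)
          ... | tri< u<v _ _ = ordered j 0<u u<v
          ... | tri≈ _ eq _  = contradiction (rank-injective 0<u eq) (joins-≢ j)
          ... | tri> _ _ v<u = ordered (joins-sym j) 0<v v<u

        -- Induction from the top rank downwards, with fuel `k`: any other edge of `x` at `v` is the
        -- low edge of a higher vertex and already excluded, so `lowEdge v` would be alone at `v`,
        -- against evenness.
        no-low : ∀ k v → rank t < k + rank v → 0 < rank v → v ≢ s → lowEdge v ∉ x
        no-low zero    v bound _ _ _ = n≮n _ (<-≤-trans bound (rank≤rank-t v))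
        no-low (suc k) v bound 0<v v≢s low∈x = contradiction (trans (sym single) (even v)) λ ()
          where
          j = proj₁ (low-joins v 0<v v≢s)
          others : ∀ f → f ≢ lowEdge v → lookup (incident G v) f ∧ lookup x f ≡ false
          others f f≢ with f ∈? incident G v | f ∈? x
          ... | no f∉v  | _      = cong (_∧ lookup x f) (∉⇒lookup f∉v)
          ... | yes _   | no f∉x = trans (cong (lookup (incident G v) f ∧_) (∉⇒lookup f∉x)) (∧-zeroʳ _)
          ... | yes f∈v | yes f∈x with u , w , jf , 0<w , w≢s , u<w , eq ← upper-end f∈x
            with joins-end jf (incident⇒meets G f∈v)
          ...   | inj₂ refl = contradiction eq f≢
          ...   | inj₁ refl = contradiction (subst (_∈ x) eq f∈x)
            (no-low k w (<-≤-trans bound (≤-trans (≤-reflexive (sym (+-suc k _))) (+-monoʳ-≤ k u<w))) 0<w w≢s)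
          single : parity G v x ≡ true
          single = trans (∑-single (lowEdge v) _ others)
            (cong₂ _∧_ (∈⇒lookup (meets⇒incident G (joins-meetsˡ j))) (∈⇒lookup low∈x))

      no-even-set : x ≡ ⊥
      no-even-set = Empty-unique λ (f , f∈x) →
        let u , v , _ , 0<v , v≢s , _ , eq = upper-end f∈x
        in  no-low (suc (rank t)) v (m≤m+n (suc (rank t)) _) 0<v v≢s (subst (_∈ x) eq f∈x)

    -- `b` is tied to the chords by an equation because looking up in a mapped list does not reduce
    -- to the chord.
    module ChordBasis {k : ℕ} (ch : Fin k → Chord) (b : Vector (Subset m) k)
      (b≡ : ∀ i → b i ≡ cycleEdges (cycleOf (ch i)))
      (ch-injective : ∀ {i j} → edge (ch i) ≡ edge (ch j) → i ≡ j)
      (ch-complete : ∀ c → ∃[ i ] edge (ch i) ≡ edge c)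
      (covers : ∀ (Z : Cycle G) → Supported (cycleEdges Z)) where

      private
        edgeAt : Fin k → Fin m
        edgeAt i = edge (ch i)

        own-edge : ∀ i → lookup (b i) (edgeAt i) ≡ true
        own-edge i = ∈⇒lookup (subst (edgeAt i ∈_) (sym (b≡ i)) (edge∈cycleOf (ch i)))

        -- By `triangular`, apart from the cycle of `ch i` itself, only cycles of chords starting
        -- strictly lower pass through `edgeAt i`.
        evaluate : ∀ (c : Vector Bool k) i →
          (∀ j → rank (lower (ch j)) < rank (lower (ch i)) → c j ≡ false) →
          lookup (combination c b) (edgeAt i) ≡ c i
        evaluate c i below = trans (lookup-combination c b (edgeAt i))
          (trans (∑-single i _ others) (trans (cong (c i ∧_) (own-edge i)) (∧-identityʳ (c i))))
          where
          others : ∀ j → j ≢ i → c j ∧ lookup (b j) (edgeAt i) ≡ false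
          others j j≢i with edgeAt i ∈? b j
          ... | no ∉bⱼ = trans (cong (c j ∧_) (∉⇒lookup ∉bⱼ)) (∧-zeroʳ _)
          ... | yes ∈bⱼ with triangular (ch j) (ch i) (subst (edgeAt i ∈_) (b≡ j) ∈bⱼ)
          ...   | inj₁ eq   = contradiction (sym (ch-injective eq)) j≢i
          ...   | inj₂ less = cong (_∧ lookup (b j) (edgeAt i)) (below j less)

      independent : LinearlyIndependent b
      independent c c≡⊥ i = vanishes (suc (rank (lower (ch i)))) i ≤-refl
        where
        vanishes : ∀ r i → rank (lower (ch i)) < r → c i ≡ false
        vanishes (suc r) i bound = trans
          (sym (evaluate c i λ j less → vanishes r j (<-≤-trans less (≤-pred bound))))
          (trans (cong (λ x → lookup x (edgeAt i)) c≡⊥) (lookup-⊥ (edgeAt i)))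

      private
        -- Forward substitution by the rank `r` of the lower ends. Cycles of different chords with
        -- the same `r` avoid each other's chords, so `c₁` clears a whole rank with coefficients
        -- read directly from `x`. Beyond the top rank no chord is left and `no-even-set` applies.
        eliminate : ∀ d r → rank t < d + r → ∀ {x} → Even G x → Supported x →
          (∀ i → rank (lower (ch i)) < r → edgeAt i ∉ x) → ∃[ c ] combination c b ≡ x
        eliminate zero r bound {x} even supp none = (λ _ → false) ,
          trans (subset-ext λ f → trans (lookup-combination (λ _ → false) b f)
                  (trans (∑-zero {k} _ λ _ → refl) (sym (lookup-⊥ f))))
          (sym (no-even-set even supp λ c c∈x → let i , eq = ch-complete c in
            none i (≤-<-trans (rank≤rank-t _) bound) (subst (_∈ x) (sym eq) c∈x)))
        eliminate (suc d) r bound {x} even supp none =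
          let c₂ , eq = eliminate d (suc r) (<-≤-trans bound (≤-reflexive (sym (+-suc d r))))
                          {x ⊕ combination c₁ b}
                          (Even-⊕ G {x} {combination c₁ b} even (Even-combination G c₁ b b-even))
                          (Supported-⊕ {x} {combination c₁ b} supp (Supported-combination c₁ b b-supp)) none′
          in  (λ i → c₂ i xor c₁ i) , trans (combination-⊕ c₂ c₁ b)
                (trans (cong (_⊕ combination c₁ b) eq) (cancel x (combination c₁ b)))
          where
          c₁ : Vector Bool _
          c₁ i = does (rank (lower (ch i)) ≟ r) ∧ lookup x (edgeAt i)
          b-even : ∀ i → Even G (b i)
          b-even i = subst (Even G) (sym (b≡ i)) (cycle-even G (cycleOf (ch i)))
          b-supp : ∀ i → Supported (b i)
          b-supp i = subst Supported (sym (b≡ i)) (covers (cycleOf (ch i)))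
          cancel : ∀ x y → (x ⊕ y) ⊕ y ≡ x
          cancel x y = subset-ext λ f → trans (lookup-⊕ (x ⊕ y) y f)
            (trans (cong (_xor lookup y f) (lookup-⊕ x y f))
            (trans (xor-assoc (lookup x f) (lookup y f) (lookup y f))
            (trans (cong (lookup x f xor_) (xor-same (lookup y f))) (xor-identityʳ (lookup x f)))))
          below : ∀ j → rank (lower (ch j)) < r → c₁ j ≡ false
          below j less = cong (_∧ lookup x (edgeAt j)) (dec-false (rank (lower (ch j)) ≟ r) (<⇒≢ less))
          none′ : ∀ i → rank (lower (ch i)) < suc r → edgeAt i ∉ x ⊕ combination c₁ b
          none′ i bound = lookup⇒∉ (trans (lookup-⊕ x (combination c₁ b) (edgeAt i))
            (trans (cong (lookup x (edgeAt i) xor_)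
                         (evaluate c₁ i λ j less → below j (<-≤-trans less (≤-pred bound))))
                   (cases (m<1+n⇒m<n∨m≡n bound))))
            where
            cases : rank (lower (ch i)) < r ⊎ rank (lower (ch i)) ≡ r → lookup x (edgeAt i) xor c₁ i ≡ false
            cases (inj₁ less) = cong₂ _xor_ (∉⇒lookup (none i less)) (below i less)
            cases (inj₂ eq)   = trans
              (cong (λ d → lookup x (edgeAt i) xor (d ∧ lookup x (edgeAt i))) (dec-true (rank (lower (ch i)) ≟ r) eq))
              (xor-same (lookup x (edgeAt i)))

      basis : IsBasisOf (CycleSpace G) b
      basis = (λ i → subst (CycleSpace G) (sym (b≡ i)) (cycle∈CycleSpace G (cycleOf (ch i))))
        , independent
        , λ x x∈ → eliminate (suc (rank t)) 0 (m≤m+n (suc (rank t)) 0) (CycleSpace-even G x∈)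
                     (space-supp x∈) (λ _ ())
        where
        space-supp : ∀ {x} → CycleSpace G x → Supported x
        space-supp (k , b , c , Zs , refl) = Supported-combination c b λ i →
          subst Supported (proj₂ (Zs i)) (covers (proj₁ (Zs i)))

    chordAt : (L : List Chord) → Fin (length (map cycleOf L)) → Chord
    chordAt (c ∷ L) zero    = c
    chordAt (c ∷ L) (suc i) = chordAt L i

    lookup-chordAt : ∀ L i → List.lookup (map cycleOf L) i ≡ cycleOf (chordAt L i)
    lookup-chordAt (c ∷ L) zero    = refl
    lookup-chordAt (c ∷ L) (suc i) = lookup-chordAt L i

    chordAt∈ : ∀ L i → edge (chordAt L i) ∈ˡ map edge L
    chordAt∈ (c ∷ L) zero    = here refl
    chordAt∈ (c ∷ L) (suc i) = there (chordAt∈ L i)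

    chordAt-injective : ∀ L → Unique (map edge L) → ∀ {i j} → edge (chordAt L i) ≡ edge (chordAt L j) → i ≡ j
    chordAt-injective (c ∷ L) _ {zero} {zero} _ = refl
    chordAt-injective (c ∷ L) (c∉ ∷ _) {zero} {suc j} eq = contradiction eq (All.lookup c∉ (chordAt∈ L j))
    chordAt-injective (c ∷ L) (c∉ ∷ _) {suc i} {zero} eq = contradiction (sym eq) (All.lookup c∉ (chordAt∈ L i))
    chordAt-injective (c ∷ L) (_ ∷ un) {suc i} {suc j} eq = cong suc (chordAt-injective L un eq)

    chordAt-surjective : ∀ L {f} → f ∈ˡ map edge L → ∃[ i ] edge (chordAt L i) ≡ f
    chordAt-surjective (c ∷ L) (here refl) = zero , refl
    chordAt-surjective (c ∷ L) (there f∈) with i , eq ← chordAt-surjective L f∈ = suc i , eq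

    chords-basis : ∀ L → Unique (map edge L) → (∀ c → edge c ∈ˡ map edge L) →
      (∀ (Z : Cycle G) → Supported (cycleEdges Z)) → IsRootedCycleBasis G e (map cycleOf L)
    chords-basis L un complete covers =
      ChordBasis.basis (chordAt L) _ (λ i → cong cycleEdges (lookup-chordAt L i))
        (chordAt-injective L un) (chordAt-surjective L ∘ complete) covers
      , rooted L
      where
      rooted : ∀ L → All (λ Z → e ∈ cycleEdges Z) (map cycleOf L)
      rooted []      = []
      rooted (c ∷ L) = e∈cycleOf c ∷ rooted L

    chords-described : ∀ L → Pointwise (λ fs Z → Enumerates fs (cycleEdges Z)) (map edgeListOf L) (map cycleOf L)
    chords-described []      = []
    chords-described (c ∷ L) = edgeListOf-enumerates c ∷ chords-described L

-- The ranked vertices contain the core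

module Cover {n m : ℕ} (G : Graph n m) (e : Fin m)
  (rank : Fin n → ℕ) (anchor : Fin n → ℕ)
  (0<rank-s : 0 < rank (end₁ G e)) (0<rank-t : 0 < rank (end₂ G e))
  (anchor-member : ∀ {v} → 0 < rank v → anchor v ≡ toℕ v)
  (no-ear : ∀ f → anchor (end₁ G f) ≡ anchor (end₂ G f) ⊎ (0 < rank (end₁ G f) × 0 < rank (end₂ G f)))
  where
  open Paths G
  open Core G

  private
    same-anchor : ∀ {f u v} → Joins f u v → rank u ≡ 0 → anchor u ≡ anchor v
    same-anchor {f} (inj₁ (refl , refl)) out with no-ear f
    ... | inj₁ eq        = eq
    ... | inj₂ (0<u , _) = contradiction (subst (0 <_) out 0<u) λ ()
    same-anchor {f} (inj₂ (refl , refl)) out with no-ear f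
    ... | inj₁ eq        = sym eq
    ... | inj₂ (_ , 0<u) = contradiction (subst (0 <_) out 0<u) λ ()

    -- The anchor is constant along the unranked start of a walk and on the edge that leaves it; the
    -- first ranked vertex, being its own anchor, is therefore the anchor of `v`.
    enters-at-anchor : ∀ (D : Subgraph G) {v r} → Star (Adjacent D) v r → rank v ≡ 0 → 0 < rank r →
      ∃[ z ] z ∈ vertices D × 0 < rank z × anchor v ≡ toℕ z
    enters-at-anchor D ε out 0<r = contradiction (subst (0 <_) out 0<r) λ ()
    enters-at-anchor D (_◅_ {j = w} (f , f∈D , j) walk) out 0<r with rank w in eq
    ... | suc _ = w , meets∈vertices D f∈D (joins-meetsʳ j) , subst (0 <_) (sym eq) (s≤s z≤n)
                , trans (same-anchor j out) (anchor-member (subst (0 <_) (sym eq) (s≤s z≤n)))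
    ... | zero with z , z∈D , 0<z , eq′ ← enters-at-anchor D walk eq 0<r =
      z , z∈D , 0<z , trans (same-anchor j out) eq′

  -- All walks from `v` to ranked vertices enter at the same `z`. Without `z`, a walk to whichever
  -- end of `e` differs from `z` would still have to enter there.
  core-ranked : ∀ {H : Subgraph G} → e ∈ edges H → TwoVertexConnected H →
    ∀ {v} → v ∈ vertices H → 0 < rank v
  core-ranked {H} e∈H ((_ , linked) , linked-without) {v} v∈H with rank v in eq
  ... | suc _ = s≤s z≤n
  ... | zero with z , z∈H , 0<z , anchor-v ← enters-at-anchor H (linked v∈H (proj₁ (closed H e∈H))) eq 0<rank-s =
    contradiction (escape (end₁ G e Fin.≟ z)) λ ()
    where
    v≢z : v ≢ z
    v≢z refl = contradiction (subst (0 <_) eq 0<z) λ ()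
    z∉ : z ∉ vertices (delete H z)
    z∉ = x∉p-x
    avoid : ∀ {r} → 0 < rank r → r ≢ z → r ∈ vertices H → 0 < 0
    avoid {r} 0<r r≢z r∈H
      with z′ , z′∈ , _ , anchor-v′ ← enters-at-anchor (delete H z)
             (linked-without z z∈H (x∈p∧x≢y⇒x∈p-y v∈H v≢z) (x∈p∧x≢y⇒x∈p-y r∈H r≢z)) eq 0<r =
      contradiction (subst (_∈ vertices (delete H z)) (Fin.toℕ-injective (trans (sym anchor-v′) anchor-v)) z′∈) z∉
    escape : _ → 0 < 0
    escape (no s≢z)   = avoid 0<rank-s s≢z (proj₁ (closed H e∈H))
    escape (yes refl) = avoid 0<rank-t (loopless G e ∘ sym) (proj₂ (closed H e∈H))

  cycles-ranked : RootInTwoConnectedCore G e → ∀ (Z : Cycle G) {f} → f ∈ cycleEdges Z →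
    0 < rank (end₁ G f) × 0 < rank (end₂ G f)
  cycles-ranked (H , core , e∈H , connected) Z f∈Z =
    let s∈ , t∈ = closed H (cycle⊆core Z core f∈Z)
    in  core-ranked {H} e∈H connected s∈ , core-ranked {H} e∈H connected t∈

-- Reasoning about programs

≔-same : ∀ {A : Set} (g : ℕ → A) x {a} → (g [ x ≔ a ]) x ≡ a
≔-same g x with x ≡ᵇ x | ≡⇒≡ᵇ x x refl
... | true | _ = refl

≔-other : ∀ {A : Set} (g : ℕ → A) {x y a} → x ≢ y → (g [ x ≔ a ]) y ≡ g y
≔-other g {x} {y} x≢y with x ≡ᵇ y in eq
... | false = refl
... | true  = contradiction (≡ᵇ⇒≡ x y (subst T (sym eq) tt)) x≢y

-- Total correctness with a clock: the postcondition also sees the elapsed time, so bounds and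
-- correctness compose together.
Run : Program → State → (ℕ → State → Set) → Set
Run P s Q = ∃[ t ] ∃[ s′ ] P ∣ s ⇓[ t ] s′ × Q t s′

-- Such programs are run by `exec` and timed by `duration`, so a whole block of assignments is
-- verified by reduction.
StraightLine : Program → Set
StraightLine skip              = ⊤
StraightLine (setReg _ _)      = ⊤
StraightLine (setCell _ _ _)   = ⊤
StraightLine (emit _)          = ⊤
StraightLine (P ⨾ Q)           = StraightLine P × StraightLine Q
StraightLine (ifLess _ _ _ _)  = Absurd
StraightLine (whileLess _ _ _) = Absurd

duration : Program → ℕ
duration (setReg _ x)    = 1 + cost x
duration (setCell _ x y) = 1 + cost x + cost y
duration (emit x)        = 1 + cost x
duration (P ⨾ Q)         = duration P + duration Q
duration _               = 1

exec : Program → State → State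
exec (setReg r x)    s = ⟨ regs s [ r ≔ ⟦ x ⟧ s ] , arrays s , output s ⟩
exec (setCell a x y) s = ⟨ regs s , arrays s [ a ≔ arrays s a [ ⟦ x ⟧ s ≔ ⟦ y ⟧ s ] ] , output s ⟩
exec (emit x)        s = ⟨ regs s , arrays s , output s ++ ⟦ x ⟧ s ∷ [] ⟩
exec (P ⨾ Q)         s = exec Q (exec P s)
exec _               s = s

exec-steps : ∀ P s → StraightLine P → P ∣ s ⇓[ duration P ] exec P s
exec-steps skip            s _ = skip⇓
exec-steps (setReg _ _)    s _ = setReg⇓
exec-steps (setCell _ _ _) s _ = setCell⇓
exec-steps (emit _)        s _ = emit⇓
exec-steps (P ⨾ Q)         s (p , q) = ⨾⇓ (exec-steps P s p) (exec-steps Q (exec P s) q)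

run-exec : ∀ P {straight : StraightLine P} {s Q} → Q (duration P) (exec P s) → Run P s Q
run-exec P {straight} {s} q = _ , _ , exec-steps P s straight , q

run-map : ∀ {P s} {Q Q′ : ℕ → State → Set} → (∀ t s′ → Q t s′ → Q′ t s′) → Run P s Q → Run P s Q′
run-map f (t , s′ , steps , q) = t , s′ , steps , f t s′ q

run-seq : ∀ {P P′ s Q R} → Run P s R → (∀ t s′ → R t s′ → Run P′ s′ (λ u → Q (t + u))) → Run (P ⨾ P′) s Q
run-seq (t , s′ , steps , r) k with u , s″ , steps′ , q ← k t s′ r = _ , s″ , ⨾⇓ steps steps′ , q

run-exec-seq : ∀ P {P′} {straight : StraightLine P} {s Q} →
  Run P′ (exec P s) (λ u → Q (duration P + u)) → Run (P ⨾ P′) s Q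
run-exec-seq P {straight = straight} (u , s″ , steps′ , q) = _ , s″ , ⨾⇓ (exec-steps P _ straight) steps′ , q

guard : Expr → Expr → ℕ
guard x y = 1 + cost x + cost y

run-if : ∀ {x y P P′ s Q} →
  (⟦ x ⟧ s < ⟦ y ⟧ s → Run P s (λ t → Q (guard x y + t))) →
  (⟦ x ⟧ s ≮ ⟦ y ⟧ s → Run P′ s (λ t → Q (guard x y + t))) →
  Run (ifLess x y P P′) s Q
run-if {x} {y} {s = s} then else with ⟦ x ⟧ s <? ⟦ y ⟧ s
... | yes less with t , s′ , steps , q ← then less = _ , s′ , then⇓ less steps , q
... | no nless with t , s′ , steps , q ← else nless = _ , s′ , else⇓ nless steps , q

-- Φ is the potential of amortised analysis: every iteration pays for itself
-- by lowering Φ, which therefore also bounds the number of iterations.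
run-while : ∀ {x y P} (I : State → Set) (Φ : State → ℕ) →
  (∀ s → I s → ⟦ x ⟧ s < ⟦ y ⟧ s → Run P s (λ t s′ → I s′ × guard x y + t + Φ s′ ≤ Φ s)) →
  ∀ s → I s → Run (whileLess x y P) s (λ t s′ → I s′ × ⟦ x ⟧ s′ ≮ ⟦ y ⟧ s′ × t + Φ s′ ≤ guard x y + Φ s)
run-while {x} {y} {P} I Φ body s i = loop (suc (Φ s)) s i ≤-refl
  where
  g = guard x y
  loop : ∀ k s → I s → Φ s < k → Run (whileLess x y P) s (λ t s′ → I s′ × ⟦ x ⟧ s′ ≮ ⟦ y ⟧ s′ × t + Φ s′ ≤ g + Φ s)
  loop (suc k) s i bound with ⟦ x ⟧ s <? ⟦ y ⟧ s
  ... | no halt = _ , s , exit⇓ halt , i , halt , ≤-refl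
  ... | yes go with t , s₁ , steps , i₁ , pays ← body s i go
    with u , s₂ , steps′ , i₂ , halt , pays′ ← loop k s₁ i₁
           (≤-trans (s≤s (m≤n+m (Φ s₁) (cost x + cost y + t))) (≤-trans pays (≤-pred bound))) =
    _ , s₂ , loop⇓ go steps steps′ , i₂ , halt , total
    where
    open ≤-Reasoning
    total : g + t + u + Φ s₂ ≤ g + Φ s
    total = begin
      g + t + u + Φ s₂     ≡⟨ +-assoc (g + t) u (Φ s₂) ⟩
      g + t + (u + Φ s₂)   ≤⟨ +-monoʳ-≤ (g + t) pays′ ⟩
      g + t + (g + Φ s₁)   ≡⟨ +-assoc (g + t) g (Φ s₁) ⟨
      g + t + g + Φ s₁     ≡⟨ cong (_+ Φ s₁) (+-comm (g + t) g) ⟩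
      g + (g + t) + Φ s₁   ≡⟨ +-assoc g (g + t) (Φ s₁) ⟩
      g + (g + t + Φ s₁)   ≤⟨ +-monoʳ-≤ g pays ⟩
      g + Φ s              ∎

output-length : ∀ {P s t s′} → P ∣ s ⇓[ t ] s′ → length (output s′) ≤ length (output s) + t
output-length {s = s} skip⇓ = m≤m+n _ 1
output-length {s = s} setReg⇓ = m≤m+n _ _
output-length {s = s} setCell⇓ = m≤m+n _ _
output-length {s = s} (emit⇓ {x = x}) = ≤-trans (≤-reflexive (length-++ (output s))) (+-monoʳ-≤ (length (output s)) (s≤s z≤n))
output-length {s = s} (⨾⇓ {t = t} {u = u} p q) = ≤-trans (output-length q)
  (≤-trans (+-monoˡ-≤ u (output-length p)) (≤-reflexive (+-assoc (length (output s)) t u)))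
output-length {s = s} (then⇓ {x} {y} {t = t} _ p) = ≤-trans (output-length p) (+-monoʳ-≤ (length (output s)) (m≤n+m t (guard x y)))
output-length {s = s} (else⇓ {x} {y} {t = t} _ p) = ≤-trans (output-length p) (+-monoʳ-≤ (length (output s)) (m≤n+m t (guard x y)))
output-length {s = s} (loop⇓ {x} {y} {t = t} {u = u} _ p q) = ≤-trans (output-length q)
  (≤-trans (+-monoˡ-≤ u (output-length p)) (≤-trans (≤-reflexive (+-assoc (length (output s)) t u))
  (+-monoʳ-≤ (length (output s)) (+-monoˡ-≤ u (m≤n+m t (guard x y))))))
output-length {s = s} (exit⇓ _) = m≤m+n _ _

-- For counting loops: an iteration of cost `k` is paid by the fall of the potential `(N ∸ i) * c`
-- as `i` advances.
tick≤ : ∀ {i N k c} → i < N → k ≤ c → k + (N ∸ suc i) * c ≤ (N ∸ i) * c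
tick≤ {i} {N} i<N k≤c rewrite +-∸-assoc 1 {N} {suc i} i<N = +-monoˡ-≤ _ k≤c

tick : ∀ {i N} k c {_ : T (k ≤ᵇ c)} → i < N → k + (N ∸ suc i) * c ≤ (N ∸ i) * c
tick k c {le} i<N = tick≤ i<N (≤ᵇ⇒≤ k c le)

succReg : ℕ → Program
succReg r = setReg r (succ (reg r))

-- The rank `r` after a gap has been opened at `suc c`.
lift : ℕ → ℕ → ℕ
lift c r = if does (c <? r) then suc r else r

lift-above : ∀ {c r} → c < r → lift c r ≡ suc r
lift-above {c} {r} c<r rewrite dec-true (c <? r) c<r = refl

lift-below : ∀ {c r} → ¬ c < r → lift c r ≡ r
lift-below {c} {r} c≮r rewrite dec-false (c <? r) c≮r = refl

shiftBody shift : Program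
shiftBody = ifLess (reg 13) (cell 9 (reg 11)) (setCell 9 (reg 11) (succ (cell 9 (reg 11)))) skip ⨾ succReg 11
shift = setReg 11 (lit 0) ⨾ whileLess (reg 11) (reg 0) shiftBody

module _ {n c : ℕ} (rk : ℕ → ℕ) (Ctx : State → Set)
  (keep-reg : ∀ s i → Ctx s → Ctx ⟨ regs s [ 11 ≔ i ] , arrays s , output s ⟩)
  (keep-array : ∀ s g → Ctx s → Ctx ⟨ regs s , arrays s [ 9 ≔ g ] , output s ⟩)
  where

  private
    record Shifted (i : ℕ) (a : ℕ → ℕ) : Set where
      field
        i≤n  : i ≤ n
        done : ∀ v → v < i → a v ≡ lift c (rk v)
        todo : ∀ v → i ≤ v → a v ≡ rk v

    open Shifted

    Inv : State → Set
    Inv s = Ctx s × regs s 0 ≡ n × regs s 13 ≡ c × Shifted (regs s 11) (arrays s 9)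

    shift-next : ∀ {i a b} → i < n → Shifted i a → (∀ v → i ≢ v → b v ≡ a v) → b i ≡ lift c (a i) → Shifted (suc i) b
    shift-next {i} {a} {b} i<n sh same at-i = record
      { i≤n = i<n
      ; done = λ v v<1+i → case-done v (m<1+n⇒m<n∨m≡n v<1+i)
      ; todo = λ v i<v → trans (same v (<⇒≢ i<v)) (todo sh v (<⇒≤ i<v)) }
      where
      case-done : ∀ v → v < i ⊎ v ≡ i → b v ≡ lift c (rk v)
      case-done v (inj₁ v<i)  = trans (same v (λ i≡v → <⇒≢ v<i (sym i≡v))) (done sh v v<i)
      case-done v (inj₂ refl) = trans at-i (cong (lift c) (todo sh v ≤-refl))

    body : ∀ s → Inv s → regs s 11 < regs s 0 →
      Run shiftBody s (λ t s′ → Inv s′ × 3 + t + (n ∸ regs s′ 11) * 15 ≤ (n ∸ regs s 11) * 15)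
    body s (ctx , refl , refl , sh) i<n = run-seq {R = λ t s′ → t ≤ 9 × regs s′ 11 ≡ regs s 11 × (Inv (exec (succReg 11) s′))}
      (run-if
        (λ c<r → run-exec (setCell 9 (reg 11) (succ (cell 9 (reg 11)))) (≤-refl , refl ,
          keep-reg _ _ (keep-array s _ ctx) , refl , refl ,
          shift-next i<n sh (λ v → ≔-other (arrays s 9)) (trans (≔-same (arrays s 9) i) (sym (lift-above c<r)))))
        (λ c≮r → run-exec skip (≤ᵇ⇒≤ 5 9 _ , refl , keep-reg _ _ ctx , refl , refl ,
          shift-next i<n sh (λ _ _ → refl) (sym (lift-below c≮r)))))
      λ t s′ (t≤9 , same , inv) → run-exec (succReg 11) (inv ,
        ≤-trans (+-monoˡ-≤ _ (+-monoʳ-≤ 3 (+-monoˡ-≤ 3 t≤9)))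
          (subst (λ i′ → 15 + (n ∸ suc i′) * 15 ≤ (n ∸ i) * 15) (sym same) (tick 15 15 i<n)))
      where i = regs s 11

  -- `Ctx` frames whatever the caller knows that does not depend on the loop counter and the rank
  -- array. Ranks from `n` onwards are zero and `lift` fixes zero, so treating `n` cells shifts the
  -- entire array.
  run-shift : ∀ s → Ctx s → regs s 0 ≡ n → regs s 13 ≡ c → (∀ v → arrays s 9 v ≡ rk v) →
    (∀ v → n ≤ v → rk v ≡ 0) →
    Run shift s (λ t s′ → (Ctx s′ × regs s′ 0 ≡ n × regs s′ 13 ≡ c) × (∀ v → arrays s′ 9 v ≡ lift c (rk v)) × t ≤ 5 + n * 15)
  run-shift s ctx n≡ c≡ rk≡ out = run-exec-seq (setReg 11 (lit 0)) (run-map finish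
    (run-while Inv (λ s′ → (n ∸ regs s′ 11) * 15) body _
      (keep-reg s 0 ctx , n≡ , c≡ , record { i≤n = z≤n ; done = λ _ () ; todo = λ v _ → rk≡ v })))
    where
    finish : ∀ t s′ → Inv s′ × ¬ (regs s′ 11 < regs s′ 0) × t + (n ∸ regs s′ 11) * 15 ≤ 3 + n * 15 → _
    finish t s′ ((ctx′ , n≡′ , c≡′ , sh) , halt , bound) =
      (ctx′ , n≡′ , c≡′) , all-done , s≤s (s≤s (≤-trans (m≤m+n t _) bound))
      where
      all-done : ∀ v → arrays s′ 9 v ≡ lift c (rk v)
      all-done v with v <? n
      ... | yes v<n = done sh v (<-≤-trans v<n (subst (_≤ regs s′ 11) n≡′ (≮⇒≥ halt)))
      ... | no v≮n = trans (todo sh v (≤-trans (i≤n sh) (≮⇒≥ v≮n)))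
        (trans (out v (≮⇒≥ v≮n)) (sym (trans (cong (lift c) (out v (≮⇒≥ v≮n))) (lift-below {c} {0} (λ ())))))

-- Growing the numbering

≡ᵇ-refl : ∀ x → (x ≡ᵇ x) ≡ true
≡ᵇ-refl zero    = refl
≡ᵇ-refl (suc x) = ≡ᵇ-refl x

≢⇒≡ᵇ : ∀ {x y} → x ≢ y → (x ≡ᵇ y) ≡ false
≢⇒≡ᵇ {x} {y} x≢y with x ≡ᵇ y in eq
... | false = refl
... | true  = contradiction (≡ᵇ⇒≡ x y (subst T (sym eq) tt)) x≢y

injection⇒≤ : ∀ {k n} (f : ℕ → ℕ) → (∀ i → i < k → f i < n) →
  (∀ i j → i < k → j < k → f i ≡ f j → i ≡ j) → k ≤ n
injection⇒≤ f f< inj = Fin.injective⇒≤ {f = λ i → fromℕ< (f< (toℕ i) (Fin.toℕ<n i))} λ {i} {j} eq →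
  Fin.toℕ-injective (inj (toℕ i) (toℕ j) (Fin.toℕ<n i) (Fin.toℕ<n j)
    (trans (sym (Fin.toℕ-fromℕ< _)) (trans (cong toℕ eq) (Fin.toℕ-fromℕ< _))))

isZero : ℕ → ℕ
isZero zero    = 1
isZero (suc _) = 0

-- Applied to `rk ∘ ord`, this counts the reached vertices without a rank, the quantity that pays
-- for the ears.
zeros : ℕ → (ℕ → ℕ) → ℕ
zeros zero    f = 0
zeros (suc k) f = isZero (f k) + zeros k f

isZero-mono : ∀ {a b} → (0 < a → 0 < b) → isZero b ≤ isZero a
isZero-mono {zero}  {zero}  _  = ≤-refl
isZero-mono {zero}  {suc b} _  = z≤n
isZero-mono {suc a} {zero}  up = contradiction (up (s≤s z≤n)) λ ()
isZero-mono {suc a} {suc b} _  = ≤-refl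

zeros-mono : ∀ k {f g : ℕ → ℕ} → (∀ j → 0 < f j → 0 < g j) → zeros k g ≤ zeros k f
zeros-mono zero    up = z≤n
zeros-mono (suc k) up = +-mono-≤ (isZero-mono (up k)) (zeros-mono k up)

zeros-strict : ∀ k {f g : ℕ → ℕ} → (∀ j → 0 < f j → 0 < g j) →
  ∀ {j} → j < k → f j ≡ 0 → 0 < g j → zeros k g < zeros k f
zeros-strict (suc k) {f} {g} up {j} j<1+k fj≡0 0<gj with m<1+n⇒m<n∨m≡n j<1+k
... | inj₁ j<k  = ≤-trans (≤-reflexive (sym (+-suc (isZero (g k)) _)))
                    (+-mono-≤ (isZero-mono (up k)) (zeros-strict k up j<k fj≡0 0<gj))
... | inj₂ refl with f k | g k | fj≡0 | 0<gj
...   | .0 | suc _ | refl | _ = s≤s (zeros-mono k up)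

zeros≤ : ∀ k f → zeros k f ≤ k
zeros≤ zero    f = z≤n
zeros≤ (suc k) f with f k
... | zero  = s≤s (zeros≤ k f)
... | suc _ = m≤n⇒m≤1+n (zeros≤ k f)

lift-≥ : ∀ c r → r ≤ lift c r
lift-≥ c r with c <? r
... | yes c<r rewrite lift-above c<r = n≤1+n r
... | no c≮r rewrite lift-below c≮r = ≤-refl

lift-mono-< : ∀ c {q r} → q < r → lift c q < lift c r
lift-mono-< c {q} {r} q<r with c <? q | c <? r
... | yes c<q | _ rewrite lift-above c<q | lift-above (<-trans c<q q<r) = s≤s q<r
... | no c≮q | yes c<r rewrite lift-below c≮q | lift-above c<r = m≤n⇒m≤1+n q<r
... | no c≮q | no c≮r rewrite lift-below c≮q | lift-below c≮r = q<r

lift-mono-≤ : ∀ c {q r} → q ≤ r → lift c q ≤ lift c r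
lift-mono-≤ c q≤r with m≤n⇒m<n∨m≡n q≤r
... | inj₁ q<r  = <⇒≤ (lift-mono-< c q<r)
... | inj₂ refl = ≤-refl

lift-injective : ∀ c {q r} → lift c q ≡ lift c r → q ≡ r
lift-injective c {q} {r} eq with <-cmp q r
... | tri< q<r _ _ = contradiction eq (<⇒≢ (lift-mono-< c q<r))
... | tri≈ _ q≡r _ = q≡r
... | tri> _ _ r<q = contradiction (sym eq) (<⇒≢ (lift-mono-< c r<q))

lift≢suc : ∀ c r → lift c r ≢ suc c
lift≢suc c r eq with c <? r
... | yes c<r = contradiction (suc-injective (trans (sym (lift-above c<r)) eq)) (<⇒≢ c<r ∘ sym)
... | no c≮r  = c≮r (≤-reflexive (trans (sym eq) (lift-below c≮r)))

<∸2⇒ : ∀ {i k} → i < k ∸ 2 → 2 + i < k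
<∸2⇒ {k = suc (suc k)} i<k = s≤s (s≤s i<k)

-- The reached vertices as an ordered forest

module Invariants (n m : ℕ) (E0 E1 : ℕ → ℕ) (e : ℕ) (e<m : e < m)
  (ends< : ∀ {f} → f < m → E0 f < n × E1 f < n) (loopfree : ∀ {f} → f < m → E0 f ≢ E1 f) where

  s t : ℕ
  s = E0 e
  t = E1 e

  s≢t : s ≢ t
  s≢t = loopfree e<m

  Link : ℕ → ℕ → ℕ → Set
  Link f u v = f < m × ((E0 f ≡ u × E1 f ≡ v) ⊎ (E0 f ≡ v × E1 f ≡ u))

  link-sym : ∀ {f u v} → Link f u v → Link f v u
  link-sym (f<m , ends) = f<m , swap ends

  link-e : Link e s t
  link-e = e<m , inj₁ (refl , refl)

  link<ˡ : ∀ {f u v} → Link f u v → u < n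
  link<ˡ (f<m , inj₁ (refl , _)) = proj₁ (ends< f<m)
  link<ˡ (f<m , inj₂ (_ , refl)) = proj₂ (ends< f<m)

  link-unique : ∀ {f u v u′ v′} → Link f u v → Link f u′ v′ → (u ≡ u′ × v ≡ v′) ⊎ (u ≡ v′ × v ≡ u′)
  link-unique (_ , inj₁ (refl , refl)) (_ , inj₁ (refl , refl)) = inj₁ (refl , refl)
  link-unique (_ , inj₁ (refl , refl)) (_ , inj₂ (refl , refl)) = inj₂ (refl , refl)
  link-unique (_ , inj₂ (refl , refl)) (_ , inj₁ (refl , refl)) = inj₂ (refl , refl)
  link-unique (_ , inj₂ (refl , refl)) (_ , inj₂ (refl , refl)) = inj₁ (refl , refl)

  -- The vertices reached so far, listed by ord; pos is the inverse of ord,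
  -- shifted by one so that 0 marks the vertices not reached.
  record Order (K : ℕ) (pos ord : ℕ → ℕ) : Set where
    field
      pos-ord : ∀ j → j < K → pos (ord j) ≡ suc j
      ord-pos : ∀ v → 0 < pos v → ∃[ j ] j < K × ord j ≡ v
      vertex  : ∀ v → 0 < pos v → v < n
      pos-s   : pos s ≡ 1
      pos-t   : pos t ≡ 2

    pos≤K : ∀ v → pos v ≤ K
    pos≤K v with pos v in eq
    ... | zero  = z≤n
    ... | suc p with j , j<K , refl ← ord-pos v (subst (0 <_) (sym eq) (s≤s z≤n)) =
      ≤-trans (≤-reflexive (trans (sym eq) (pos-ord j j<K))) j<K

    ord-injective : ∀ i j → i < K → j < K → ord i ≡ ord j → i ≡ j
    ord-injective i j i<K j<K eq =
      suc-injective (trans (sym (pos-ord i i<K)) (trans (cong pos eq) (pos-ord j j<K)))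

    0<pos-ord : ∀ {j} → j < K → 0 < pos (ord j)
    0<pos-ord {j} j<K = subst (0 <_) (sym (pos-ord j j<K)) (s≤s z≤n)

    K≤n : K ≤ n
    K≤n = injection⇒≤ ord (λ j j<K → vertex (ord j) (0<pos-ord j<K)) ord-injective

    pos≤1 : ∀ v → pos v ≡ 1 → v ≡ s
    pos≤1 v pos≡1
      with i , i<K , refl ← ord-pos v (subst (0 <_) (sym pos≡1) (s≤s z≤n))
      with j , j<K , eq ← ord-pos s (subst (0 <_) (sym pos-s) (s≤s z≤n)) =
      trans (cong ord (suc-injective (trans (sym (pos-ord i i<K)) (trans pos≡1
        (trans (sym pos-s) (trans (cong pos (sym eq)) (pos-ord j j<K))))))) eq

    pos≡2 : ∀ v → pos v ≡ 2 → v ≡ t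
    pos≡2 v pos≡2
      with i , i<K , refl ← ord-pos v (subst (0 <_) (sym pos≡2) (s≤s z≤n))
      with j , j<K , eq ← ord-pos t (subst (0 <_) (sym pos-t) (s≤s z≤n)) =
      trans (cong ord (suc-injective (trans (sym (pos-ord i i<K)) (trans pos≡2
        (trans (sym pos-t) (trans (cong pos (sym eq)) (pos-ord j j<K))))))) eq

  -- `s` and `t`, at positions 1 and 2, are the roots. As long as only they are ranked, the anchor
  -- `att` of a reached vertex is the root of its tree.
  record Tree (pos lowV lowE att : ℕ → ℕ) : Set where
    field
      parent    : ∀ v → 2 < pos v →
                  Link (lowE v) v (lowV v) × 0 < pos (lowV v) × pos (lowV v) < pos v × att v ≡ att (lowV v)
      lowV-t    : lowV t ≡ s
      lowE-t    : lowE t ≡ e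
      att-s     : att s ≡ s
      att-t     : att t ≡ t
      unreached : ∀ v → pos v ≡ 0 → att v ≡ 0

  0<⇒≢ : ∀ (g : ℕ → ℕ) {u v} → g u ≡ 0 → 0 < g v → u ≢ v
  0<⇒≢ g eq 0<gv refl = contradiction (subst (0 <_) eq 0<gv) λ ()

  module _ {K X Y f : ℕ} {pos ord lowV lowE att : ℕ → ℕ}
    (order : Order K pos ord) (tree : Tree pos lowV lowE att)
    (new : pos X ≡ 0) (0<pos-Y : 0 < pos Y) (link : Link f X Y) where
    open Order order
    open Tree tree

    private
      X≢ : ∀ {v} → 0 < pos v → X ≢ v
      X≢ = 0<⇒≢ pos new
      0<pos-s : 0 < pos s
      0<pos-s = subst (0 <_) (sym pos-s) (s≤s z≤n)
      0<pos-t : 0 < pos t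
      0<pos-t = subst (0 <_) (sym pos-t) (s≤s z≤n)

    extend-order : Order (suc K) (pos [ X ≔ suc K ]) (ord [ K ≔ X ])
    extend-order = record
      { pos-ord = pos-ord′
      ; ord-pos = ord-pos′
      ; vertex  = vertex′
      ; pos-s   = trans (≔-other pos (X≢ 0<pos-s)) pos-s
      ; pos-t   = trans (≔-other pos (X≢ 0<pos-t)) pos-t }
      where
      pos-ord′ : ∀ j → j < suc K → (pos [ X ≔ suc K ]) ((ord [ K ≔ X ]) j) ≡ suc j
      pos-ord′ j j<1+K with m<1+n⇒m<n∨m≡n j<1+K
      ... | inj₂ refl rewrite ≡ᵇ-refl K | ≡ᵇ-refl X = refl
      ... | inj₁ j<K rewrite ≢⇒≡ᵇ {K} {j} (<⇒≢ j<K ∘ sym) | ≢⇒≡ᵇ (X≢ (0<pos-ord j<K)) = pos-ord j j<K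
      ord-pos′ : ∀ v → 0 < (pos [ X ≔ suc K ]) v → ∃[ j ] j < suc K × (ord [ K ≔ X ]) j ≡ v
      ord-pos′ v 0<v with X ≟ v
      ... | yes refl = K , ≤-refl , ≔-same ord K
      ... | no X≢v rewrite ≢⇒≡ᵇ X≢v with j , j<K , eq ← ord-pos v 0<v =
        j , m≤n⇒m≤1+n j<K , trans (≔-other ord (<⇒≢ j<K ∘ sym)) eq
      vertex′ : ∀ v → 0 < (pos [ X ≔ suc K ]) v → v < n
      vertex′ v 0<v with X ≟ v
      ... | yes refl = link<ˡ link
      ... | no X≢v rewrite ≢⇒≡ᵇ X≢v = vertex v 0<v

    extend-tree : Tree (pos [ X ≔ suc K ]) (lowV [ X ≔ Y ]) (lowE [ X ≔ f ]) (att [ X ≔ att Y ])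
    extend-tree = record
      { parent    = parent′
      ; lowV-t    = trans (≔-other lowV (X≢ 0<pos-t)) lowV-t
      ; lowE-t    = trans (≔-other lowE (X≢ 0<pos-t)) lowE-t
      ; att-s     = trans (≔-other att (X≢ 0<pos-s)) att-s
      ; att-t     = trans (≔-other att (X≢ 0<pos-t)) att-t
      ; unreached = unreached′ }
      where
      pos′ = pos [ X ≔ suc K ]
      att′ = att [ X ≔ att Y ]
      parent′ : ∀ v → 2 < pos′ v → let p = (lowV [ X ≔ Y ]) v in
        Link ((lowE [ X ≔ f ]) v) v p × 0 < pos′ p × pos′ p < pos′ v × att′ v ≡ att′ p
      parent′ v 2<v with X ≟ v
      ... | yes refl rewrite ≡ᵇ-refl X | ≢⇒≡ᵇ (X≢ 0<pos-Y) = link , 0<pos-Y , s≤s (pos≤K Y) , refl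
      ... | no X≢v rewrite ≢⇒≡ᵇ X≢v with l , 0<p , p<v , eq ← parent v 2<v
        rewrite ≢⇒≡ᵇ (X≢ 0<p) = l , 0<p , p<v , eq
      unreached′ : ∀ v → pos′ v ≡ 0 → att′ v ≡ 0
      unreached′ v eq with X ≟ v
      ... | yes refl rewrite ≡ᵇ-refl X = contradiction eq λ ()
      ... | no X≢v rewrite ≢⇒≡ᵇ X≢v = unreached v eq

  -- Every vertex reached after s and t has its own parent edge.
  K≤2+m : ∀ {K pos ord lowV lowE att} → Order K pos ord → Tree pos lowV lowE att → K ≤ 2 + m
  K≤2+m {K} {pos} {ord} {lowV} {lowE} order tree = ≤-trans (m≤n+m∸n K 2) (+-monoʳ-≤ 2 (injection⇒≤ (λ i → lowE (ord (2 + i)))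
    (λ i i< → proj₁ (proj₁ (up i i<))) inj))
    where
    open Order order
    open Tree tree
    up : ∀ i → i < K ∸ 2 → let v = ord (2 + i) in Link (lowE v) v (lowV v) × pos (lowV v) < pos v
    up i i< with l , _ , p<v , _ ← parent (ord (2 + i)) (subst (2 <_) (sym (pos-ord (2 + i) (<∸2⇒ i<))) (s≤s (s≤s (s≤s z≤n)))) = l , p<v
    inj : ∀ i j → i < K ∸ 2 → j < K ∸ 2 → lowE (ord (2 + i)) ≡ lowE (ord (2 + j)) → i ≡ j
    inj i j i< j< eq with lᵢ , pᵢ ← up i i< | lⱼ , pⱼ ← up j j<
      with link-unique lᵢ (subst (λ f → Link f _ _) (sym eq) lⱼ)
    ... | inj₁ (v≡ , _) = suc-injective (suc-injective (ord-injective _ _ (<∸2⇒ i<) (<∸2⇒ j<) v≡))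
    ... | inj₂ (v≡ , p≡) = contradiction (<-trans (subst₂ (λ a b → pos a < pos b) p≡ v≡ pᵢ) pⱼ) (n≮n _)

-- Inserting one ear

module Climbing (n m : ℕ) (E0 E1 : ℕ → ℕ) (e : ℕ) (e<m : e < m)
  (ends< : ∀ {f} → f < m → E0 f < n × E1 f < n) (loopfree : ∀ {f} → f < m → E0 f ≢ E1 f) where

  open Invariants n m E0 E1 e e<m ends< loopfree

  module Ear (K : ℕ) (pos ord : ℕ → ℕ) (order : Order K pos ord) where
    open Order order

    -- `counted` bounds the top rank: an insertion raises `rk t` by one and uses up an unranked
    -- vertex. With `K≤n` this limits the length of the walks that write the cycles.
    record Ranked (rk : ℕ → ℕ) : Set where
      field
        rk-s      : rk s ≡ 1
        injective : ∀ u v → 0 < rk u → rk u ≡ rk v → u ≡ v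
        top       : ∀ v → rk v ≤ rk t
        reached   : ∀ v → 0 < rk v → 0 < pos v
        counted   : rk t + zeros K (rk ∘ ord) ≤ 2 + K

      0<rk-s : 0 < rk s
      0<rk-s = ≤-reflexive (sym rk-s)

      0<rk-t : 0 < rk t
      0<rk-t = ≤-trans 0<rk-s (top s)

    -- While an ear is being inserted, the low or the high neighbour of some
    -- vertices is not yet in order: these are described by the two holes.
    record Wired (LowHole HighHole : ℕ → ℕ → Set) (lowV lowE highV highE rk : ℕ → ℕ) : Set where
      field
        low    : ∀ v → 0 < rk v → v ≢ s →
                 Link (lowE v) v (lowV v) × ((0 < rk (lowV v) × rk (lowV v) < rk v) ⊎ LowHole v (lowV v))
        high   : ∀ v → 0 < rk v → v ≢ t →
                 Link (highE v) v (highV v) × ((0 < rk (highV v) × rk v < rk (highV v)) ⊎ HighHole v (highV v))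
        lowE-t : lowE t ≡ e
        parent : ∀ v → 0 < pos v → rk v ≡ 0 →
                 Link (lowE v) v (lowV v) × 0 < pos (lowV v) × pos (lowV v) < pos v

    NoHole : ℕ → ℕ → Set
    NoHole _ _ = Absurd

    ParentAnchored : (rk lowV att : ℕ → ℕ) → Set
    ParentAnchored rk lowV att = ∀ v → 0 < pos v → rk v ≡ 0 → att v ≡ att (lowV v)

    -- w enters the numbering just above rank c.
    module Insert {rk rk′ : ℕ → ℕ} {w c : ℕ} (ranked : Ranked rk) (out : rk w ≡ 0) (0<pos-w : 0 < pos w)
      (0<c : 0 < c) (c<top : c < rk t)
      (at-w : rk′ w ≡ suc c) (off-w : ∀ v → w ≢ v → rk′ v ≡ lift c (rk v)) where
      open Ranked ranked

      member-≢ : ∀ {v} → 0 < rk v → w ≢ v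
      member-≢ = 0<⇒≢ rk out

      grows : ∀ v → 0 < rk v → 0 < rk′ v
      grows v 0<v = subst (0 <_) (sym (off-w v (member-≢ 0<v))) (≤-trans 0<v (lift-≥ c (rk v)))

      0<rk′w : 0 < rk′ w
      0<rk′w = subst (0 <_) (sym at-w) (s≤s z≤n)

      old : ∀ v → w ≢ v → 0 < rk′ v → 0 < rk v
      old v w≢v 0<v with rk v in eq | off-w v w≢v
      ... | suc _ | _   = s≤s z≤n
      ... | zero  | eq′ = contradiction (subst (0 <_) (trans eq′ (lift-below {c} {0} λ ())) 0<v) λ ()

      still-out : ∀ v → rk′ v ≡ 0 → w ≢ v × rk v ≡ 0
      still-out v eq = 0<⇒≢′ , zero-rk
        where
        0<⇒≢′ : w ≢ v
        0<⇒≢′ refl = contradiction (trans (sym at-w) eq) λ ()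
        zero-rk : rk v ≡ 0
        zero-rk = n≤0⇒n≡0 (≤-trans (lift-≥ c (rk v)) (≤-reflexive (trans (sym (off-w v 0<⇒≢′)) eq)))

      mono : ∀ {u v} → 0 < rk u → rk u < rk v → rk′ u < rk′ v
      mono {u} {v} 0<u u<v = subst₂ _<_ (sym (off-w u (member-≢ 0<u))) (sym (off-w v (member-≢ (<-trans 0<u u<v))))
        (lift-mono-< c u<v)

      above : ∀ {v} → c < rk v → suc c < rk′ v
      above {v} c<v = subst (suc c <_) (sym (trans (off-w v (member-≢ (<-trans 0<c c<v))) (lift-above c<v))) (s≤s c<v)

      below : ∀ {v} → 0 < rk v → rk v ≤ c → rk′ v ≡ rk v
      below {v} 0<v v≤c = trans (off-w v (member-≢ 0<v)) (lift-below (≤⇒≯ v≤c))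

      fewer : zeros K (rk′ ∘ ord) < zeros K (rk ∘ ord)
      fewer with j , j<K , eq ← ord-pos w 0<pos-w = zeros-strict K (λ j → grows (ord j)) j<K
        (trans (cong rk eq) out) (subst (0 <_) (sym (cong rk′ eq)) 0<rk′w)

      ranked′ : Ranked rk′
      ranked′ = record
        { rk-s      = trans (below 0<rk-s (≤-trans (≤-reflexive rk-s) 0<c)) rk-s
        ; injective = injective′
        ; top       = top′
        ; reached   = reached′
        ; counted   = begin
            rk′ t + zeros K (rk′ ∘ ord)    ≡⟨ cong (_+ zeros K (rk′ ∘ ord)) rk′t ⟩
            suc (rk t) + zeros K (rk′ ∘ ord) ≡⟨ +-suc (rk t) _ ⟨
            rk t + suc (zeros K (rk′ ∘ ord)) ≤⟨ +-monoʳ-≤ (rk t) fewer ⟩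
            rk t + zeros K (rk ∘ ord)        ≤⟨ counted ⟩
            2 + K ∎
        }
        where
        open ≤-Reasoning
        rk′t : rk′ t ≡ suc (rk t)
        rk′t = trans (off-w t (member-≢ 0<rk-t)) (lift-above c<top)
        injective′ : ∀ u v → 0 < rk′ u → rk′ u ≡ rk′ v → u ≡ v
        injective′ u v 0<u eq with w ≟ u | w ≟ v
        ... | yes refl | yes refl = refl
        ... | yes refl | no w≢v   = contradiction (trans (sym (off-w v w≢v)) (trans (sym eq) at-w)) (lift≢suc c (rk v))
        ... | no w≢u   | yes refl = contradiction (trans (sym (off-w u w≢u)) (trans eq at-w)) (lift≢suc c (rk u))
        ... | no w≢u   | no w≢v   = injective u v (old u w≢u 0<u)
          (lift-injective c (trans (sym (off-w u w≢u)) (trans eq (off-w v w≢v))))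
        top′ : ∀ v → rk′ v ≤ rk′ t
        top′ v with w ≟ v
        ... | yes refl = ≤-trans (≤-reflexive at-w) (<⇒≤ (above c<top))
        ... | no w≢v   = subst₂ _≤_ (sym (off-w v w≢v)) (sym (off-w t (member-≢ 0<rk-t))) (lift-mono-≤ c (top v))
        reached′ : ∀ v → 0 < rk′ v → 0 < pos v
        reached′ v 0<v with w ≟ v
        ... | yes refl = 0<pos-w
        ... | no w≢v   = reached v (old v w≢v 0<v)

    module _ (att rk₀ : ℕ → ℕ) (X Y a b : ℕ) where

      -- The walk from `X` to its anchor `a`: `w` comes next, entered from `z` along `g`. Every
      -- vertex is inserted directly above `a`, hence below its predecessor, so tree parents turn
      -- into low neighbours without being moved. By `fresh` the end is recognised: `att` stays
      -- unchanged meanwhile, so a vertex ranked on the way still has anchor `a` and was discovered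
      -- after `w`; a ranked `w` can only be `a`.
      record Climb₁ (w z g c : ℕ) (lowV lowE highV highE rk : ℕ → ℕ) : Set where
        field
          ranked : Ranked rk
          wired  : Wired (λ v u → u ≡ w × c < rk v) (λ v u → u ≡ Y × rk v < rk b) lowV lowE highV highE rk
          0<pos-w : 0 < pos w
          att-w  : att w ≡ a
          link   : Link g w z
          prev   : (0 < rk z × c < rk z) ⊎ z ≡ Y
          c≡     : c ≡ rk a
          0<c    : 0 < c
          c<b    : c < rk b
          grown  : ∀ v → 0 < rk₀ v → 0 < rk v
          fresh  : ∀ v → 0 < rk v → att v ≡ v ⊎ (att v ≡ a × pos w < pos v)
          anchored : ParentAnchored rk lowV att
          X-place : w ≡ X ⊎ (0 < rk X × rk X < rk b)

      climb₁ : ∀ {w z g c lowV lowE highV highE rk rk′} → Climb₁ w z g c lowV lowE highV highE rk → rk w ≡ 0 →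
        rk′ w ≡ suc c → (∀ v → w ≢ v → rk′ v ≡ lift c (rk v)) →
        Climb₁ (lowV w) w (lowE w) c lowV lowE (highV [ w ≔ z ]) (highE [ w ≔ g ]) rk′
        × zeros K (rk′ ∘ ord) < zeros K (rk ∘ ord)
      climb₁ {w} {z} {g} {c} {lowV} {lowE} {highV} {highE} {rk} {rk′} climb out at-w off-w = record
        { ranked   = ranked′
        ; wired    = record
          { low    = low′
          ; high   = high′
          ; lowE-t = lowE-t
          ; parent = λ v 0<v out′ → parent v 0<v (proj₂ (still-out v out′)) }
        ; 0<pos-w  = proj₁ (proj₂ (parent w 0<pos-w out))
        ; att-w    = trans (sym (anchored w 0<pos-w out)) att-w
        ; link     = link-sym (proj₁ (parent w 0<pos-w out))
        ; prev     = inj₁ (0<rk′w , ≤-reflexive (sym at-w))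
        ; c≡       = trans c≡ (sym (below {a} 0<rk-a (≤-reflexive (sym c≡))))
        ; 0<c      = 0<c
        ; c<b      = <-trans (n<1+n c) (above c<b)
        ; grown    = λ v 0<v → grows v (grown v 0<v)
        ; fresh    = fresh′
        ; anchored = λ v 0<v out′ → anchored v 0<v (proj₂ (still-out v out′))
        ; X-place  = inj₂ X-place′ } , fewer
        where
        open Climb₁ climb
        open Ranked ranked
        open Wired wired
        open Insert ranked out 0<pos-w 0<c (<-≤-trans c<b (top b)) at-w off-w
        0<rk-a : 0 < rk a
        0<rk-a = subst (0 <_) c≡ 0<c
        low′ : ∀ v → 0 < rk′ v → v ≢ s →
          Link (lowE v) v (lowV v) × ((0 < rk′ (lowV v) × rk′ (lowV v) < rk′ v) ⊎ (lowV v ≡ lowV w × c < rk′ v))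
        low′ v 0<v v≢s with w ≟ v
        -- The low hole passes on to `w`, whose parent is the next vertex of the walk.
        ... | yes refl = proj₁ (parent w 0<pos-w out) , inj₂ (refl , ≤-reflexive (sym at-w))
        ... | no w≢v with low v (old v w≢v 0<v) v≢s
        ...   | l , inj₁ (0<p , p<v)  = l , inj₁ (grows _ 0<p , mono 0<p p<v)
        ...   | l , inj₂ (refl , c<v) = l , inj₁ (0<rk′w , subst (_< rk′ v) (sym at-w) (above c<v))
        high′ : ∀ v → 0 < rk′ v → v ≢ t → let h = (highV [ w ≔ z ]) v in
          Link ((highE [ w ≔ g ]) v) v h × ((0 < rk′ h × rk′ v < rk′ h) ⊎ (h ≡ Y × rk′ v < rk′ b))
        high′ v 0<v v≢t with w ≟ v
        ... | yes refl rewrite ≡ᵇ-refl w = link , Sum.map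
                (λ (0<z , c<z) → grows z 0<z , subst (_< rk′ z) (sym at-w) (above c<z))
                (λ z≡Y → z≡Y , subst (_< rk′ b) (sym at-w) (above c<b)) prev
        ... | no w≢v rewrite ≢⇒≡ᵇ w≢v with high v (old v w≢v 0<v) v≢t
        ...   | l , inj₁ (0<h , v<h)  = l , inj₁ (grows _ 0<h , mono (old v w≢v 0<v) v<h)
        ...   | l , inj₂ (h≡Y , v<b)  = l , inj₂ (h≡Y , mono (old v w≢v 0<v) v<b)
        fresh′ : ∀ v → 0 < rk′ v → att v ≡ v ⊎ (att v ≡ a × pos (lowV w) < pos v)
        fresh′ v 0<v with w ≟ v
        ... | yes refl = inj₂ (att-w , proj₂ (proj₂ (parent w 0<pos-w out)))
        ... | no w≢v with fresh v (old v w≢v 0<v)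
        ...   | inj₁ eq        = inj₁ eq
        ...   | inj₂ (eq , lt) = inj₂ (eq , <-trans (proj₂ (proj₂ (parent w 0<pos-w out))) lt)
        X-place′ : 0 < rk′ X × rk′ X < rk′ b
        X-place′ with X-place
        ... | inj₁ refl        = 0<rk′w , subst (_< rk′ b) (sym at-w) (above c<b)
        ... | inj₂ (0<X , X<b) = grows X 0<X , mono 0<X X<b

      -- The walk from `Y` to its anchor `b`, against the orientation of the first: every vertex is
      -- inserted directly below `b`, above its predecessor, so the tree parent becomes the high
      -- neighbour and the low one is overwritten. `c` stays just below `rk b` and grows with it.
      record Climb₂ (w z g c : ℕ) (lowV lowE highV highE rk : ℕ → ℕ) : Set where
        field
          ranked : Ranked rk
          wired  : Wired NoHole (λ v u → u ≡ w × rk v ≤ c) lowV lowE highV highE rk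
          0<pos-w : 0 < pos w
          att-w  : att w ≡ b
          link   : Link g w z
          0<z    : 0 < rk z
          z≤c    : rk z ≤ c
          b≡     : rk b ≡ suc c
          0<c    : 0 < c
          grown  : ∀ v → 0 < rk₀ v → 0 < rk v
          fresh  : ∀ v → 0 < rk v → att v ≡ v ⊎ att v ≡ a ⊎ (att v ≡ b × pos w < pos v)
          anchored : ParentAnchored rk lowV att
          0<X    : 0 < rk X
          Y-place : w ≡ Y ⊎ 0 < rk Y

      -- The first climb has arrived at `a`, which closes its low holes; the hole left open, the
      -- high neighbour `Y`, is where the second climb begins. Insertion takes place above `c`,
      -- hence the predecessor of `rk b`.
      turn : ∀ {w z g c lowV lowE highV highE rk f} → Climb₁ w z g c lowV lowE highV highE rk → 0 < rk w →
        0 < pos Y → att Y ≡ b → Link f Y X →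
        Climb₂ Y X f (rk b ∸ 1) lowV lowE highV highE rk
      turn {w} {z} {g} {c} {lowV} {lowE} {highV} {highE} {rk} {f} climb 0<w 0<pos-Y att-Y link-f = record
        { ranked = ranked
        ; wired  = record
          { low    = λ v 0<v v≢s → low′ v (low v 0<v v≢s)
          ; high   = λ v 0<v v≢t → proj₁ (high v 0<v v≢t) ,
                       Sum.map₂ (λ (u≡Y , v<b) → u≡Y , <⇒≤pred v<b) (proj₂ (high v 0<v v≢t))
          ; lowE-t = lowE-t
          ; parent = parent }
        ; 0<pos-w = 0<pos-Y
        ; att-w  = att-Y
        ; link   = link-f
        ; 0<z    = proj₁ X-place′
        ; z≤c    = <⇒≤pred (proj₂ X-place′)
        ; b≡     = sym (m+[n∸m]≡n {1} (<-trans (proj₁ X-place′) (proj₂ X-place′)))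
        ; 0<c    = ≤-trans (proj₁ X-place′) (<⇒≤pred (proj₂ X-place′))
        ; grown  = grown
        ; fresh  = λ v 0<v → Sum.map₂ (λ (eq , _) → inj₁ eq) (fresh v 0<v)
        ; anchored = anchored
        ; 0<X    = proj₁ X-place′
        ; Y-place = inj₁ refl }
        where
        open Climb₁ climb
        open Ranked ranked
        open Wired wired
        w≡a : w ≡ a
        w≡a with fresh w 0<w
        ... | inj₁ eq       = trans (sym eq) att-w
        ... | inj₂ (_ , lt) = contradiction lt (n≮n _)
        low′ : ∀ v → Link (lowE v) v (lowV v) × ((0 < rk (lowV v) × rk (lowV v) < rk v) ⊎ (lowV v ≡ w × c < rk v)) →
          Link (lowE v) v (lowV v) × ((0 < rk (lowV v) × rk (lowV v) < rk v) ⊎ Absurd)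
        low′ v (l , inj₁ ok)          = l , inj₁ ok
        low′ v (l , inj₂ (eq , c<v)) rewrite eq = l , inj₁ (0<w , subst (_< rk v) (trans c≡ (cong rk (sym w≡a))) c<v)
        X-place′ : 0 < rk X × rk X < rk b
        X-place′ with X-place
        ... | inj₁ refl  = 0<w , subst (_< rk b) (trans c≡ (cong rk (sym w≡a))) c<b
        ... | inj₂ place = place

      climb₂ : ∀ {w z g c lowV lowE highV highE rk rk′} → Climb₂ w z g c lowV lowE highV highE rk → rk w ≡ 0 →
        rk′ w ≡ suc c → (∀ v → w ≢ v → rk′ v ≡ lift c (rk v)) →
        Climb₂ (lowV w) w (lowE w) (suc c) (lowV [ w ≔ z ]) (lowE [ w ≔ g ]) (highV [ w ≔ lowV w ]) (highE [ w ≔ lowE w ]) rk′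
        × zeros K (rk′ ∘ ord) < zeros K (rk ∘ ord)
      climb₂ {w} {z} {g} {c} {lowV} {lowE} {highV} {highE} {rk} {rk′} climb out at-w off-w = record
        { ranked   = ranked′
        ; wired    = record
          { low    = low′
          ; high   = high′
          ; lowE-t = trans (≔-other lowE (member-≢ 0<rk-t)) lowE-t
          ; parent = parent′ }
        ; 0<pos-w  = proj₁ (proj₂ (parent w 0<pos-w out))
        ; att-w    = trans (sym (anchored w 0<pos-w out)) att-w
        ; link     = link-sym (proj₁ (parent w 0<pos-w out))
        ; 0<z      = 0<rk′w
        ; z≤c      = ≤-reflexive at-w
        ; b≡       = trans (trans (off-w b (member-≢ 0<rk-b)) (lift-above c<b)) (cong suc b≡)
        ; 0<c      = s≤s z≤n
        ; grown    = λ v 0<v → grows v (grown v 0<v)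
        ; fresh    = fresh′
        ; anchored = anchored′
        ; 0<X      = grows X 0<X
        ; Y-place  = inj₂ Y-place′ } , fewer
        where
        open Climb₂ climb
        open Ranked ranked
        open Wired wired
        c<b : c < rk b
        c<b = ≤-reflexive (sym b≡)
        0<rk-b : 0 < rk b
        0<rk-b = <-trans 0<c c<b
        open Insert ranked out 0<pos-w 0<c (<-≤-trans c<b (top b)) at-w off-w
        low′ : ∀ v → 0 < rk′ v → v ≢ s → let p = (lowV [ w ≔ z ]) v in
          Link ((lowE [ w ≔ g ]) v) v p × ((0 < rk′ p × rk′ p < rk′ v) ⊎ Absurd)
        low′ v 0<v v≢s with w ≟ v
        ... | yes refl rewrite ≡ᵇ-refl w = link , inj₁ (grows z 0<z , subst₂ _<_ (sym (below 0<z z≤c)) (sym at-w) (s≤s z≤c))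
        ... | no w≢v rewrite ≢⇒≡ᵇ w≢v with low v (old v w≢v 0<v) v≢s
        ...   | l , inj₁ (0<p , p<v) = l , inj₁ (grows _ 0<p , mono 0<p p<v)
        high′ : ∀ v → 0 < rk′ v → v ≢ t → let h = (highV [ w ≔ lowV w ]) v in
          Link ((highE [ w ≔ lowE w ]) v) v h × ((0 < rk′ h × rk′ v < rk′ h) ⊎ (h ≡ lowV w × rk′ v ≤ suc c))
        high′ v 0<v v≢t with w ≟ v
        ... | yes refl rewrite ≡ᵇ-refl w = proj₁ (parent w 0<pos-w out) , inj₂ (refl , ≤-reflexive at-w)
        ... | no w≢v rewrite ≢⇒≡ᵇ w≢v with high v (old v w≢v 0<v) v≢t
        ...   | l , inj₁ (0<h , v<h)  = l , inj₁ (grows _ 0<h , mono (old v w≢v 0<v) v<h)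
        ...   | l , inj₂ (h≡w , v≤c) rewrite h≡w =
          l , inj₁ (0<rk′w , subst₂ _<_ (sym (below (old v w≢v 0<v) v≤c)) (sym at-w) (s≤s v≤c))
        -- Overwriting the low entries of `w` loses no parent: `w` is ranked now, and only unranked
        -- vertices are asked for theirs.
        parent′ : ∀ v → 0 < pos v → rk′ v ≡ 0 → let p = (lowV [ w ≔ z ]) v in
          Link ((lowE [ w ≔ g ]) v) v p × 0 < pos p × pos p < pos v
        parent′ v 0<v out′ with w≢v , out″ ← still-out v out′ rewrite ≢⇒≡ᵇ w≢v = parent v 0<v out″
        anchored′ : ParentAnchored rk′ (lowV [ w ≔ z ]) att
        anchored′ v 0<v out′ with w≢v , out″ ← still-out v out′ rewrite ≢⇒≡ᵇ w≢v = anchored v 0<v out″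
        fresh′ : ∀ v → 0 < rk′ v → att v ≡ v ⊎ att v ≡ a ⊎ (att v ≡ b × pos (lowV w) < pos v)
        fresh′ v 0<v with w ≟ v
        ... | yes refl = inj₂ (inj₂ (att-w , proj₂ (proj₂ (parent w 0<pos-w out))))
        ... | no w≢v with fresh v (old v w≢v 0<v)
        ...   | inj₁ eq               = inj₁ eq
        ...   | inj₂ (inj₁ eq)        = inj₂ (inj₁ eq)
        ...   | inj₂ (inj₂ (eq , lt)) = inj₂ (inj₂ (eq , <-trans (proj₂ (proj₂ (parent w 0<pos-w out))) lt))
        Y-place′ : 0 < rk′ Y
        Y-place′ with Y-place
        ... | inj₁ refl = 0<rk′w
        ... | inj₂ 0<Y  = grows Y 0<Y

      record Inserted (lowV lowE highV highE rk : ℕ → ℕ) : Set where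
        field
          ranked : Ranked rk
          wired  : Wired NoHole NoHole lowV lowE highV highE rk
          grown  : ∀ v → 0 < rk₀ v → 0 < rk v
          0<X    : 0 < rk X
          0<Y    : 0 < rk Y

      -- `a ≢ b` keeps the vertices ranked in the first climb from being mistaken for the end of the
      -- second.
      arrive : ∀ {w z g c lowV lowE highV highE rk} → Climb₂ w z g c lowV lowE highV highE rk → 0 < rk w → a ≢ b →
        Inserted lowV lowE highV highE rk
      arrive {w} {c = c} {lowV} {lowE} {highV} {highE} {rk} climb 0<w a≢b = record
        { ranked = ranked
        ; wired  = record { low = low ; high = λ v 0<v v≢t → high′ v (high v 0<v v≢t) ; lowE-t = lowE-t ; parent = parent }
        ; grown  = grown
        ; 0<X    = 0<X
        ; 0<Y    = 0<Y }
        where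
        open Climb₂ climb
        open Ranked ranked
        open Wired wired
        w≡b : w ≡ b
        w≡b with fresh w 0<w
        ... | inj₁ eq               = trans (sym eq) att-w
        ... | inj₂ (inj₁ eq)        = contradiction (trans (sym eq) att-w) a≢b
        ... | inj₂ (inj₂ (_ , lt)) = contradiction lt (n≮n _)
        high′ : ∀ v → Link (highE v) v (highV v) × ((0 < rk (highV v) × rk v < rk (highV v)) ⊎ (highV v ≡ w × rk v ≤ c)) →
          Link (highE v) v (highV v) × ((0 < rk (highV v) × rk v < rk (highV v)) ⊎ Absurd)
        high′ v (l , inj₁ ok) = l , inj₁ ok
        high′ v (l , inj₂ (eq , v≤c)) rewrite eq =
          l , inj₁ (0<w , <-≤-trans (s≤s v≤c) (≤-reflexive (trans (sym b≡) (cong rk (sym w≡b)))))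
        0<Y : 0 < rk Y
        0<Y with Y-place
        ... | inj₁ refl = 0<w
        ... | inj₂ 0<Y  = 0<Y

-- The state between two ears

module Settling (n m : ℕ) (E0 E1 : ℕ → ℕ) (e : ℕ) (e<m : e < m)
  (ends< : ∀ {f} → f < m → E0 f < n × E1 f < n) (loopfree : ∀ {f} → f < m → E0 f ≢ E1 f) where

  open Invariants n m E0 E1 e e<m ends< loopfree
  open Climbing n m E0 E1 e e<m ends< loopfree

  record Initial (highV highE rk : ℕ → ℕ) : Set where
    field
      rk-s      : rk s ≡ 1
      rk-t      : rk t ≡ 2
      rk-others : ∀ v → v ≢ s → v ≢ t → rk v ≡ 0
      highV-s   : highV s ≡ t
      highE-s   : highE s ≡ e

  Closed : (ℕ → ℕ) → Set
  Closed pos = ∀ f u v → Link f u v → 0 < pos u → 0 < pos v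

  module Settle (K : ℕ) (pos ord : ℕ → ℕ) (order : Order K pos ord) where
    open Order order
    open Ear K pos ord order

    record Settled (lowV lowE highV highE att rk : ℕ → ℕ) : Set where
      field
        ranked    : Ranked rk
        wired     : Wired NoHole NoHole lowV lowE highV highE rk
        att-member : ∀ v → 0 < rk v → att v ≡ v
        anchored  : ParentAnchored rk lowV att
        unreached : ∀ v → pos v ≡ 0 → att v ≡ 0

    settled-initially : ∀ {lowV lowE highV highE att rk} → Tree pos lowV lowE att → Initial highV highE rk →
      Settled lowV lowE highV highE att rk
    settled-initially {lowV} {lowE} {highV} {highE} {att} {rk} tree initial = record
      { ranked = record
        { rk-s = rk-s
        ; injective = λ u v 0<u eq → inj u v (member u 0<u) (member v (subst (0 <_) eq 0<u)) eq
        ; top = top′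
        ; reached = λ v 0<v → reached′ v (member v 0<v)
        ; counted = +-mono-≤ (≤-reflexive rk-t) (zeros≤ K (rk ∘ ord)) }
      ; wired = record
        { low = λ v 0<v v≢s → low′ v (member v 0<v) v≢s
        ; high = λ v 0<v v≢t → high′ v (member v 0<v) v≢t
        ; lowE-t = lowE-t
        ; parent = λ v 0<v out → let l , 0<p , p<v , _ = parent v (late v 0<v out) in l , 0<p , p<v }
      ; att-member = λ v 0<v → att-member′ v (member v 0<v)
      ; anchored = λ v 0<v out → proj₂ (proj₂ (proj₂ (parent v (late v 0<v out))))
      ; unreached = unreached }
      where
      open Tree tree
      open Initial initial
      member : ∀ v → 0 < rk v → v ≡ s ⊎ v ≡ t
      member v 0<v with v ≟ s | v ≟ t
      ... | yes v≡s | _       = inj₁ v≡s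
      ... | no _    | yes v≡t = inj₂ v≡t
      ... | no v≢s  | no v≢t  = contradiction (subst (0 <_) (rk-others v v≢s v≢t) 0<v) λ ()
      inj : ∀ u v → u ≡ s ⊎ u ≡ t → v ≡ s ⊎ v ≡ t → rk u ≡ rk v → u ≡ v
      inj u v (inj₁ refl) (inj₁ refl) _ = refl
      inj u v (inj₂ refl) (inj₂ refl) _ = refl
      inj u v (inj₁ refl) (inj₂ refl) eq = contradiction (trans (sym rk-s) (trans eq rk-t)) λ ()
      inj u v (inj₂ refl) (inj₁ refl) eq = contradiction (trans (sym rk-s) (trans (sym eq) rk-t)) λ ()
      top′ : ∀ v → rk v ≤ rk t
      top′ v with v ≟ s | v ≟ t
      ... | yes refl | _       = subst₂ _≤_ (sym rk-s) (sym rk-t) (s≤s z≤n)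
      ... | no _    | yes refl = ≤-refl
      ... | no v≢s  | no v≢t   = ≤-trans (≤-reflexive (rk-others v v≢s v≢t)) z≤n
      reached′ : ∀ v → v ≡ s ⊎ v ≡ t → 0 < pos v
      reached′ v (inj₁ refl) = subst (0 <_) (sym pos-s) (s≤s z≤n)
      reached′ v (inj₂ refl) = subst (0 <_) (sym pos-t) (s≤s z≤n)
      s<t : rk s < rk t
      s<t = subst₂ _<_ (sym rk-s) (sym rk-t) ≤-refl
      0<rk-s : 0 < rk s
      0<rk-s = subst (0 <_) (sym rk-s) ≤-refl
      low′ : ∀ v → v ≡ s ⊎ v ≡ t → v ≢ s →
        Link (lowE v) v (lowV v) × ((0 < rk (lowV v) × rk (lowV v) < rk v) ⊎ Absurd)
      low′ v (inj₁ v≡s) v≢s = contradiction v≡s v≢s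
      low′ v (inj₂ refl) _ rewrite lowE-t | lowV-t = link-sym link-e , inj₁ (0<rk-s , s<t)
      high′ : ∀ v → v ≡ s ⊎ v ≡ t → v ≢ t →
        Link (highE v) v (highV v) × ((0 < rk (highV v) × rk v < rk (highV v)) ⊎ Absurd)
      high′ v (inj₂ v≡t) v≢t = contradiction v≡t v≢t
      high′ v (inj₁ refl) _ rewrite highE-s | highV-s = link-e , inj₁ (<-trans 0<rk-s s<t , s<t)
      att-member′ : ∀ v → v ≡ s ⊎ v ≡ t → att v ≡ v
      att-member′ v (inj₁ refl) = att-s
      att-member′ v (inj₂ refl) = att-t
      late : ∀ v → 0 < pos v → rk v ≡ 0 → 2 < pos v
      late v 0<v out = ≤∧≢⇒< (≤∧≢⇒< 0<v λ eq → not-s (pos≤1 v (sym eq))) λ eq → not-t (pos≡2 v (sym eq))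
        where
        not-s : v ≢ s
        not-s refl = contradiction (trans (sym out) rk-s) λ ()
        not-t : v ≢ t
        not-t refl = contradiction (trans (sym out) rk-t) λ ()

    module _ {lowV lowE highV highE att rk : ℕ → ℕ} (settled : Settled lowV lowE highV highE att rk)
             (closed : Closed pos) where
      open Settled settled
      open Ranked ranked
      open Wired wired

      0<rk-att : ∀ v → 0 < pos v → 0 < rk (att v)
      0<rk-att v = go (suc (pos v)) v ≤-refl
        where
        go : ∀ k v → pos v < k → 0 < pos v → 0 < rk (att v)
        go (suc k) v bound 0<v with rk v in eq
        ... | suc _ = subst (λ u → 0 < rk u) (sym (att-member v (subst (0 <_) (sym eq) (s≤s z≤n)))) (subst (0 <_) (sym eq) (s≤s z≤n))
        ... | zero with _ , 0<p , p<v ← parent v 0<v eq =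
          subst (λ u → 0 < rk u) (sym (anchored v 0<v eq)) (go k (lowV v) (<-≤-trans p<v (≤-pred bound)) 0<p)

      -- An unreached vertex has the anchor 0 of blank memory, which may happen to name a ranked
      -- vertex. Since the reached set is closed, this occurs at both ends of an edge or at neither,
      -- and equal anchors never start an ear.
      reached-together : ∀ {f u v} → Link f u v → (0 < pos u × 0 < pos v) ⊎ (att u ≡ att v)
      reached-together {f} {u} {v} l with pos u in eq-u | pos v in eq-v
      ... | suc _ | suc _ = inj₁ (s≤s z≤n , s≤s z≤n)
      ... | zero  | zero  = inj₂ (trans (unreached u eq-u) (sym (unreached v eq-v)))
      ... | suc _ | zero  = contradiction (subst (0 <_) eq-v (closed _ _ _ l (subst (0 <_) (sym eq-u) (s≤s z≤n)))) λ ()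
      ... | zero  | suc _ = contradiction (subst (0 <_) eq-u (closed _ _ _ (link-sym l) (subst (0 <_) (sym eq-v) (s≤s z≤n)))) λ ()

      ear-reached : ∀ {f u v} → Link f u v → rk (att u) < rk (att v) → 0 < pos u × 0 < pos v
      ear-reached l less with reached-together l
      ... | inj₁ both = both
      ... | inj₂ eq   = contradiction (cong rk eq) (<⇒≢ less)

      same-rank⇒same-anchor : ∀ {f u v} → Link f u v → rk (att u) ≡ rk (att v) → att u ≡ att v
      same-rank⇒same-anchor {u = u} l eq with reached-together l
      ... | inj₁ (0<u , _) = injective _ _ (0<rk-att u 0<u) eq
      ... | inj₂ same      = same

      set-out : ∀ {f X Y} → Link f X Y → rk (att X) < rk (att Y) →
        Climb₁ att rk X Y (att X) (att Y) X Y f (rk (att X)) lowV lowE highV highE rk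
      set-out {X = X} l less = record
        { ranked   = ranked
        ; wired    = record
          { low    = λ v 0<v v≢s → Product.map₂ (Sum.map₂ absurd) (low v 0<v v≢s)
          ; high   = λ v 0<v v≢t → Product.map₂ (Sum.map₂ absurd) (high v 0<v v≢t)
          ; lowE-t = lowE-t
          ; parent = parent }
        ; 0<pos-w  = proj₁ (ear-reached l less)
        ; att-w    = refl
        ; link     = l
        ; prev     = inj₂ refl
        ; c≡       = refl
        ; 0<c      = 0<rk-att X (proj₁ (ear-reached l less))
        ; c<b      = less
        ; grown    = λ _ 0<v → 0<v
        ; fresh    = λ v 0<v → inj₁ (att-member v 0<v)
        ; anchored = anchored
        ; X-place  = inj₁ refl }

    -- Anchors are recomputed in the order of discovery. Parents come before their children, so the
    -- new anchor of a parent is ready when needed and is not written again.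
    record Anchored (lowV rk : ℕ → ℕ) (i : ℕ) (att : ℕ → ℕ) : Set where
      field
        i≤K       : i ≤ K
        members   : ∀ v → 0 < pos v → pos v ≤ i → 0 < rk v → att v ≡ v
        others    : ∀ v → 0 < pos v → pos v ≤ i → rk v ≡ 0 → att v ≡ att (lowV v)
        unreached : ∀ v → pos v ≡ 0 → att v ≡ 0

    module _ {lowV lowE highV highE rk : ℕ → ℕ} (ranked : Ranked rk)
             (wired : Wired NoHole NoHole lowV lowE highV highE rk) where
      open Ranked ranked
      open Wired wired

      anchor-next : ∀ {i att u} → Anchored lowV rk i att → i < K →
        (0 < rk (ord i) → u ≡ ord i) → (rk (ord i) ≡ 0 → u ≡ att (lowV (ord i))) →
        Anchored lowV rk (suc i) (att [ ord i ≔ u ])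
      anchor-next {i} {att} {u} anch i<K if-member if-other = record
        { i≤K       = i<K
        ; members   = members′
        ; others    = others′
        ; unreached = λ v eq → trans (≔-other att (0<⇒≢ pos eq (0<pos-ord i<K) ∘ sym)) (unreached v eq) }
        where
        open Anchored anch
        earlier : ∀ v → ord i ≢ v → 0 < pos v → pos v ≤ suc i → pos v ≤ i
        earlier v ≢v 0<v v≤ with j , j<K , refl ← ord-pos v 0<v =
          ≤-pred (≤∧≢⇒< v≤ λ eq → ≢v (cong ord (suc-injective (trans (sym eq) (pos-ord j j<K)))))
        members′ : ∀ v → 0 < pos v → pos v ≤ suc i → 0 < rk v → (att [ ord i ≔ u ]) v ≡ v
        members′ v 0<v v≤ 0<rk with ord i ≟ v
        ... | yes refl = trans (≔-same att (ord i)) (if-member 0<rk)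
        ... | no ≢v    = trans (≔-other att ≢v) (members v 0<v (earlier v ≢v 0<v v≤) 0<rk)
        others′ : ∀ v → 0 < pos v → pos v ≤ suc i → rk v ≡ 0 → (att [ ord i ≔ u ]) v ≡ (att [ ord i ≔ u ]) (lowV v)
        others′ v 0<v v≤ out = trans lhs (sym (≔-other att ≢p))
          where
          p<v : pos (lowV v) < pos v
          p<v = proj₂ (proj₂ (parent v 0<v out))
          ≢p : ord i ≢ lowV v
          ≢p eq = contradiction (<-≤-trans (subst (_< pos v) (trans (cong pos (sym eq)) (pos-ord i i<K)) p<v) v≤) (n≮n _)
          lhs : (att [ ord i ≔ u ]) v ≡ att (lowV v)
          lhs with ord i ≟ v
          ... | yes refl = trans (≔-same att (ord i)) (if-other out)
          ... | no ≢v    = trans (≔-other att ≢v) (others v 0<v (earlier v ≢v 0<v v≤) out)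

      settle : ∀ {att} → Anchored lowV rk K att → Settled lowV lowE highV highE att rk
      settle anch = record
        { ranked = ranked ; wired = wired
        ; att-member = λ v 0<v → members v (reached v 0<v) (pos≤K v) 0<v
        ; anchored = λ v 0<v out → others v 0<v (pos≤K v) out
        ; unreached = unreached }
        where open Anchored anch

-- Registers 0–2 and arrays 0, 1 hold the input.  Registers: 3, 4 the ends s, t
-- of the root edge; 5 the edge being scanned; 6, 7 its ends, in order; 8 a
-- walker; 9, 10 the vertex and edge it came from; 11 a loop counter; 12 the
-- number of vertices reached; 13 a rank; 14 a count.  Arrays: 2 position in the
-- order of discovery; 3 that order; 4, 5 low neighbour and edge (for unranked
-- vertices: parent and parent edge); 6, 7 high neighbour and edge; 8 anchor,
-- the nearest ranked ancestor; 9 rank.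

initialise : Program
initialise =
  setReg 3 (cell 0 (reg 2)) ⨾ setReg 4 (cell 1 (reg 2)) ⨾ setReg 12 (lit 2) ⨾
  setCell 2 (reg 3) (lit 1) ⨾ setCell 2 (reg 4) (lit 2) ⨾
  setCell 3 (lit 0) (reg 3) ⨾ setCell 3 (lit 1) (reg 4) ⨾
  setCell 4 (reg 4) (reg 3) ⨾ setCell 5 (reg 4) (reg 2) ⨾
  setCell 6 (reg 3) (reg 4) ⨾ setCell 7 (reg 3) (reg 2) ⨾
  setCell 8 (reg 3) (reg 3) ⨾ setCell 8 (reg 4) (reg 4) ⨾
  setCell 9 (reg 3) (lit 1) ⨾ setCell 9 (reg 4) (lit 2) ⨾
  setReg 5 (lit 0)

orient : (Expr → Expr) → Program
orient key = ifLess (key (cell 0 (reg 5))) (key (cell 1 (reg 5)))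
  (setReg 6 (cell 0 (reg 5)) ⨾ setReg 7 (cell 1 (reg 5)))
  (setReg 6 (cell 1 (reg 5)) ⨾ setReg 7 (cell 0 (reg 5)))

-- A new vertex may turn an edge already scanned into one that leaves the reached set. The scan
-- therefore restarts, which costs O(m) for each vertex.
growStep growBody grow : Program
growStep =
  setCell 4 (reg 6) (reg 7) ⨾ setCell 5 (reg 6) (reg 5) ⨾
  setCell 3 (reg 12) (reg 6) ⨾ succReg 12 ⨾ setCell 2 (reg 6) (reg 12) ⨾
  setCell 8 (reg 6) (cell 8 (reg 7)) ⨾ setReg 5 (lit 0)
growBody = orient (cell 2) ⨾
  ifLess (cell 2 (reg 6)) (lit 1)
    (ifLess (lit 0) (cell 2 (reg 7)) growStep (succReg 5))
    (succReg 5)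
grow = whileLess (reg 5) (reg 1) growBody

-- Correctness and cost of the search

module Growing (n m : ℕ) (E0 E1 : ℕ → ℕ) (e : ℕ) (e<m : e < m)
  (ends< : ∀ {f} → f < m → E0 f < n × E1 f < n) (loopfree : ∀ {f} → f < m → E0 f ≢ E1 f) where

  open Invariants n m E0 E1 e e<m ends< loopfree
  open Climbing n m E0 E1 e e<m ends< loopfree
  open Settling n m E0 E1 e e<m ends< loopfree

  -- Indexed by the values read from a state instead of the state: an assignment to another register
  -- or array leaves these values definitionally equal, so the same proof passes through it. Later
  -- invariants follow this pattern.
  record InputAt (r₀ r₁ r₂ r₄ : ℕ) (a₀ a₁ : ℕ → ℕ) (out : List ℕ) : Set where
    constructor input
    field
      n≡  : r₀ ≡ n
      m≡  : r₁ ≡ m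
      e≡  : r₂ ≡ e
      t≡  : r₄ ≡ t
      E0≡ : a₀ ≡ E0
      E1≡ : a₁ ≡ E1
      []≡ : out ≡ []

  Base : State → Set
  Base σ = InputAt (regs σ 0) (regs σ 1) (regs σ 2) (regs σ 4) (arrays σ 0) (arrays σ 1) (output σ)

  -- The rest of the program is verified once, for an arbitrary pair `x`, `y` ordered by key, and
  -- both outcomes of the comparison feed into it.
  run-orient : ∀ key (κ : ℕ → ℕ) {P Q} σ → arrays σ 0 ≡ E0 → arrays σ 1 ≡ E1 → regs σ 5 < m →
    (∀ x → ⟦ key x ⟧ σ ≡ κ (⟦ x ⟧ σ)) →
    (∀ x y → Link (regs σ 5) x y → κ x ≤ κ y →
      Run P ⟨ regs σ [ 6 ≔ x ] [ 7 ≔ y ] , arrays σ , output σ ⟩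
          (λ u → Q (guard (key (cell 0 (reg 5))) (key (cell 1 (reg 5))) + 6 + u))) →
    Run (orient key ⨾ P) σ Q
  run-orient key κ σ refl refl f<m key≡ rest with ⟦ key (cell 0 (reg 5)) ⟧ σ <? ⟦ key (cell 1 (reg 5)) ⟧ σ
  ... | yes less with u , σ′ , steps , q ← rest _ _ (f<m , inj₁ (refl , refl))
            (<⇒≤ (subst₂ _<_ (key≡ (cell 0 (reg 5))) (key≡ (cell 1 (reg 5))) less)) =
    _ , σ′ , ⨾⇓ (then⇓ less (exec-steps _ σ _)) steps , q
  ... | no nless with u , σ′ , steps , q ← rest _ _ (f<m , inj₂ (refl , refl))
            (≮⇒≥ (nless ∘ subst₂ _<_ (sym (key≡ (cell 0 (reg 5)))) (sym (key≡ (cell 1 (reg 5)))))) =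
    _ , σ′ , ⨾⇓ (else⇓ nless (exec-steps _ σ _)) steps , q

  record Grown (F K : ℕ) (pos ord lowV lowE att : ℕ → ℕ) : Set where
    field
      order    : Order K pos ord
      tree     : Tree pos lowV lowE att
      F≤m      : F ≤ m
      explored : ∀ {g u v} → g < F → Link g u v → 0 < pos u → 0 < pos v

  GrowInv : State → Set
  GrowInv σ = Base σ × Grown (regs σ 5) (regs σ 12) (arrays σ 2) (arrays σ 3) (arrays σ 4) (arrays σ 5) (arrays σ 8)
    × Initial (arrays σ 6) (arrays σ 7) (arrays σ 9)

  -- Every unreached vertex holds the credit for a complete scan of the edges and for its own
  -- insertion; 100 is a generous round bound on the work spent on one edge.
  growPotential : State → ℕ
  growPotential σ = (n ∸ regs σ 12) * (m * 100 + 100) + (m ∸ regs σ 5) * 100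

  skip-edge : ∀ {F K pos ord lowV lowE att} → Grown F K pos ord lowV lowE att → F < m →
    (∀ {u v} → Link F u v → 0 < pos u → 0 < pos v) → Grown (suc F) K pos ord lowV lowE att
  skip-edge {F} {pos = pos} g F<m ok = record
    { order = order ; tree = tree ; F≤m = F<m
    ; explored = λ g<1+F → by-cases (m<1+n⇒m<n∨m≡n g<1+F) }
    where
    open Grown g
    by-cases : ∀ {g u v} → g < F ⊎ g ≡ F → Link g u v → 0 < pos u → 0 < pos v
    by-cases (inj₁ g<F)  = explored g<F
    by-cases (inj₂ refl) = ok

  link-ends : ∀ {f x y u v} (P : ℕ → Set) → Link f x y → P x → P y → Link f u v → P u × P v
  link-ends P l px py l′ with link-unique l l′
  ... | inj₁ (refl , refl) = px , py
  ... | inj₂ (refl , refl) = py , px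

  grow-body : ∀ σ → GrowInv σ → regs σ 5 < regs σ 1 →
    Run growBody σ (λ τ σ′ → GrowInv σ′ × 3 + τ + growPotential σ′ ≤ growPotential σ)
  grow-body σ (base@(input _ refl _ _ E0≡ E1≡ _) , grown , initial) F<m =
    run-orient (cell 2) pos {Q = λ τ σ′ → GrowInv σ′ × 3 + τ + growPotential σ′ ≤ growPotential σ}
      σ E0≡ E1≡ F<m (λ _ → refl) λ x y link x≤y →
      run-if
        (λ x<1 → run-if
          (λ 0<y → run-exec growStep
            ( (base
            , record
              { order = extend-order order tree (n<1⇒n≡0 x<1) 0<y link
              ; tree = extend-tree order tree (n<1⇒n≡0 x<1) 0<y link
              ; F≤m = z≤n
              ; explored = λ () }
            , initial)
            , pays (Order.K≤n (extend-order order tree (n<1⇒n≡0 x<1) 0<y link))))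
          (λ 0≮y → run-exec (succReg 5)
            ( (base , skip-edge grown F<m
                (λ l 0<u → contradiction (subst (0 <_) (proj₁ (link-ends (λ v → pos v ≡ 0) link
                  (n<1⇒n≡0 x<1) (n≤0⇒n≡0 (≮⇒≥ 0≮y)) l)) 0<u) λ ()) , initial)
            , passes 24)))
        (λ x≮1 → run-exec (succReg 5)
          ( (base , skip-edge grown F<m
              (λ l _ → proj₂ (link-ends (λ v → 0 < pos v) link (≮⇒≥ x≮1) (≤-trans (≮⇒≥ x≮1) x≤y) l)) , initial)
          , passes 20))
    where
    open Grown grown
    pos = arrays σ 2
    K = regs σ 12
    F = regs σ 5
    passes : ∀ k {_ : T (3 + k ≤ᵇ 100)} →
      3 + k + ((n ∸ K) * (m * 100 + 100) + (m ∸ suc F) * 100) ≤ (n ∸ K) * (m * 100 + 100) + (m ∸ F) * 100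
    passes k {ok} = begin
      3 + k + ((n ∸ K) * M + (m ∸ suc F) * 100) ≡⟨ +-assoc (3 + k) _ _ ⟨
      3 + k + (n ∸ K) * M + (m ∸ suc F) * 100   ≡⟨ cong (_+ (m ∸ suc F) * 100) (+-comm (3 + k) _) ⟩
      (n ∸ K) * M + (3 + k) + (m ∸ suc F) * 100 ≡⟨ +-assoc ((n ∸ K) * M) _ _ ⟩
      (n ∸ K) * M + (3 + k + (m ∸ suc F) * 100) ≤⟨ +-monoʳ-≤ ((n ∸ K) * M) (tick (3 + k) 100 {ok} F<m) ⟩
      (n ∸ K) * M + (m ∸ F) * 100 ∎
      where
      open ≤-Reasoning
      M = m * 100 + 100
    pays : suc K ≤ n → 45 + ((n ∸ suc K) * (m * 100 + 100) + m * 100) ≤ (n ∸ K) * (m * 100 + 100) + (m ∸ F) * 100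
    pays K<n = begin
      45 + ((n ∸ suc K) * M + m * 100) ≡⟨ cong (45 +_) (+-comm _ (m * 100)) ⟩
      45 + (m * 100 + (n ∸ suc K) * M) ≡⟨ +-assoc 45 (m * 100) _ ⟨
      45 + m * 100 + (n ∸ suc K) * M   ≡⟨ cong (_+ (n ∸ suc K) * M) (+-comm 45 (m * 100)) ⟩
      m * 100 + 45 + (n ∸ suc K) * M   ≤⟨ +-monoˡ-≤ _ (+-monoʳ-≤ (m * 100) (≤ᵇ⇒≤ 45 100 _)) ⟩
      M + (n ∸ suc K) * M              ≡⟨ cong (_* M) (+-∸-assoc 1 {n} {suc K} K<n) ⟨
      (n ∸ K) * M                      ≤⟨ m≤m+n _ _ ⟩
      (n ∸ K) * M + (m ∸ F) * 100 ∎
      where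
      open ≤-Reasoning
      M = m * 100 + 100

  run-grow : ∀ σ → GrowInv σ →
    Run grow σ (λ τ σ′ → GrowInv σ′ × Closed (arrays σ′ 2) × τ ≤ 3 + growPotential σ)
  run-grow σ inv = run-map
    (λ τ σ′ (inv′ , halt , bound) → inv′ , closed-at σ′ inv′ halt , ≤-trans (m≤m+n τ _) bound)
    (run-while GrowInv growPotential grow-body σ inv)
    where
    closed-at : ∀ σ′ → GrowInv σ′ → ¬ (regs σ′ 5 < regs σ′ 1) → Closed (arrays σ′ 2)
    closed-at σ′ (base , grown , _) halt _ _ _ link = Grown.explored grown
      (<-≤-trans (proj₁ link) (subst (_≤ regs σ′ 5) (InputAt.m≡ base) (≮⇒≥ halt))) link

  initial-order : ∀ {ord : ℕ → ℕ} → Order 2 ((λ _ → 0) [ s ≔ 1 ] [ t ≔ 2 ]) (ord [ 0 ≔ s ] [ 1 ≔ t ])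
  initial-order {ord} = record
    { pos-ord = λ where
        0 _ → pos-s′
        1 _ → pos-t′
        (suc (suc _)) (s≤s (s≤s ()))
    ; ord-pos = λ v 0<v → proj₁ (place v 0<v)
    ; vertex  = λ v 0<v → proj₂ (place v 0<v)
    ; pos-s   = pos-s′
    ; pos-t   = pos-t′ }
    where
    pos = (λ _ → 0) [ s ≔ 1 ] [ t ≔ 2 ]
    pos-s′ : pos s ≡ 1
    pos-s′ rewrite ≢⇒≡ᵇ (s≢t ∘ sym) | ≡ᵇ-refl s = refl
    pos-t′ : pos t ≡ 2
    pos-t′ rewrite ≡ᵇ-refl t = refl
    place : ∀ v → 0 < pos v → (∃[ j ] j < 2 × (ord [ 0 ≔ s ] [ 1 ≔ t ]) j ≡ v) × v < n
    place v 0<v with t ≟ v | s ≟ v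
    ... | yes refl | _        = (1 , ≤-refl , refl) , proj₂ (ends< e<m)
    ... | no _     | yes refl = (0 , s≤s z≤n , refl) , proj₁ (ends< e<m)
    ... | no t≢v   | no s≢v rewrite ≢⇒≡ᵇ t≢v | ≢⇒≡ᵇ s≢v = contradiction 0<v λ ()

  initial-tree : ∀ {lowV lowE : ℕ → ℕ} → Tree ((λ _ → 0) [ s ≔ 1 ] [ t ≔ 2 ])
    (lowV [ t ≔ s ]) (lowE [ t ≔ e ]) ((λ _ → 0) [ s ≔ s ] [ t ≔ t ])
  initial-tree {lowV} {lowE} = record
    { parent    = λ v 2<v → contradiction 2<v (≤⇒≯ (pos≤2 v))
    ; lowV-t    = ≔-same lowV t
    ; lowE-t    = ≔-same lowE t
    ; att-s     = att-s′
    ; att-t     = att-t′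
    ; unreached = unreached′ }
    where
    pos = (λ _ → 0) [ s ≔ 1 ] [ t ≔ 2 ]
    att = (λ _ → 0) [ s ≔ s ] [ t ≔ t ]
    att-s′ : att s ≡ s
    att-s′ rewrite ≢⇒≡ᵇ (s≢t ∘ sym) | ≡ᵇ-refl s = refl
    att-t′ : att t ≡ t
    att-t′ rewrite ≡ᵇ-refl t = refl
    pos≤2 : ∀ v → pos v ≤ 2
    pos≤2 v with t ≡ᵇ v | s ≡ᵇ v
    ... | true  | _     = ≤-refl
    ... | false | true  = s≤s z≤n
    ... | false | false = z≤n
    unreached′ : ∀ v → pos v ≡ 0 → att v ≡ 0
    unreached′ v eq with t ≡ᵇ v | s ≡ᵇ v
    ... | false | false = refl
    ... | true  | _     = contradiction eq λ ()
    ... | false | true  = contradiction eq λ ()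

  initial-numbering : ∀ {highV highE : ℕ → ℕ} →
    Initial (highV [ s ≔ t ]) (highE [ s ≔ e ]) ((λ _ → 0) [ s ≔ 1 ] [ t ≔ 2 ])
  initial-numbering {highV} {highE} = record
    { rk-s      = rk-s′
    ; rk-t      = rk-t′
    ; rk-others = rk-others′
    ; highV-s   = ≔-same highV s
    ; highE-s   = ≔-same highE s }
    where
    rk = (λ _ → 0) [ s ≔ 1 ] [ t ≔ 2 ]
    rk-s′ : rk s ≡ 1
    rk-s′ rewrite ≢⇒≡ᵇ (s≢t ∘ sym) | ≡ᵇ-refl s = refl
    rk-t′ : rk t ≡ 2
    rk-t′ rewrite ≡ᵇ-refl t = refl
    rk-others′ : ∀ v → v ≢ s → v ≢ t → rk v ≡ 0
    rk-others′ v v≢s v≢t rewrite ≢⇒≡ᵇ (v≢t ∘ sym) | ≢⇒≡ᵇ (v≢s ∘ sym) = refl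

  run-initialise : ∀ σ → regs σ 0 ≡ n → regs σ 1 ≡ m → regs σ 2 ≡ e → arrays σ 0 ≡ E0 → arrays σ 1 ≡ E1 →
    output σ ≡ [] → (∀ a → 2 ≤ a → arrays σ a ≡ λ _ → 0) →
    Run initialise σ (λ τ σ′ → GrowInv σ′ × regs σ′ 5 ≡ 0 × regs σ′ 12 ≡ 2 × τ ≡ duration initialise)
  run-initialise σ refl refl refl refl refl refl zero-arrays = run-exec initialise
    ( ( input refl refl refl refl refl refl refl
      , record
        { order    = subst (λ z → Order 2 (z [ s ≔ 1 ] [ t ≔ 2 ]) (arrays σ 3 [ 0 ≔ s ] [ 1 ≔ t ]))
                       (sym (zero-arrays 2 ≤-refl)) initial-order
        ; tree     = subst₂ (λ z z′ → Tree (z [ s ≔ 1 ] [ t ≔ 2 ]) (arrays σ 4 [ t ≔ s ]) (arrays σ 5 [ t ≔ e ]) (z′ [ s ≔ s ] [ t ≔ t ]))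
                       (sym (zero-arrays 2 ≤-refl)) (sym (zero-arrays 8 (s≤s (s≤s z≤n)))) initial-tree
        ; F≤m      = z≤n
        ; explored = λ () }
      , subst (λ z → Initial (arrays σ 6 [ s ≔ t ]) (arrays σ 7 [ s ≔ e ]) (z [ s ≔ 1 ] [ t ≔ 2 ]))
          (sym (zero-arrays 9 (s≤s (s≤s z≤n)))) initial-numbering)
    , refl , refl , refl)

aim₁ climbStep₁ climbUp₁ aim₂ climbStep₂ climbUp₂ reanchorStep reanchorBody reanchor insertEar earBody addEars : Program
aim₁ = setReg 13 (cell 9 (cell 8 (reg 6))) ⨾ setReg 8 (reg 6) ⨾ setReg 9 (reg 7) ⨾ setReg 10 (reg 5)
climbStep₁ =
  setCell 9 (reg 8) (succ (reg 13)) ⨾ setCell 6 (reg 8) (reg 9) ⨾ setCell 7 (reg 8) (reg 10) ⨾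
  setReg 9 (reg 8) ⨾ setReg 10 (cell 5 (reg 8)) ⨾ setReg 8 (cell 4 (reg 8))
climbUp₁ = whileLess (cell 9 (reg 8)) (lit 1) (shift ⨾ climbStep₁)
aim₂ = setReg 13 (cell 9 (cell 8 (reg 7)) ⊖ lit 1) ⨾ setReg 8 (reg 7) ⨾ setReg 9 (reg 6) ⨾ setReg 10 (reg 5)
-- Arrays 4 and 5 hold tree parents as well as low neighbours. The parent is to become the high
-- neighbour here, so it is copied before it is overwritten.
climbStep₂ =
  setCell 9 (reg 8) (succ (reg 13)) ⨾ succReg 13 ⨾
  setCell 6 (reg 8) (cell 4 (reg 8)) ⨾ setCell 7 (reg 8) (cell 5 (reg 8)) ⨾
  setCell 4 (reg 8) (reg 9) ⨾ setCell 5 (reg 8) (reg 10) ⨾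
  setReg 9 (reg 8) ⨾ setReg 10 (cell 7 (reg 8)) ⨾ setReg 8 (cell 6 (reg 8))
climbUp₂ = whileLess (cell 9 (reg 8)) (lit 1) (shift ⨾ climbStep₂)
reanchorStep = ifLess (cell 9 (cell 3 (reg 11))) (lit 1)
  (setCell 8 (cell 3 (reg 11)) (cell 8 (cell 4 (cell 3 (reg 11)))))
  (setCell 8 (cell 3 (reg 11)) (cell 3 (reg 11)))
reanchorBody = reanchorStep ⨾ succReg 11
reanchor = setReg 11 (lit 0) ⨾ whileLess (reg 11) (reg 12) reanchorBody
insertEar = aim₁ ⨾ climbUp₁ ⨾ aim₂ ⨾ climbUp₂ ⨾ reanchor ⨾ setReg 5 (lit 0)

anchorRank : Expr → Expr
anchorRank x = cell 9 (cell 8 x)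

-- The expression a ∸ (a ∸ b) computes the minimum of a and b.
earBody = orient anchorRank ⨾
  ifLess (anchorRank (reg 6)) (anchorRank (reg 7))
    (ifLess (cell 9 (reg 6) ⊖ (cell 9 (reg 6) ⊖ cell 9 (reg 7))) (lit 1) insertEar (succReg 5))
    (succReg 5)
addEars = setReg 5 (lit 0) ⨾ whileLess (reg 5) (reg 1) earBody

-- Correctness and cost of the ear phase

module Earing (n m : ℕ) (E0 E1 : ℕ → ℕ) (e : ℕ) (e<m : e < m)
  (ends< : ∀ {f} → f < m → E0 f < n × E1 f < n) (loopfree : ∀ {f} → f < m → E0 f ≢ E1 f) where

  open Invariants n m E0 E1 e e<m ends< loopfree
  open Climbing n m E0 E1 e e<m ends< loopfree
  open Settling n m E0 E1 e e<m ends< loopfree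
  open Growing n m E0 E1 e e<m ends< loopfree

  module Phase (K : ℕ) (pos ord : ℕ → ℕ) (order : Order K pos ord) (closed : Closed pos) where
    open Order order
    open Ear K pos ord order
    open Settle K pos ord order

    record Static (r₅ r₆ r₇ r₁₂ f X Y : ℕ) (a₂ a₃ : ℕ → ℕ) : Set where
      constructor static
      field
        f≡ : r₅ ≡ f
        X≡ : r₆ ≡ X
        Y≡ : r₇ ≡ Y
        K≡ : r₁₂ ≡ K
        pos≡ : a₂ ≡ pos
        ord≡ : a₃ ≡ ord

    Fixed : ℕ → ℕ → ℕ → State → Set
    Fixed f X Y σ = Base σ × Static (regs σ 5) (regs σ 6) (regs σ 7) (regs σ 12) f X Y (arrays σ 2) (arrays σ 3)

    unranked : State → ℕ
    unranked σ = zeros K (arrays σ 9 ∘ ord)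

    D : ℕ
    D = 100 + n * 15

    pay-step : ∀ {τ z z′ k} {_ : T (9 + k ≤ᵇ 100)} → z′ < z → τ ≤ 5 + n * 15 → 4 + (τ + k) + z′ * D ≤ z * D
    pay-step {τ} {z} {z′} {k} {ok} z′<z τ≤ = begin
      4 + (τ + k) + z′ * D              ≤⟨ +-monoˡ-≤ (z′ * D) (+-monoʳ-≤ 4 (+-monoˡ-≤ k τ≤)) ⟩
      4 + (5 + n * 15 + k) + z′ * D     ≡⟨ rearrange (n * 15) k (z′ * D) ⟩
      9 + k + (n * 15 + z′ * D)         ≤⟨ +-monoˡ-≤ (n * 15 + z′ * D) (≤ᵇ⇒≤ (9 + k) 100 ok) ⟩
      100 + (n * 15 + z′ * D)           ≡⟨ +-assoc 100 (n * 15) (z′ * D) ⟨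
      D + z′ * D                        ≤⟨ *-monoˡ-≤ D z′<z ⟩
      z * D ∎
      where
      open ≤-Reasoning
      rearrange : ∀ x k y → 4 + (5 + x + k) + y ≡ 9 + k + (x + y)
      rearrange = solve-∀

    off-after : ∀ {rk a : ℕ → ℕ} {w c x} → (∀ v → a v ≡ lift c (rk v)) → ∀ v → w ≢ v → (a [ w ≔ x ]) v ≡ lift c (rk v)
    off-after {a = a} eq v w≢v = trans (≔-other a w≢v) (eq v)

    ranked-out : ∀ {rk} → Ranked rk → ∀ v → n ≤ v → rk v ≡ 0
    ranked-out {rk} ranked v n≤v with rk v in eq
    ... | zero  = refl
    ... | suc _ = contradiction (vertex v (Ranked.reached ranked v (subst (0 <_) (sym eq) (s≤s z≤n)))) (≤⇒≯ n≤v)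

    module _ (att rk₀ : ℕ → ℕ) (f X Y a b : ℕ) where

      Climbing₁ : State → Set
      Climbing₁ σ = Fixed f X Y σ × arrays σ 8 ≡ att ×
        Climb₁ att rk₀ X Y a b (regs σ 8) (regs σ 9) (regs σ 10) (regs σ 13)
          (arrays σ 4) (arrays σ 5) (arrays σ 6) (arrays σ 7) (arrays σ 9)

      climb-body₁ : ∀ σ → Climbing₁ σ → arrays σ 9 (regs σ 8) < 1 →
        Run (shift ⨾ climbStep₁) σ (λ τ σ′ → Climbing₁ σ′ × 4 + τ + unranked σ′ * D ≤ unranked σ * D)
      climb-body₁ σ (fixed , att≡ , climb) out =
        run-seq {Q = λ τ σ′ → Climbing₁ σ′ × 4 + τ + unranked σ′ * D ≤ unranked σ * D}
          (run-shift rk Ctx (λ _ _ ctx → ctx) (λ _ _ ctx → ctx) σ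
            (fixed , att≡ , climb , n<1⇒n≡0 out) (InputAt.n≡ (proj₁ fixed)) refl (λ _ → refl) (ranked-out (Climb₁.ranked climb)))
          λ τ σ′ (((fixed′ , att≡′ , climb′ , out′) , _ , c≡) , shifted , bound) →
            let next , fewer = climb₁ att rk₀ X Y a b climb′ out′
                                 (≔-same (arrays σ′ 9) (regs σ′ 8))
                                 (off-after {rk} {c = regs σ′ 13} (λ v → trans (shifted v) (cong (λ c → lift c (rk v)) (sym c≡))))
            in  run-exec climbStep₁ ((fixed′ , att≡′ , next) , pay-step {k = 18} fewer bound)
        where
        rk = arrays σ 9
        Ctx : State → Set
        Ctx σ′ = Fixed f X Y σ′ × arrays σ′ 8 ≡ att ×
          Climb₁ att rk₀ X Y a b (regs σ′ 8) (regs σ′ 9) (regs σ′ 10) (regs σ′ 13)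
            (arrays σ′ 4) (arrays σ′ 5) (arrays σ′ 6) (arrays σ′ 7) rk × rk (regs σ′ 8) ≡ 0

      run-climb₁ : ∀ σ → Climbing₁ σ → Run climbUp₁ σ (λ τ σ′ → Climbing₁ σ′ × ¬ (arrays σ′ 9 (regs σ′ 8) < 1) ×
        τ + unranked σ′ * D ≤ 4 + unranked σ * D)
      run-climb₁ = run-while Climbing₁ (λ σ → unranked σ * D) climb-body₁

      Climbing₂ : State → Set
      Climbing₂ σ = Fixed f X Y σ × arrays σ 8 ≡ att ×
        Climb₂ att rk₀ X Y a b (regs σ 8) (regs σ 9) (regs σ 10) (regs σ 13)
          (arrays σ 4) (arrays σ 5) (arrays σ 6) (arrays σ 7) (arrays σ 9)

      climb-body₂ : ∀ σ → Climbing₂ σ → arrays σ 9 (regs σ 8) < 1 →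
        Run (shift ⨾ climbStep₂) σ (λ τ σ′ → Climbing₂ σ′ × 4 + τ + unranked σ′ * D ≤ unranked σ * D)
      climb-body₂ σ (fixed , att≡ , climb) out =
        run-seq {Q = λ τ σ′ → Climbing₂ σ′ × 4 + τ + unranked σ′ * D ≤ unranked σ * D}
          (run-shift rk Ctx (λ _ _ ctx → ctx) (λ _ _ ctx → ctx) σ
            (fixed , att≡ , climb , n<1⇒n≡0 out) (InputAt.n≡ (proj₁ fixed)) refl (λ _ → refl) (ranked-out (Climb₂.ranked climb)))
          λ τ σ′ (((fixed′ , att≡′ , climb′ , out′) , _ , c≡) , shifted , bound) →
            let next , fewer = climb₂ att rk₀ X Y a b climb′ out′
                                 (≔-same (arrays σ′ 9) (regs σ′ 8))
                                 (off-after {rk} {c = regs σ′ 13} (λ v → trans (shifted v) (cong (λ c → lift c (rk v)) (sym c≡))))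
            in  run-exec climbStep₂ ((fixed′ , att≡′ , moved σ′ next) , pay-step {k = 29} fewer bound)
        where
        rk = arrays σ 9
        Ctx : State → Set
        Ctx σ′ = Fixed f X Y σ′ × arrays σ′ 8 ≡ att ×
          Climb₂ att rk₀ X Y a b (regs σ′ 8) (regs σ′ 9) (regs σ′ 10) (regs σ′ 13)
            (arrays σ′ 4) (arrays σ′ 5) (arrays σ′ 6) (arrays σ′ 7) rk × rk (regs σ′ 8) ≡ 0
        -- After the updates the program reads the old parent back from the arrays of high neighbours.
        moved : ∀ σ′ → let w = regs σ′ 8 ; hV = arrays σ′ 6 [ w ≔ arrays σ′ 4 w ] ; hE = arrays σ′ 7 [ w ≔ arrays σ′ 5 w ] in
          ∀ {c lowV lowE rk} → Climb₂ att rk₀ X Y a b (arrays σ′ 4 w) w (arrays σ′ 5 w) c lowV lowE hV hE rk →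
          Climb₂ att rk₀ X Y a b (hV w) w (hE w) c lowV lowE hV hE rk
        moved σ′ climb rewrite ≡ᵇ-refl (regs σ′ 8) = climb

      run-climb₂ : ∀ σ → Climbing₂ σ → Run climbUp₂ σ (λ τ σ′ → Climbing₂ σ′ × ¬ (arrays σ′ 9 (regs σ′ 8) < 1) ×
        τ + unranked σ′ * D ≤ 4 + unranked σ * D)
      run-climb₂ = run-while Climbing₂ (λ σ → unranked σ * D) climb-body₂

      turn-machine : ∀ σ → Climbing₁ σ → ¬ (arrays σ 9 (regs σ 8) < 1) → 0 < pos Y → att Y ≡ b → Link f Y X →
        Climbing₂ (exec aim₂ σ)
      turn-machine σ ((base , static refl refl refl K≡ pos≡ ord≡) , refl , climb) halt 0<pos-Y refl link =
        (base , static refl refl refl K≡ pos≡ ord≡) , refl , turn att rk₀ X Y a b climb (≮⇒≥ halt) 0<pos-Y refl link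

    module _ (f X Y : ℕ) (rk : ℕ → ℕ) (ranked : Ranked rk) where

      Reanchoring : State → Set
      Reanchoring σ = Fixed f X Y σ × arrays σ 9 ≡ rk ×
        Wired NoHole NoHole (arrays σ 4) (arrays σ 5) (arrays σ 6) (arrays σ 7) rk ×
        Anchored (arrays σ 4) rk (regs σ 11) (arrays σ 8)

      reanchor-body : ∀ σ → Reanchoring σ → regs σ 11 < regs σ 12 →
        Run reanchorBody σ (λ τ σ′ → Reanchoring σ′ × 3 + τ + (K ∸ regs σ′ 11) * 18 ≤ (K ∸ regs σ 11) * 18)
      reanchor-body σ (fixed@(base , static f≡ X≡ Y≡ refl pos≡ refl) , refl , wired , anch) i<K =
        run-seq {Q = λ τ σ′ → Reanchoring σ′ × 3 + τ + (K ∸ regs σ′ 11) * 18 ≤ (K ∸ regs σ 11) * 18}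
          {R = λ τ σ′ → τ ≤ 12 × regs σ′ 11 ≡ regs σ 11 × Reanchoring (exec (succReg 11) σ′)}
          (run-if
            (λ out → run-exec (setCell 8 (cell 3 (reg 11)) (cell 8 (cell 4 (cell 3 (reg 11)))))
              (≤ᵇ⇒≤ 12 12 _ , refl , fixed , refl , wired ,
               anchor-next ranked wired anch i<K (λ 0<v → contradiction out (≤⇒≯ 0<v)) (λ _ → refl)))
            (λ in′ → run-exec (setCell 8 (cell 3 (reg 11)) (cell 3 (reg 11)))
              (≤ᵇ⇒≤ 10 12 _ , refl , fixed , refl , wired ,
               anchor-next ranked wired anch i<K (λ _ → refl) (λ out → contradiction (subst (_< 1) (sym out) (s≤s z≤n)) in′))))
          λ τ σ′ (τ≤ , same , inv) → run-exec (succReg 11) (inv ,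
            ≤-trans (+-monoˡ-≤ _ (+-monoʳ-≤ 3 (+-monoˡ-≤ 3 τ≤)))
              (subst (λ i′ → 18 + (K ∸ suc i′) * 18 ≤ (K ∸ i) * 18) (sym same) (tick 18 18 i<K)))
        where i = regs σ 11

      run-reanchor : ∀ σ → Fixed f X Y σ → arrays σ 9 ≡ rk →
        Wired NoHole NoHole (arrays σ 4) (arrays σ 5) (arrays σ 6) (arrays σ 7) rk →
        (∀ v → pos v ≡ 0 → arrays σ 8 v ≡ 0) →
        Run reanchor σ (λ τ σ′ → Fixed f X Y σ′ × arrays σ′ 9 ≡ rk ×
          Settled (arrays σ′ 4) (arrays σ′ 5) (arrays σ′ 6) (arrays σ′ 7) (arrays σ′ 8) rk × τ ≤ 5 + K * 18)
      run-reanchor σ fixed rk≡ wired unreached = run-exec-seq (setReg 11 (lit 0)) (run-map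
        (λ τ σ′ ((fixed′ , rk≡′ , wired′ , anch) , halt , bound) → fixed′ , rk≡′ ,
          settle ranked wired′ (subst (λ i → Anchored (arrays σ′ 4) rk i (arrays σ′ 8))
            (≤-antisym (Anchored.i≤K anch) (subst (_≤ regs σ′ 11) (Static.K≡ (proj₂ fixed′)) (≮⇒≥ halt))) anch) ,
          s≤s (s≤s (≤-trans (m≤m+n τ _) bound)))
        (run-while Reanchoring (λ σ′ → (K ∸ regs σ′ 11) * 18) reanchor-body _
          (fixed , rk≡ , wired , record
            { i≤K = z≤n
            ; members = λ v 0<v v≤0 → contradiction 0<v (≤⇒≯ v≤0)
            ; others = λ v 0<v v≤0 → contradiction 0<v (≤⇒≯ v≤0)
            ; unreached = unreached })))

    record NoEars (F : ℕ) (att rk : ℕ → ℕ) : Set where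
      field
        F≤m    : F ≤ m
        no-ear : ∀ g u v → g < F → Link g u v → att u ≡ att v ⊎ (0 < rk u × 0 < rk v)

    Kept : State → Set
    Kept σ = regs σ 12 ≡ K × arrays σ 2 ≡ pos × arrays σ 3 ≡ ord

    EarInv : State → Set
    EarInv σ = Base σ × Kept σ ×
      Settled (arrays σ 4) (arrays σ 5) (arrays σ 6) (arrays σ 7) (arrays σ 8) (arrays σ 9) ×
      NoEars (regs σ 5) (arrays σ 8) (arrays σ 9)

    -- Of the credit E of an unranked vertex, D pays for its own insertion and R
    -- for the new anchors and the restarted scan after an ear.
    R E : ℕ
    R = 200 + (K * 18 + m * 100)
    E = D + R

    earPotential : State → ℕ
    earPotential σ = unranked σ * E + (m ∸ regs σ 5) * 100

    -- `z₀`, `z₁`, `z₂` count the unranked vertices before, between and after the two climbs. The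
    -- climbs live on `D` per insertion, and `z₂ < z₀` frees at least one `R` for the rest.
    ear-pays : ∀ {z₀ z₁ z₂ τ₁ τ₂ τ₃} y → τ₁ + z₁ * D ≤ 4 + z₀ * D → τ₂ + z₂ * D ≤ 4 + z₁ * D → τ₃ ≤ 5 + K * 18 → z₂ < z₀ →
      35 + (10 + (τ₁ + (12 + (τ₂ + (τ₃ + 2))))) + (z₂ * E + m * 100) ≤ z₀ * E + y
    ear-pays {z₀} {z₁} {z₂} {τ₁} {τ₂} {τ₃} y p₁ p₂ p₃ z₂<z₀ = begin
      35 + (10 + (τ₁ + (12 + (τ₂ + (τ₃ + 2))))) + (z₂ * E + m * 100)
        ≡⟨ rearrange₁ τ₁ τ₂ τ₃ z₂ D R (m * 100) ⟩
      59 + τ₃ + (τ₁ + (τ₂ + z₂ * D)) + z₂ * R + m * 100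
        ≤⟨ +-monoˡ-≤ (m * 100) (+-monoˡ-≤ (z₂ * R) (+-mono-≤ (+-monoʳ-≤ 59 p₃) (+-monoʳ-≤ τ₁ p₂))) ⟩
      59 + (5 + K * 18) + (τ₁ + (4 + z₁ * D)) + z₂ * R + m * 100
        ≡⟨ rearrange₂ (K * 18) τ₁ (z₁ * D) (z₂ * R) (m * 100) ⟩
      68 + K * 18 + (τ₁ + z₁ * D) + z₂ * R + m * 100
        ≤⟨ +-monoˡ-≤ (m * 100) (+-monoˡ-≤ (z₂ * R) (+-monoʳ-≤ (68 + K * 18) p₁)) ⟩
      68 + K * 18 + (4 + z₀ * D) + z₂ * R + m * 100
        ≡⟨ rearrange₃ (K * 18) (z₀ * D) (z₂ * R) (m * 100) ⟩
      72 + (K * 18 + m * 100) + (z₂ * R + z₀ * D)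
        ≤⟨ +-monoˡ-≤ (z₂ * R + z₀ * D) (+-monoˡ-≤ (K * 18 + m * 100) (≤ᵇ⇒≤ 72 200 _)) ⟩
      R + (z₂ * R + z₀ * D)
        ≡⟨ +-assoc R (z₂ * R) (z₀ * D) ⟨
      suc z₂ * R + z₀ * D
        ≤⟨ +-monoˡ-≤ (z₀ * D) (*-monoˡ-≤ R z₂<z₀) ⟩
      z₀ * R + z₀ * D
        ≡⟨ +-comm (z₀ * R) (z₀ * D) ⟩
      z₀ * D + z₀ * R
        ≡⟨ *-distribˡ-+ z₀ D R ⟨
      z₀ * E
        ≤⟨ m≤m+n _ y ⟩
      z₀ * E + y ∎
      where
      open ≤-Reasoning
      rearrange₁ : ∀ a b c z D R x →
        35 + (10 + (a + (12 + (b + (c + 2))))) + (z * (D + R) + x) ≡ 59 + c + (a + (b + z * D)) + z * R + x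
      rearrange₁ = solve-∀
      rearrange₂ : ∀ k a z r x → 59 + (5 + k) + (a + (4 + z)) + r + x ≡ 68 + k + (a + z) + r + x
      rearrange₂ = solve-∀
      rearrange₃ : ∀ k z r x → 68 + k + (4 + z) + r + x ≡ 72 + (k + x) + (r + z)
      rearrange₃ = solve-∀

    -- An unranked end guarantees that the ear ranks a new vertex; without this progress the scan
    -- could restart forever. The 35 units are spent on the loop test, the orientation and the two
    -- comparisons leading here.
    run-insert-ear : ∀ y σ → Base σ → Kept σ →
      Settled (arrays σ 4) (arrays σ 5) (arrays σ 6) (arrays σ 7) (arrays σ 8) (arrays σ 9) →
      Link (regs σ 5) (regs σ 6) (regs σ 7) →
      arrays σ 9 (arrays σ 8 (regs σ 6)) < arrays σ 9 (arrays σ 8 (regs σ 7)) →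
      arrays σ 9 (regs σ 6) ≡ 0 ⊎ arrays σ 9 (regs σ 7) ≡ 0 →
      Run insertEar σ (λ τ σ′ → EarInv σ′ × 35 + τ + earPotential σ′ ≤ unranked σ * E + y)
    run-insert-ear y σ base (K≡ , pos≡ , ord≡) settled link less out =
      run-exec-seq aim₁ (run-seq {Q = λ τ → Q (10 + τ)}
        (run-climb₁ att rk f X Y (att X) (att Y) (exec aim₁ σ)
          ((base , static refl refl refl K≡ pos≡ ord≡) , refl , set-out settled closed link less))
      λ τ₁ σ₁ (climbing₁ , halt₁ , paid₁) → run-exec-seq aim₂ (run-seq {Q = λ τ → Q (10 + (τ₁ + (12 + τ)))}
        (run-climb₂ att rk f X Y (att X) (att Y) (exec aim₂ σ₁)
          (turn-machine att rk f X Y (att X) (att Y) σ₁ climbing₁ halt₁ 0<pos-Y refl (link-sym link)))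
      λ τ₂ σ₂ ((fixed₂ , att≡ , climb₂) , halt₂ , paid₂) →
      let inserted = arrive att rk X Y (att X) (att Y) climb₂ (≮⇒≥ halt₂) a≢b in
      run-seq {Q = λ τ → Q (10 + (τ₁ + (12 + (τ₂ + τ))))}
        (run-reanchor f X Y (arrays σ₂ 9) (Inserted.ranked inserted) σ₂ fixed₂ refl (Inserted.wired inserted)
          (λ v new → trans (cong (λ g → g v) att≡) (Settled.unreached settled v new)))
      λ τ₃ σ₃ ((base₃ , static _ _ _ K≡₃ pos≡₃ ord≡₃) , rk≡₃ , settled₃ , paid₃) →
      run-exec (setReg 5 (lit 0))
        ( (base₃ , (K≡₃ , pos≡₃ , ord≡₃)
          , subst (Settled (arrays σ₃ 4) (arrays σ₃ 5) (arrays σ₃ 6) (arrays σ₃ 7) (arrays σ₃ 8)) (sym rk≡₃) settled₃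
          , record { F≤m = z≤n ; no-ear = λ _ _ _ () })
        , subst (λ g → 35 + (10 + (τ₁ + (12 + (τ₂ + (τ₃ + 2))))) + (zeros K (g ∘ ord) * E + m * 100) ≤ unranked σ * E + y)
            (sym rk≡₃) (ear-pays {z₁ = unranked σ₁} {τ₁ = τ₁} y paid₁ paid₂ paid₃ (fewer inserted)))))
      where
      f = regs σ 5
      X = regs σ 6
      Y = regs σ 7
      att = arrays σ 8
      rk = arrays σ 9
      Q : ℕ → State → Set
      Q τ σ′ = EarInv σ′ × 35 + τ + earPotential σ′ ≤ unranked σ * E + y
      0<pos-X : 0 < pos X
      0<pos-X = proj₁ (ear-reached settled closed link less)
      0<pos-Y : 0 < pos Y
      0<pos-Y = proj₂ (ear-reached settled closed link less)
      a≢b : att X ≢ att Y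
      a≢b eq = <⇒≢ less (cong rk eq)
      fewer-at : ∀ {rk′} → (∀ v → 0 < rk v → 0 < rk′ v) → ∀ v → 0 < pos v → rk v ≡ 0 → 0 < rk′ v →
        zeros K (rk′ ∘ ord) < zeros K (rk ∘ ord)
      fewer-at {rk′} grown v 0<v out 0<rk′ with j , j<K , refl ← ord-pos v 0<v =
        zeros-strict K (λ j → grown (ord j)) j<K out 0<rk′
      fewer : ∀ {lowV lowE highV highE rk′} → Inserted att rk X Y (att X) (att Y) lowV lowE highV highE rk′ →
        zeros K (rk′ ∘ ord) < zeros K (rk ∘ ord)
      fewer inserted = Sum.[ (λ out-X → fewer-at grown X 0<pos-X out-X 0<X) , (λ out-Y → fewer-at grown Y 0<pos-Y out-Y 0<Y) ]′ out
        where open Inserted inserted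

    pass-edge : ∀ {F att rk} → NoEars F att rk → F < m →
      (∀ u v → Link F u v → att u ≡ att v ⊎ (0 < rk u × 0 < rk v)) → NoEars (suc F) att rk
    pass-edge {F} {att} {rk} none F<m ok = record { F≤m = F<m ; no-ear = λ g u v g<1+F → cases g u v (m<1+n⇒m<n∨m≡n g<1+F) }
      where
      cases : ∀ g u v → g < F ⊎ g ≡ F → Link g u v → att u ≡ att v ⊎ (0 < rk u × 0 < rk v)
      cases g u v (inj₁ g<F)  = NoEars.no-ear none g u v g<F
      cases g u v (inj₂ refl) = ok u v

    flip-ear : ∀ {f x y u v} {att rk : ℕ → ℕ} → Link f x y → att x ≡ att y ⊎ (0 < rk x × 0 < rk y) →
      Link f u v → att u ≡ att v ⊎ (0 < rk u × 0 < rk v)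
    flip-ear l ok l′ with link-unique l l′
    ... | inj₁ (refl , refl) = ok
    ... | inj₂ (refl , refl) = Sum.map sym Product.swap ok

    min-positive : ∀ {x y} → ¬ (x ∸ (x ∸ y) < 1) → 0 < x × 0 < y
    min-positive {zero}  {y}     big = contradiction (subst (_< 1) (sym (0∸n≡0 (0 ∸ y))) ≤-refl) big
    min-positive {suc x} {zero}  big = contradiction (subst (_< 1) (sym (n∸n≡0 x)) ≤-refl) big
    min-positive {suc x} {suc y} _   = s≤s z≤n , s≤s z≤n

    min-zero : ∀ {x y} → x ∸ (x ∸ y) < 1 → x ≡ 0 ⊎ y ≡ 0
    min-zero {zero}          _ = inj₁ refl
    min-zero {suc x} {zero}  _ = inj₂ refl
    min-zero {suc x} {suc y} small = contradiction small (≤⇒≯ (m<n⇒0<n∸m {x ∸ y} {suc x} (s≤s (m∸n≤m x y))))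

    ear-body : ∀ σ → EarInv σ → regs σ 5 < regs σ 1 →
      Run earBody σ (λ τ σ′ → EarInv σ′ × 3 + τ + earPotential σ′ ≤ earPotential σ)
    ear-body σ (base@(input _ refl _ _ E0≡ E1≡ _) , kept , settled , none) F<m =
      run-orient anchorRank (rk ∘ att) {Q = λ τ σ′ → EarInv σ′ × 3 + τ + earPotential σ′ ≤ earPotential σ}
        σ E0≡ E1≡ F<m (λ _ → refl) λ x y link x≤y →
        run-if
          (λ less → run-if
            (λ small → run-insert-ear ((m ∸ F) * 100) _ base kept settled link less (min-zero small))
            (λ big → run-exec (succReg 5)
              ((base , kept , settled , pass-edge none F<m (λ u v → flip-ear link (inj₂ (min-positive big)))) , passes 35)))
          (λ nless → run-exec (succReg 5)
            ((base , kept , settled , pass-edge none F<m (λ u v → flip-ear link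
              (inj₁ (same-rank⇒same-anchor settled closed link (≤-antisym x≤y (≮⇒≥ nless)))))) , passes 25))
      where
      F = regs σ 5
      att = arrays σ 8
      rk = arrays σ 9
      passes : ∀ k {_ : T (3 + k ≤ᵇ 100)} →
        3 + k + (unranked σ * E + (m ∸ suc F) * 100) ≤ unranked σ * E + (m ∸ F) * 100
      passes k {ok} = ≤-trans (≤-reflexive (rearrange (3 + k) (unranked σ * E) _))
        (+-monoʳ-≤ (unranked σ * E) (tick (3 + k) 100 {ok} F<m))
        where
        rearrange : ∀ k a b → k + (a + b) ≡ a + (k + b)
        rearrange = solve-∀

    run-add-ears : ∀ σ → Base σ → Kept σ →
      Settled (arrays σ 4) (arrays σ 5) (arrays σ 6) (arrays σ 7) (arrays σ 8) (arrays σ 9) →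
      Run addEars σ (λ τ σ′ → EarInv σ′ × ¬ (regs σ′ 5 < regs σ′ 1) × τ ≤ 5 + (unranked σ * E + m * 100))
    run-add-ears σ base kept settled = run-exec-seq (setReg 5 (lit 0)) (run-map
      (λ τ σ′ (inv , halt , bound) → inv , halt , s≤s (s≤s (≤-trans (m≤m+n τ _) bound)))
      (run-while EarInv earPotential ear-body _
        (base , kept , settled , record { F≤m = z≤n ; no-ear = λ _ _ _ () })))

-- Writing out the cycles

advance : ℕ → Program → Program
advance a act = act ⨾ setReg 8 (cell a (reg 8))

-- Among ranked vertices only `s` has rank 1 and only `t` the top rank, so comparing ranks detects
-- the end of either walk.
walkDown walkUp : Program → Program
walkDown act = whileLess (lit 1) (cell 9 (reg 8)) (advance 4 act)
walkUp act = whileLess (cell 9 (reg 8)) (cell 9 (reg 4)) (advance 6 act)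

-- The format puts the length first, so each cycle is walked twice, once to count and once to write.
-- The count starts at 2, for the chord and `e`.
startCount announce emitCycle emitStep emitBody emitAll : Program
startCount = setReg 14 (lit 2) ⨾ setReg 8 (reg 6)
announce = emit (reg 14) ⨾ emit (reg 5) ⨾ emit (reg 2) ⨾ setReg 8 (reg 6)
emitCycle =
  startCount ⨾ walkDown (succReg 14) ⨾ setReg 8 (reg 7) ⨾ walkUp (succReg 14) ⨾
  announce ⨾ walkDown (emit (cell 5 (reg 8))) ⨾ setReg 8 (reg 7) ⨾ walkUp (emit (cell 7 (reg 8)))

-- equal x y is positive exactly when x and y have the same value.
equal : Expr → Expr → Expr
equal x y = (lit 1 ⊖ (x ⊖ y)) ⊖ (y ⊖ x)

emitStep = ifLess (lit 0) (cell 9 (reg 6)) (ifLess (equal (reg 5) (cell 5 (reg 7))) (lit 1) emitCycle skip) skip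
emitBody = orient (cell 9) ⨾ emitStep ⨾ succReg 5
emitAll = setReg 5 (lit 0) ⨾ whileLess (reg 5) (reg 1) emitBody

equal⇒ : ∀ x y → ¬ (1 ∸ (x ∸ y) ∸ (y ∸ x) < 1) → x ≡ y
equal⇒ zero    zero    _   = refl
equal⇒ zero    (suc y) big = contradiction (≤-reflexive (cong suc (0∸n≡0 y))) big
equal⇒ (suc x) zero    big = contradiction (≤-reflexive (cong suc (0∸n≡0 x))) big
equal⇒ (suc x) (suc y) big = cong suc (equal⇒ x y big)

⇒equal : ∀ x → ¬ (1 ∸ (x ∸ x) ∸ (x ∸ x) < 1)
⇒equal x rewrite n∸n≡0 x = λ { (s≤s ()) }

module _ {n m : ℕ} (G : Graph n m) {next : Fin n → Fin n} {nextEdge : Fin n → Fin m} {root : Fin n}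
  (x y : Expr) (a : ℕ) (act : Program) (straight : StraightLine act)
  (Ok : Fin n → Set) (Inv : List (Fin m) → State → Set)
  (halts : ∀ σ → Inv [] σ → regs σ 8 ≡ toℕ root → ⟦ x ⟧ σ ≮ ⟦ y ⟧ σ)
  (goes  : ∀ σ v fs → Inv (nextEdge v ∷ fs) σ → Ok v → v ≢ root → regs σ 8 ≡ toℕ v →
             ⟦ x ⟧ σ < ⟦ y ⟧ σ × Inv fs (exec (advance a act) σ) ×
             regs (exec (advance a act) σ) 8 ≡ toℕ (next v) × Ok (next v))
  where

  -- `Inv` is indexed by the edges still ahead, which makes counting and writing, in both
  -- directions, instances of one lemma.
  run-walk : ∀ {v fs} → Chase G next nextEdge root v fs → ∀ σ → regs σ 8 ≡ toℕ v → Ok v → Inv fs σ →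
    Run (whileLess x y (advance a act)) σ
      (λ τ σ′ → Inv [] σ′ × τ ≤ guard x y + length fs * (guard x y + (duration act + 3)))
  run-walk stop σ at ok inv = _ , σ , exit⇓ (halts σ inv at) , inv , m≤m+n _ _
  run-walk (step {v} {fs} v≢root chase) σ at ok inv
    with less , inv′ , at′ , ok′ ← goes σ v fs inv ok v≢root at
    with τ , σ′ , steps , inv″ , bound ← run-walk chase _ at′ ok′ inv′ =
    _ , σ′ , loop⇓ less (⨾⇓ (exec-steps act σ straight) setReg⇓) steps , inv″ , (begin
      g + (d + 3) + τ            ≤⟨ +-monoʳ-≤ (g + (d + 3)) bound ⟩
      g + (d + 3) + (g + length fs * (g + (d + 3))) ≡⟨ rearrange (g + (d + 3)) g _ ⟩
      g + (g + (d + 3) + length fs * (g + (d + 3))) ∎)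
    where
    open ≤-Reasoning
    g = guard x y
    d = duration act
    rearrange : ∀ a b c → a + (b + c) ≡ b + (a + c)
    rearrange = solve-∀

-- Correctness and cost of the output

module Emitting {n m : ℕ} (G : Graph n m) {e : Fin m} (numbering : Numbering G e) where
  open Numbering numbering
  open Paths G
  open Chords G numbering
  open Chord

  -- A `Chord` carries proofs, so chords are identified by their edges alone.
  record Listed (F : ℕ) (out : List ℕ) : Set where
    field
      F≤m      : F ≤ m
      chords   : List Chord
      distinct : Unique (map edge chords)
      earlier  : ∀ {f} → f ∈ˡ map edge chords → toℕ f < F
      complete : ∀ c → toℕ (edge c) < F → edge c ∈ˡ map edge chords
      written  : out ≡ encode (map edgeListOf chords)

  module Emission (A : ℕ → ℕ → ℕ)
    (rank-bound : rank t ≤ 2 + n)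
    (A₀ : ∀ f → A 0 (toℕ f) ≡ toℕ (end₁ G f)) (A₁ : ∀ f → A 1 (toℕ f) ≡ toℕ (end₂ G f))
    (A₉ : ∀ v → A 9 (toℕ v) ≡ rank v)
    (A₄ : ∀ v → 0 < rank v → v ≢ s → A 4 (toℕ v) ≡ toℕ (low v))
    (A₅ : ∀ v → 0 < rank v → v ≢ s → A 5 (toℕ v) ≡ toℕ (lowEdge v))
    (A₆ : ∀ v → 0 < rank v → v ≢ t → A 6 (toℕ v) ≡ toℕ (high v))
    (A₇ : ∀ v → 0 < rank v → v ≢ t → A 7 (toℕ v) ≡ toℕ (highEdge v))
    where

    record Registers (r₁ r₂ r₄ : ℕ) (a : ℕ → ℕ → ℕ) : Set where
      constructor registers
      field
        m≡ : r₁ ≡ m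
        e≡ : r₂ ≡ toℕ e
        t≡ : r₄ ≡ toℕ t
        A≡ : a ≡ A

    Env : State → Set
    Env σ = Registers (regs σ 1) (regs σ 2) (regs σ 4) (arrays σ)

    rank-s<rank : ∀ {v} → 0 < rank v → v ≢ s → 1 < rank v
    rank-s<rank {v} 0<v v≢s = ≤∧≢⇒< 0<v λ 1≡ → v≢s (rank-injective 0<v (trans (sym 1≡) (sym rank-s)))

    rank<rank-t : ∀ {v} → 0 < rank v → v ≢ t → rank v < rank t
    rank<rank-t {v} 0<v v≢t = ≤∧≢⇒< (rank≤rank-t v) λ eq → v≢t (rank-injective 0<v eq)

    down-goes : ∀ σ {v} → Env σ → 0 < rank v → v ≢ s → regs σ 8 ≡ toℕ v →
      1 < arrays σ 9 (regs σ 8) × arrays σ 4 (regs σ 8) ≡ toℕ (low v) × arrays σ 5 (regs σ 8) ≡ toℕ (lowEdge v)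
    down-goes σ {v} (registers _ _ _ A≡) 0<v v≢s at rewrite A≡ | at =
      subst (1 <_) (sym (A₉ v)) (rank-s<rank 0<v v≢s) , A₄ v 0<v v≢s , A₅ v 0<v v≢s

    down-halts : ∀ σ → Env σ → regs σ 8 ≡ toℕ s → ¬ (1 < arrays σ 9 (regs σ 8))
    down-halts σ (registers _ _ _ A≡) at rewrite A≡ | at | A₉ s | rank-s = λ { (s≤s ()) }

    up-goes : ∀ σ {v} → Env σ → 0 < rank v → v ≢ t → regs σ 8 ≡ toℕ v →
      arrays σ 9 (regs σ 8) < arrays σ 9 (regs σ 4) × arrays σ 6 (regs σ 8) ≡ toℕ (high v) × arrays σ 7 (regs σ 8) ≡ toℕ (highEdge v)
    up-goes σ {v} (registers _ _ t≡ A≡) 0<v v≢t at rewrite A≡ | at | t≡ =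
      subst₂ _<_ (sym (A₉ v)) (sym (A₉ t)) (rank<rank-t 0<v v≢t) , A₆ v 0<v v≢t , A₇ v 0<v v≢t

    up-halts : ∀ σ → Env σ → regs σ 8 ≡ toℕ t → ¬ (arrays σ 9 (regs σ 8) < arrays σ 9 (regs σ 4))
    up-halts σ (registers _ _ t≡ A≡) at rewrite A≡ | at | t≡ = n≮n _

    record Edge (r₅ r₆ r₇ f x y : ℕ) : Set where
      constructor edge-at
      field
        f≡ : r₅ ≡ f
        x≡ : r₆ ≡ x
        y≡ : r₇ ≡ y

    module _ (f x y : ℕ) where

      Scene : State → Set
      Scene σ = Env σ × Edge (regs σ 5) (regs σ 6) (regs σ 7) f x y

      Counting : List ℕ → ℕ → List (Fin m) → State → Set
      Counting out total fs σ = Scene σ × output σ ≡ out × regs σ 14 + length fs ≡ total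

      Writing : List ℕ → List (Fin m) → State → Set
      Writing out fs σ = Scene σ × output σ ++ map toℕ fs ≡ out

      private
        counted : ∀ {c k total} → c + suc k ≡ total → suc c + k ≡ total
        counted {c} {k} eq = trans (sym (+-suc c k)) eq

        written : ∀ {out : List ℕ} {x y : ℕ} {xs zs} → out ++ x ∷ xs ≡ zs → y ≡ x → (out ++ y ∷ []) ++ xs ≡ zs
        written {out} {x} {xs = xs} eq refl = trans (++-assoc out (x ∷ []) xs) eq

      count-down : ∀ {out total v fs} → Chase G low lowEdge s v fs → ∀ σ → regs σ 8 ≡ toℕ v → 0 < rank v →
        Counting out total fs σ → Run (walkDown (succReg 14)) σ (λ τ σ′ → Counting out total [] σ′ × τ ≤ 4 + length fs * 10)
      count-down {out} {total} = run-walk G (lit 1) (cell 9 (reg 8)) 4 (succReg 14) _ Member (Counting out total)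
        (λ σ inv at → down-halts σ (proj₁ (proj₁ inv)) at)
        λ σ v fs ((env , at-edge) , out≡ , count) 0<v v≢s at →
          let less , next≡ , _ = down-goes σ env 0<v v≢s at
          in  less , ((env , at-edge) , out≡ , counted count) , next≡ , proj₁ (proj₂ (low-joins v 0<v v≢s))

      count-up : ∀ {out total v fs} → Chase G high highEdge t v fs → ∀ σ → regs σ 8 ≡ toℕ v → 0 < rank v →
        Counting out total fs σ → Run (walkUp (succReg 14)) σ (λ τ σ′ → Counting out total [] σ′ × τ ≤ 5 + length fs * 11)
      count-up {out} {total} = run-walk G (cell 9 (reg 8)) (cell 9 (reg 4)) 6 (succReg 14) _ Member (Counting out total)
        (λ σ inv at → up-halts σ (proj₁ (proj₁ inv)) at)
        λ σ v fs ((env , at-edge) , out≡ , count) 0<v v≢t at →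
          let less , next≡ , _ = up-goes σ env 0<v v≢t at
          in  less , ((env , at-edge) , out≡ , counted count) , next≡ , proj₁ (proj₂ (high-joins v 0<v v≢t))

      write-down : ∀ {out v fs} → Chase G low lowEdge s v fs → ∀ σ → regs σ 8 ≡ toℕ v → 0 < rank v →
        Writing out fs σ → Run (walkDown (emit (cell 5 (reg 8)))) σ (λ τ σ′ → Writing out [] σ′ × τ ≤ 4 + length fs * 10)
      write-down {out} = run-walk G (lit 1) (cell 9 (reg 8)) 4 (emit (cell 5 (reg 8))) _ Member (Writing out)
        (λ σ inv at → down-halts σ (proj₁ (proj₁ inv)) at)
        λ σ v fs ((env , at-edge) , out≡) 0<v v≢s at →
          let less , next≡ , edge≡ = down-goes σ env 0<v v≢s at
          in  less , ((env , at-edge) , written {output σ} out≡ edge≡) , next≡ , proj₁ (proj₂ (low-joins v 0<v v≢s))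

      write-up : ∀ {out v fs} → Chase G high highEdge t v fs → ∀ σ → regs σ 8 ≡ toℕ v → 0 < rank v →
        Writing out fs σ → Run (walkUp (emit (cell 7 (reg 8)))) σ (λ τ σ′ → Writing out [] σ′ × τ ≤ 5 + length fs * 11)
      write-up {out} = run-walk G (cell 9 (reg 8)) (cell 9 (reg 4)) 6 (emit (cell 7 (reg 8))) _ Member (Writing out)
        (λ σ inv at → up-halts σ (proj₁ (proj₁ inv)) at)
        λ σ v fs ((env , at-edge) , out≡) 0<v v≢t at →
          let less , next≡ , edge≡ = up-goes σ env 0<v v≢t at
          in  less , ((env , at-edge) , written {output σ} out≡ edge≡) , next≡ , proj₁ (proj₂ (high-joins v 0<v v≢t))

    run-emit-cycle : ∀ (c : Chord) σ → Scene (toℕ (edge c)) (toℕ (lower c)) (toℕ (upper c)) σ →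
      Run emitCycle σ (λ τ σ′ → Scene (toℕ (edge c)) (toℕ (lower c)) (toℕ (upper c)) σ′ ×
        output σ′ ≡ output σ ++ length (edgeListOf c) ∷ map toℕ (edgeListOf c) × τ ≤ 124 + n * 44)
    run-emit-cycle c σ (env , at-edge@(edge-at _ x≡ _)) =
      run-exec-seq startCount (run-seq {Q = λ τ → Q (4 + τ)}
        (count-down f x y {out = output σ} {total = 2 + length downs} (Down.Descent.chase (down c)) (exec startCount σ) x≡ (0<lower c)
          ((env , at-edge) , refl , refl))
      λ τ₁ σ₁ ((scene₁ , out₁ , count₁) , paid₁) → run-exec-seq (setReg 8 (reg 7)) (run-seq {Q = λ τ → Q (4 + (τ₁ + (2 + τ)))}
        (count-up f x y {out = output σ} {total = 2 + length downs + length ups} (Up.Descent.chase (up c)) (exec (setReg 8 (reg 7)) σ₁)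
          (Edge.y≡ (proj₂ scene₁)) (0<upper c)
          (scene₁ , out₁ , cong (_+ length ups) (trans (sym (+-identityʳ _)) count₁)))
      λ τ₂ σ₂ ((scene₂ , out₂ , count₂) , paid₂) → run-exec-seq announce (run-seq {Q = λ τ → Q (4 + (τ₁ + (2 + (τ₂ + (8 + τ)))))}
        (write-down f x y {out = pre ++ map toℕ downs} (Down.Descent.chase (down c)) (exec announce σ₂)
          (Edge.x≡ (proj₂ scene₂)) (0<lower c) (scene₂ , cong (_++ map toℕ downs) (announced σ₂ scene₂ out₂ count₂)))
      λ τ₃ σ₃ ((scene₃ , out₃) , paid₃) → run-exec-seq (setReg 8 (reg 7)) (run-map
        (λ τ₄ σ₄ ((scene₄ , out₄) , paid₄) → scene₄ ,
          trans (sym (++-identityʳ (output σ₄))) (trans out₄ assembled) ,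
          total-time paid₁ paid₂ paid₃ paid₄)
        (write-up f x y {out = pre ++ map toℕ downs ++ map toℕ ups} (Up.Descent.chase (up c)) (exec (setReg 8 (reg 7)) σ₃)
          (Edge.y≡ (proj₂ scene₃)) (0<upper c)
          (scene₃ , trans (cong (_++ map toℕ ups) (trans (sym (++-identityʳ (output σ₃))) out₃)) (++-assoc pre _ _)))))))
      where
      f = toℕ (edge c)
      x = toℕ (lower c)
      y = toℕ (upper c)
      downs = Down.Descent.fs (down c)
      ups = Up.Descent.fs (up c)
      L = edgeListOf c
      pre : List ℕ
      pre = output σ ++ length L ∷ f ∷ toℕ e ∷ []
      Q : ℕ → State → Set
      Q τ σ′ = Scene f x y σ′ × output σ′ ≡ output σ ++ length L ∷ map toℕ L × τ ≤ 124 + n * 44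
      announced : ∀ σ₂ → Scene f x y σ₂ → output σ₂ ≡ output σ → regs σ₂ 14 + 0 ≡ 2 + length downs + length ups →
        ((output σ₂ ++ regs σ₂ 14 ∷ []) ++ regs σ₂ 5 ∷ []) ++ regs σ₂ 2 ∷ [] ≡ pre
      announced σ₂ (registers _ e≡ _ _ , edge-at f≡ _ _) out≡ count≡
        rewrite e≡ | f≡ | out≡ | trans (sym (+-identityʳ (regs σ₂ 14))) (trans count≡ (cong (2 +_) (sym (length-++ downs {ups})))) =
        trans (++-assoc (output σ ++ length L ∷ []) (f ∷ []) (toℕ e ∷ [])) (++-assoc (output σ) (length L ∷ []) (f ∷ toℕ e ∷ []))
      assembled : pre ++ map toℕ downs ++ map toℕ ups ≡ output σ ++ length L ∷ map toℕ L
      assembled = trans (++-assoc (output σ) (length L ∷ f ∷ toℕ e ∷ []) _)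
        (cong (λ zs → output σ ++ length L ∷ f ∷ toℕ e ∷ zs) (sym (map-++ toℕ downs ups)))
      downs≤ : length downs ≤ 2 + n
      downs≤ = ≤-trans (Down.Descent.short (down c)) (≤-trans (rank≤rank-t _) rank-bound)
      ups≤ : length ups ≤ 2 + n
      ups≤ = ≤-trans (Up.Descent.short (up c)) (≤-trans (m∸n≤m (rank t) (rank (upper c))) rank-bound)
      walk≤ : ∀ {τ k ℓ c} → ℓ ≤ 2 + n → k ≤ 5 → c ≤ 11 → τ ≤ k + ℓ * c → τ ≤ 27 + n * 11
      walk≤ ℓ≤ k≤ c≤ bound = ≤-trans bound (+-mono-≤ k≤ (*-mono-≤ ℓ≤ c≤))
      total-time : ∀ {τ₁ τ₂ τ₃ τ₄} → τ₁ ≤ 4 + length downs * 10 → τ₂ ≤ 5 + length ups * 11 →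
        τ₃ ≤ 4 + length downs * 10 → τ₄ ≤ 5 + length ups * 11 →
        4 + (τ₁ + (2 + (τ₂ + (8 + (τ₃ + (2 + τ₄)))))) ≤ 124 + n * 44
      total-time {τ₁} {τ₂} {τ₃} {τ₄} p₁ p₂ p₃ p₄ = ≤-trans
        (+-monoʳ-≤ 4 (+-mono-≤ (walk≤ downs≤ 4≤5 10≤11 p₁) (+-monoʳ-≤ 2 (+-mono-≤ (walk≤ ups≤ ≤-refl ≤-refl p₂)
          (+-monoʳ-≤ 8 (+-mono-≤ (walk≤ downs≤ 4≤5 10≤11 p₃) (+-monoʳ-≤ 2 (walk≤ ups≤ ≤-refl ≤-refl p₄))))))))
        (≤-reflexive (collect n))
        where
        4≤5 : 4 ≤ 5
        4≤5 = n≤1+n 4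
        10≤11 : 10 ≤ 11
        10≤11 = n≤1+n 10
        collect : ∀ n → let w = 27 + n * 11 in 4 + (w + (2 + (w + (8 + (w + (2 + w)))))) ≡ 124 + n * 44
        collect = solve-∀

    EmitInv : State → Set
    EmitInv σ = Env σ × Listed (regs σ 5) (output σ)

    list-none : ∀ {F out} → Listed F out → F < m → (∀ c → toℕ (edge c) ≢ F) → Listed (suc F) out
    list-none {F} listed F<m none = record
      { F≤m = F<m ; chords = chords ; distinct = distinct
      ; earlier = m≤n⇒m≤1+n ∘ earlier
      ; complete = λ c c<1+F → Sum.[ complete c , (λ c≡F → contradiction c≡F (none c)) ]′ (m<1+n⇒m<n∨m≡n c<1+F)
      ; written = written }
      where open Listed listed

    list-chord : ∀ {F out} (c : Chord) → toℕ (edge c) ≡ F → Listed F out → F < m →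
      Listed (suc F) (out ++ length (edgeListOf c) ∷ map toℕ (edgeListOf c))
    list-chord {F} {out} c c≡F listed F<m = record
      { F≤m = F<m ; chords = chords ++ c ∷ []
      ; distinct = subst Unique (sym snoc) (++⁺ distinct ([] ∷ []) λ where
          (f∈ , here refl) → <⇒≢ (earlier f∈) c≡F)
      ; earlier = λ f∈ → Sum.[ m≤n⇒m≤1+n ∘ earlier , (λ where (here refl) → s≤s (≤-reflexive c≡F)) ]′
          (∈-++⁻ (map edge chords) (subst (_ ∈ˡ_) snoc f∈))
      ; complete = λ d d<1+F → subst (edge d ∈ˡ_) (sym snoc) (Sum.[ ∈-++⁺ˡ ∘ complete d ,
          (λ d≡F → ∈-++⁺ʳ (map edge chords) (here (Fin.toℕ-injective (trans d≡F (sym c≡F))))) ]′ (m<1+n⇒m<n∨m≡n d<1+F))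
      ; written = begin
          out ++ block                                       ≡⟨ cong (_++ block) written ⟩
          encode (map edgeListOf chords) ++ block            ≡⟨ cong (encode (map edgeListOf chords) ++_) (++-identityʳ block) ⟨
          encode (map edgeListOf chords) ++ encode (edgeListOf c ∷ [])
            ≡⟨ concatMap-++ (λ fs → length fs ∷ map toℕ fs) (map edgeListOf chords) (edgeListOf c ∷ []) ⟨
          encode (map edgeListOf chords ++ edgeListOf c ∷ []) ≡⟨ cong encode (map-++ edgeListOf chords (c ∷ [])) ⟨
          encode (map edgeListOf (chords ++ c ∷ [])) ∎ }
      where
      open Listed listed
      open ≡-Reasoning
      block = length (edgeListOf c) ∷ map toℕ (edgeListOf c)
      snoc : map edge (chords ++ c ∷ []) ≡ map edge chords ++ edge c ∷ []
      snoc = map-++ edge chords (c ∷ [])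

    -- With the ends ordered, two tests decide: a ranked `u` makes both ends ranked, and then `f`
    -- fails to be a chord only as the low edge of `v`.
    run-emit-step : ∀ {F} (f : Fin m) {u v : Fin n} σ → toℕ f ≡ F → F < m → Joins f u v → rank u ≤ rank v → Env σ →
      Edge (regs σ 5) (regs σ 6) (regs σ 7) (toℕ f) (toℕ u) (toℕ v) → Listed F (output σ) →
      Run emitStep σ (λ τ σ′ → Env σ′ × regs σ′ 5 ≡ F × Listed (suc F) (output σ′) × τ ≤ 141 + n * 44)
    run-emit-step {F} f {u} {v} σ f≡F F<m j u≤v env at-edge@(edge-at r₅≡ r₆≡ r₇≡) listed = run-if
      (λ member → let 0<u = subst (0 <_) rank-u member in run-if
        (λ small → let c = chord 0<u (λ eq → unequal 0<u eq small) in
          run-map (λ τ σ′ ((env′ , edge-at f≡ _ _) , out≡ , bound) → env′ , trans f≡ f≡F ,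
                     subst (Listed (suc F)) (sym out≡) (list-chord c f≡F listed F<m) ,
                     +-monoʳ-≤ 4 (+-monoʳ-≤ 13 bound))
            (run-emit-cycle c σ (env , at-edge)))
        (λ big → run-exec skip (env , trans r₅≡ f≡F ,
           list-none listed F<m (λ c c≡F → low-edge 0<u big {c} (Fin.toℕ-injective (trans c≡F (sym f≡F)))) ,
           +-mono-≤ {18} {141} (≤ᵇ⇒≤ 18 141 _) z≤n)))
      (λ out → run-exec skip (env , trans r₅≡ f≡F ,
         list-none listed F<m (λ c c≡F → not-chord out {c} (Fin.toℕ-injective (trans c≡F (sym f≡F)))) ,
         +-mono-≤ {5} {141} (≤ᵇ⇒≤ 5 141 _) z≤n))
      where
      rank-u : arrays σ 9 (regs σ 6) ≡ rank u
      rank-u = trans (cong₂ (λ a r → a 9 r) (Registers.A≡ env) r₆≡) (A₉ u)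
      chord : 0 < rank u → f ≢ lowEdge v → Chord
      chord 0<u f≢ = record
        { edge = f ; lower = u ; upper = v ; joins = j ; 0<lower = 0<u
        ; lower<upper = ≤∧≢⇒< u≤v (λ eq → joins-≢ j (rank-injective 0<u eq)) ; not-low = f≢ }
      0<v′ : 0 < rank u → 0 < rank v
      0<v′ 0<u = ≤-trans 0<u u≤v
      v≢s : 0 < rank u → v ≢ s
      v≢s 0<u refl = joins-≢ j (rank-injective 0<u (≤-antisym u≤v (≤-trans (≤-reflexive rank-s) 0<u)))
      low≡ : 0 < rank u → arrays σ 5 (regs σ 7) ≡ toℕ (lowEdge v)
      low≡ 0<u = trans (cong₂ (λ a r → a 5 r) (Registers.A≡ env) r₇≡) (A₅ v (0<v′ 0<u) (v≢s 0<u))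
      unequal : 0 < rank u → f ≡ lowEdge v → ¬ (⟦ equal (reg 5) (cell 5 (reg 7)) ⟧ σ < 1)
      unequal 0<u eq rewrite r₅≡ | low≡ 0<u | eq = ⇒equal (toℕ (lowEdge v))
      not-chord : ¬ (0 < arrays σ 9 (regs σ 6)) → ∀ {c} → edge c ≢ f
      not-chord out {c} refl with joins-end j (joins-meetsˡ (joins c)) | joins-end j (joins-meetsʳ (joins c))
      ... | inj₁ refl | _         = out (subst (0 <_) (sym rank-u) (0<lower c))
      ... | inj₂ refl | inj₁ refl = out (subst (0 <_) (sym rank-u) (0<upper c))
      ... | inj₂ refl | inj₂ eq   = joins-≢ (joins c) (sym eq)
      low-edge : 0 < rank u → ¬ (⟦ equal (reg 5) (cell 5 (reg 7)) ⟧ σ < 1) → ∀ {c} → edge c ≢ f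
      low-edge 0<u big {c} refl with joins-end j (joins-meetsˡ (joins c)) | joins-end j (joins-meetsʳ (joins c))
      ... | inj₁ refl | inj₂ refl = not-low c (Fin.toℕ-injective
            (trans (sym r₅≡) (trans (equal⇒ _ _ big) (low≡ 0<u))))
      ... | inj₁ refl | inj₁ eq   = joins-≢ (joins c) (sym eq)
      ... | inj₂ refl | inj₂ eq   = joins-≢ (joins c) (sym eq)
      ... | inj₂ refl | inj₁ refl = contradiction (lower<upper c) (≤⇒≯ u≤v)

    run-emit-body : ∀ σ → EmitInv σ → regs σ 5 < regs σ 1 →
      Run emitBody σ (λ τ σ′ → EmitInv σ′ × 3 + τ + (m ∸ regs σ′ 5) * (160 + n * 44) ≤ (m ∸ regs σ 5) * (160 + n * 44))
    run-emit-body σ (env@(registers refl _ _ A≡) , listed) F<m = run-seq {Q = Q} {R = R} oriented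
      λ τ σ₁ (τ≡ , joined) → run-seq {Q = λ τ′ → Q (τ + τ′)} joined λ τ₁ σ₂ (env₂ , F≡ , listed₂ , paid) →
        run-exec (succReg 5) ((env₂ , subst (λ F → Listed (suc F) (output σ₂)) (sym F≡) listed₂) ,
          subst (λ F′ → 3 + (τ + (τ₁ + 3)) + (m ∸ suc F′) * (160 + n * 44) ≤ (m ∸ F) * (160 + n * 44)) (sym F≡)
            (tick≤ F<m (time τ≡ paid)))
      where
      F = regs σ 5
      f = fromℕ< F<m
      Q : ℕ → State → Set
      Q τ σ′ = EmitInv σ′ × 3 + τ + (m ∸ regs σ′ 5) * (160 + n * 44) ≤ (m ∸ F) * (160 + n * 44)
      S : ℕ → State → Set
      S τ σ′ = Env σ′ × regs σ′ 5 ≡ F × Listed (suc F) (output σ′) × τ ≤ 141 + n * 44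
      R : ℕ → State → Set
      R τ σ₁ = τ ≡ 13 × Run emitStep σ₁ S
      f≡F : toℕ f ≡ F
      f≡F = Fin.toℕ-fromℕ< F<m
      end₁≡ : arrays σ 0 F ≡ toℕ (end₁ G f)
      end₁≡ = trans (cong₂ (λ a i → a 0 i) A≡ (sym f≡F)) (A₀ f)
      end₂≡ : arrays σ 1 F ≡ toℕ (end₂ G f)
      end₂≡ = trans (cong₂ (λ a i → a 1 i) A≡ (sym f≡F)) (A₁ f)
      key₁ : arrays σ 9 (arrays σ 0 F) ≡ rank (end₁ G f)
      key₁ = trans (cong₂ (λ a i → a 9 i) A≡ end₁≡) (A₉ _)
      key₂ : arrays σ 9 (arrays σ 1 F) ≡ rank (end₂ G f)
      key₂ = trans (cong₂ (λ a i → a 9 i) A≡ end₂≡) (A₉ _)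
      oriented : Run (orient (cell 9)) σ R
      oriented = run-if
        (λ less → run-exec (setReg 6 (cell 0 (reg 5)) ⨾ setReg 7 (cell 1 (reg 5))) (refl ,
          run-emit-step f _ f≡F F<m (joins-ends f) (<⇒≤ (subst₂ _<_ key₁ key₂ less)) env (edge-at (sym f≡F) end₁≡ end₂≡) listed))
        (λ nless → run-exec (setReg 6 (cell 1 (reg 5)) ⨾ setReg 7 (cell 0 (reg 5))) (refl ,
          run-emit-step f _ f≡F F<m (joins-sym (joins-ends f)) (subst₂ _≤_ key₂ key₁ (≮⇒≥ nless)) env (edge-at (sym f≡F) end₂≡ end₁≡) listed))
      time : ∀ {τ τ₁} → τ ≡ 13 → τ₁ ≤ 141 + n * 44 → 3 + (τ + (τ₁ + 3)) ≤ 160 + n * 44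
      time {τ₁ = τ₁} refl paid = begin
        16 + (τ₁ + 3) ≡⟨ cong (16 +_) (+-comm τ₁ 3) ⟩
        19 + τ₁       ≤⟨ +-monoʳ-≤ 19 paid ⟩
        160 + n * 44  ∎
        where open ≤-Reasoning

    run-emit-all : ∀ σ → Env σ → output σ ≡ [] →
      Run emitAll σ (λ τ σ′ → Listed m (output σ′) × τ ≤ 5 + m * (160 + n * 44))
    run-emit-all σ env out≡ = run-exec-seq (setReg 5 (lit 0)) (run-map
      (λ τ σ′ ((env′ , listed) , halt , bound) →
        subst (λ F → Listed F (output σ′)) (≤-antisym (Listed.F≤m listed)
          (subst (_≤ regs σ′ 5) (Registers.m≡ env′) (≮⇒≥ halt))) listed ,
        s≤s (s≤s (≤-trans (m≤m+n τ _) bound)))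
      (run-while EmitInv (λ σ → (m ∸ regs σ 5) * (160 + n * 44)) run-emit-body _
        (env , record { F≤m = z≤n ; chords = [] ; distinct = [] ; earlier = λ () ; complete = λ _ () ; written = out≡ })))

-- The algorithm on a graph

zeroPadded-< : ∀ {m i} (g : Fin m → ℕ) (i<m : i < m) → zeroPadded g i ≡ g (fromℕ< i<m)
zeroPadded-< {m} {i} g i<m with i <? m
... | yes i<m′ = cong (g ∘ λ p → fromℕ< p) (<-irrelevant i<m′ i<m)
... | no i≮m   = contradiction i<m i≮m

zeroPadded-toℕ : ∀ {m} (g : Fin m → ℕ) f → zeroPadded g (toℕ f) ≡ g f
zeroPadded-toℕ g f = trans (zeroPadded-< g (Fin.toℕ<n f)) (cong g (Fin.fromℕ<-toℕ f (Fin.toℕ<n f)))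

-- Array entries need not be valid names; the default is taken only where the numbering promises
-- nothing.
clamp : ∀ {k} → Fin k → ℕ → Fin k
clamp {k} default i with i <? k
... | yes i<k = fromℕ< i<k
... | no _    = default

toℕ-clamp : ∀ {k} (default : Fin k) {i} → i < k → toℕ (clamp default i) ≡ i
toℕ-clamp {k} default {i} i<k with i <? k
... | yes i<k′ = Fin.toℕ-fromℕ< i<k′
... | no i≮k   = contradiction i<k i≮k

solver : Program
solver = initialise ⨾ grow ⨾ addEars ⨾ emitAll

module Solve {n m : ℕ} (G : Graph n m) (e : Fin m) where
  open Paths G

  E0 E1 : ℕ → ℕ
  E0 = zeroPadded (toℕ ∘ end₁ G)
  E1 = zeroPadded (toℕ ∘ end₂ G)

  ends< : ∀ {f} → f < m → E0 f < n × E1 f < n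
  ends< f<m = subst (_< n) (sym (zeroPadded-< (toℕ ∘ end₁ G) f<m)) (Fin.toℕ<n _)
            , subst (_< n) (sym (zeroPadded-< (toℕ ∘ end₂ G) f<m)) (Fin.toℕ<n _)

  loopfree : ∀ {f} → f < m → E0 f ≢ E1 f
  loopfree f<m eq = loopless G (fromℕ< f<m) (Fin.toℕ-injective
    (trans (sym (zeroPadded-< (toℕ ∘ end₁ G) f<m)) (trans eq (zeroPadded-< (toℕ ∘ end₂ G) f<m))))

  open Invariants n m E0 E1 (toℕ e) (Fin.toℕ<n e) ends< loopfree
  open Climbing n m E0 E1 (toℕ e) (Fin.toℕ<n e) ends< loopfree
  open Settling n m E0 E1 (toℕ e) (Fin.toℕ<n e) ends< loopfree
  open Growing n m E0 E1 (toℕ e) (Fin.toℕ<n e) ends< loopfree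
  open Earing n m E0 E1 (toℕ e) (Fin.toℕ<n e) ends< loopfree

  E0-toℕ : ∀ f → E0 (toℕ f) ≡ toℕ (end₁ G f)
  E0-toℕ = zeroPadded-toℕ (toℕ ∘ end₁ G)

  E1-toℕ : ∀ f → E1 (toℕ f) ≡ toℕ (end₂ G f)
  E1-toℕ = zeroPadded-toℕ (toℕ ∘ end₂ G)

  link⇒joins : ∀ {f u v} → Link (toℕ f) (toℕ u) (toℕ v) → Joins f u v
  link⇒joins {f} (_ , inj₁ (p , q)) = inj₁
    (Fin.toℕ-injective (trans (sym (E0-toℕ f)) p) , Fin.toℕ-injective (trans (sym (E1-toℕ f)) q))
  link⇒joins {f} (_ , inj₂ (p , q)) = inj₂
    (Fin.toℕ-injective (trans (sym (E0-toℕ f)) p) , Fin.toℕ-injective (trans (sym (E1-toℕ f)) q))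

  module Number (K : ℕ) (pos ord : ℕ → ℕ) (order : Order K pos ord) where
    open Settle K pos ord order
    open Ear K pos ord order

    module _ {lowV lowE highV highE att rk : ℕ → ℕ} (settled : Settled lowV lowE highV highE att rk) where
      open Settled settled
      open Ranked ranked
      open Wired wired

      private
        toℕ-≢ : ∀ {v u : Fin n} {i} → i ≡ toℕ u → v ≢ u → toℕ v ≢ i
        toℕ-≢ eq v≢u v≡i = v≢u (Fin.toℕ-injective (trans v≡i eq))

        low-at : ∀ v → 0 < rk (toℕ v) → v ≢ end₁ G e →
          Link (lowE (toℕ v)) (toℕ v) (lowV (toℕ v)) × 0 < rk (lowV (toℕ v)) × rk (lowV (toℕ v)) < rk (toℕ v)
        low-at v 0<v v≢s with low (toℕ v) 0<v (toℕ-≢ (E0-toℕ e) v≢s)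
        ... | l , inj₁ ordered = l , ordered

        high-at : ∀ v → 0 < rk (toℕ v) → v ≢ end₂ G e →
          Link (highE (toℕ v)) (toℕ v) (highV (toℕ v)) × 0 < rk (highV (toℕ v)) × rk (toℕ v) < rk (highV (toℕ v))
        high-at v 0<v v≢t with high (toℕ v) 0<v (toℕ-≢ (E1-toℕ e) v≢t)
        ... | l , inj₁ ordered = l , ordered

      low-vertex : ∀ v → 0 < rk (toℕ v) → v ≢ end₁ G e → toℕ (clamp v (lowV (toℕ v))) ≡ lowV (toℕ v)
      low-vertex v 0<v v≢s = toℕ-clamp v (link<ˡ (link-sym (proj₁ (low-at v 0<v v≢s))))

      low-edge : ∀ v → 0 < rk (toℕ v) → v ≢ end₁ G e → toℕ (clamp e (lowE (toℕ v))) ≡ lowE (toℕ v)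
      low-edge v 0<v v≢s = toℕ-clamp e (proj₁ (proj₁ (low-at v 0<v v≢s)))

      high-vertex : ∀ v → 0 < rk (toℕ v) → v ≢ end₂ G e → toℕ (clamp v (highV (toℕ v))) ≡ highV (toℕ v)
      high-vertex v 0<v v≢t = toℕ-clamp v (link<ˡ (link-sym (proj₁ (high-at v 0<v v≢t))))

      high-edge : ∀ v → 0 < rk (toℕ v) → v ≢ end₂ G e → toℕ (clamp e (highE (toℕ v))) ≡ highE (toℕ v)
      high-edge v 0<v v≢t = toℕ-clamp e (proj₁ (proj₁ (high-at v 0<v v≢t)))

      numbering : Numbering G e
      numbering = record
        { rank = rk ∘ toℕ
        ; low = λ v → clamp v (lowV (toℕ v))
        ; high = λ v → clamp v (highV (toℕ v))
        ; lowEdge = λ v → clamp e (lowE (toℕ v))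
        ; highEdge = λ v → clamp e (highE (toℕ v))
        ; rank-s = trans (cong rk (sym (E0-toℕ e))) rk-s
        ; rank-injective = λ 0<u eq → Fin.toℕ-injective (injective _ _ 0<u eq)
        ; rank≤rank-t = λ v → ≤-trans (top (toℕ v)) (≤-reflexive (cong rk (E1-toℕ e)))
        ; low-joins = λ v 0<v v≢s → let l , 0<p , p<v = low-at v 0<v v≢s ; p≡ = sym (low-vertex v 0<v v≢s) in
            link⇒joins (subst₂ (λ f p → Link f (toℕ v) p) (sym (low-edge v 0<v v≢s)) p≡ l) ,
            subst (λ p → 0 < rk p) p≡ 0<p , subst (λ p → rk p < rk (toℕ v)) p≡ p<v
        ; high-joins = λ v 0<v v≢t → let l , 0<h , v<h = high-at v 0<v v≢t ; h≡ = sym (high-vertex v 0<v v≢t) in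
            link⇒joins (subst₂ (λ f h → Link f (toℕ v) h) (sym (high-edge v 0<v v≢t)) h≡ l) ,
            subst (λ h → 0 < rk h) h≡ 0<h , subst (λ h → rk (toℕ v) < rk h) h≡ v<h
        ; lowEdge-t = Fin.toℕ-injective (trans
            (cong (λ v → toℕ (clamp e (lowE v))) (sym (E1-toℕ e)))
            (trans (cong (toℕ ∘ clamp e) lowE-t) (toℕ-clamp e (Fin.toℕ<n e))))
        }

      module _ (none : ∀ g u v → g < m → Link g u v → att u ≡ att v ⊎ (0 < rk u × 0 < rk v)) where

        -- The one point at which the program's correctness draws on the core; without cycles there
        -- is nothing to show.
        supported : RootInTwoConnectedCore G e ⊎ ¬ Cycle G →
          ∀ (Z : Cycle G) {f} → f ∈ cycleEdges Z → 0 < rk (toℕ (end₁ G f)) × 0 < rk (toℕ (end₂ G f))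
        supported (inj₂ acyclic) Z = contradiction Z acyclic
        supported (inj₁ core)    Z = Cover.cycles-ranked G e (rk ∘ toℕ) (att ∘ toℕ)
          (subst (λ v → 0 < rk v) (E0-toℕ e) 0<rk-s) (subst (λ v → 0 < rk v) (E1-toℕ e) 0<rk-t)
          (λ {v} 0<v → att-member (toℕ v) 0<v)
          (λ f → none (toℕ f) _ _ (Fin.toℕ<n f) (Fin.toℕ<n f , inj₁ (E0-toℕ f , E1-toℕ f)))
          core Z

  module _ (numbering : Numbering G e) where
    open Chords G numbering
    open Chord

    total-length≤ : ∀ L → totalLength G (map cycleOf L) ≤ length (encode (map edgeListOf L))
    total-length≤ []      = z≤n
    total-length≤ (c ∷ L) = ≤-trans
      (+-mono-≤ (≤-reflexive (∣fromList∣ (CutCycle.unique-edgeList (cut c)))) (total-length≤ L))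
      (≤-trans (≤-reflexive (cong (_+ length (encode (map edgeListOf L))) (sym (length-map toℕ (edgeListOf c)))))
      (≤-trans (n≤1+n _) (≤-reflexive (cong suc (sym (length-++ (map toℕ (edgeListOf c))))))))

  Solved : ℕ → Set
  Solved C = ∃[ t ] ∃[ σ ] ∃[ B ]
    solver ∣ inputState G e ⇓[ t ] σ × Describes (output σ) B × IsRootedCycleBasis G e B ×
    t ≤ C * (m * n) × totalLength G B ≤ C * (m * n)

  -- 46 is the duration of `initialise`. Since `e` exists, `m` and `n` are positive, so constants
  -- and the terms in `m` or `n` alone are absorbed into `m * n`, and 1162 is 59 + 466 + 360 + 277.
  time≤ : ∀ {τ₁ τ₂ τ₃ z K} → z ≤ K → K ≤ n → K ≤ 2 + m →
    τ₁ ≤ 3 + ((n ∸ 2) * (m * 100 + 100) + m * 100) →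
    τ₂ ≤ 5 + (z * ((100 + n * 15) + (200 + (K * 18 + m * 100))) + m * 100) →
    τ₃ ≤ 5 + m * (160 + n * 44) →
    46 + (τ₁ + (τ₂ + τ₃)) ≤ m * n * 1162
  time≤ {τ₁} {τ₂} {τ₃} {z} {K} z≤K K≤n K≤2+m p₁ p₂ p₃ = begin
    46 + (τ₁ + (τ₂ + τ₃))
      ≤⟨ +-monoʳ-≤ 46 (+-mono-≤ (≤-trans p₁ b₁) (+-mono-≤ (≤-trans p₂ b₂) p₃)) ⟩
    46 + ((3 + (n * (m * 100 + 100) + m * 100)) + ((5 + ((n * 300 + ((2 + m) * (n * 15) + (n * ((2 + m) * 18) + n * (m * 100)))) + m * 100))
      + (5 + m * (160 + n * 44))))
      ≡⟨ collect m n ⟩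
    59 + (n * 466 + (m * 360 + m * n * 277))
      ≤⟨ +-mono-≤ (*-monoˡ-≤ 59 1≤mn) (+-mono-≤ (*-monoˡ-≤ 466 n≤mn) (+-monoˡ-≤ (m * n * 277) (*-monoˡ-≤ 360 m≤mn))) ⟩
    m * n * 59 + (m * n * 466 + (m * n * 360 + m * n * 277))
      ≡⟨ gather (m * n) ⟩
    m * n * 1162 ∎
    where
    open ≤-Reasoning
    1≤n : 1 ≤ n
    1≤n = ≤-trans (s≤s z≤n) (Fin.toℕ<n (end₁ G e))
    1≤m : 1 ≤ m
    1≤m = ≤-trans (s≤s z≤n) (Fin.toℕ<n e)
    1≤mn : 1 ≤ m * n
    1≤mn = *-mono-≤ 1≤m 1≤n
    n≤mn : n ≤ m * n
    n≤mn = ≤-trans (≤-reflexive (sym (*-identityˡ n))) (*-monoˡ-≤ n 1≤m)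
    m≤mn : m ≤ m * n
    m≤mn = ≤-trans (≤-reflexive (sym (*-identityʳ m))) (*-monoʳ-≤ m 1≤n)
    collect : ∀ m n →
      46 + ((3 + (n * (m * 100 + 100) + m * 100)) + ((5 + ((n * 300 + ((2 + m) * (n * 15) + (n * ((2 + m) * 18) + n * (m * 100)))) + m * 100))
        + (5 + m * (160 + n * 44)))) ≡ 59 + (n * 466 + (m * 360 + m * n * 277))
    collect = solve-∀
    gather : ∀ p → p * 59 + (p * 466 + (p * 360 + p * 277)) ≡ p * 1162
    gather = solve-∀
    b₁ : 3 + ((n ∸ 2) * (m * 100 + 100) + m * 100) ≤ 3 + (n * (m * 100 + 100) + m * 100)
    b₁ = +-monoʳ-≤ 3 (+-monoˡ-≤ (m * 100) (*-monoˡ-≤ (m * 100 + 100) (m∸n≤m n 2)))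
    split : ∀ z n K m → z * ((100 + n * 15) + (200 + (K * 18 + m * 100))) ≡ z * 300 + (z * (n * 15) + (z * (K * 18) + z * (m * 100)))
    split = solve-∀
    b₂ : 5 + (z * ((100 + n * 15) + (200 + (K * 18 + m * 100))) + m * 100)
       ≤ 5 + ((n * 300 + ((2 + m) * (n * 15) + (n * ((2 + m) * 18) + n * (m * 100)))) + m * 100)
    b₂ = +-monoʳ-≤ 5 (+-monoˡ-≤ (m * 100) (≤-trans (≤-reflexive (split z n K m))
      -- The cost `n * 15` of a shift is multiplied by `2 + m`, not by `n`, and likewise `K * 18` is
      -- bounded through `m`; otherwise a term quadratic in `n` would remain.
      (+-mono-≤ (*-monoˡ-≤ 300 z≤n′) (+-mono-≤ (*-monoˡ-≤ (n * 15) (≤-trans z≤K K≤2+m))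
        (+-mono-≤ (*-mono-≤ z≤n′ (*-monoˡ-≤ 18 K≤2+m)) (*-monoˡ-≤ (m * 100) z≤n′))))))
      where
      z≤n′ : z ≤ n
      z≤n′ = ≤-trans z≤K K≤n

  Answer : List ℕ → Set
  Answer out = ∃[ B ] Describes out B × IsRootedCycleBasis G e B × totalLength G B ≤ length out

  listed⇒answer : ∀ (N : Numbering G e) →
    (∀ (Z : Cycle G) {f} → f ∈ cycleEdges Z → 0 < Numbering.rank N (end₁ G f) × 0 < Numbering.rank N (end₂ G f)) →
    ∀ {out} → Emitting.Listed G N m out → Answer out
  listed⇒answer N ranked listed = map cycleOf chords ,
    (map edgeListOf chords , chords-described chords , written) ,
    chords-basis chords distinct (λ c → complete c (Fin.toℕ<n _)) ranked ,
    subst (λ out → totalLength G (map cycleOf chords) ≤ length out) (sym written) (total-length≤ N chords)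
    where
    open Chords G N
    open Chord
    open Emitting.Listed listed

  module _ (K : ℕ) (pos ord : ℕ → ℕ) (order : Order K pos ord) where
    open Settle K pos ord order
    open Ear K pos ord order
    open Number K pos ord order

    run-emission : RootInTwoConnectedCore G e ⊎ ¬ Cycle G → ∀ σ → Base σ →
      Settled (arrays σ 4) (arrays σ 5) (arrays σ 6) (arrays σ 7) (arrays σ 8) (arrays σ 9) →
      (∀ g u v → g < m → Link g u v → arrays σ 8 u ≡ arrays σ 8 v ⊎ (0 < arrays σ 9 u × 0 < arrays σ 9 v)) →
      Run emitAll σ (λ τ σ′ → Answer (output σ′) × τ ≤ 5 + m * (160 + n * 44))
    run-emission hypothesis σ (input _ m≡ e≡ t≡ E0≡ E1≡ out≡) settled none = run-map
      (λ τ σ′ (listed , bound) → listed⇒answer N (supported settled none hypothesis) listed , bound)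
      (Emitting.Emission.run-emit-all G N (arrays σ) rank-bound
        (λ f → trans (cong (_$ toℕ f) E0≡) (E0-toℕ f))
        (λ f → trans (cong (_$ toℕ f) E1≡) (E1-toℕ f))
        (λ _ → refl)
        (λ v 0<v v≢s → sym (low-vertex settled v 0<v v≢s))
        (λ v 0<v v≢s → sym (low-edge settled v 0<v v≢s))
        (λ v 0<v v≢t → sym (high-vertex settled v 0<v v≢t))
        (λ v 0<v v≢t → sym (high-edge settled v 0<v v≢t))
        σ (record { m≡ = m≡ ; e≡ = e≡ ; t≡ = trans t≡ (E1-toℕ e) ; A≡ = refl }) out≡)
      where
      N : Numbering G e
      N = numbering settled
      rank-bound : arrays σ 9 (toℕ (end₂ G e)) ≤ 2 + n
      rank-bound = subst (λ v → arrays σ 9 v ≤ 2 + n) (E1-toℕ e)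
        (≤-trans (m≤m+n _ _) (≤-trans (Ranked.counted (Settled.ranked settled)) (+-monoʳ-≤ 2 (Order.K≤n order))))

    run-numbered : RootInTwoConnectedCore G e ⊎ ¬ Cycle G → (closed : Closed pos) → ∀ σ → Base σ → Phase.Kept K pos ord order closed σ →
      Settled (arrays σ 4) (arrays σ 5) (arrays σ 6) (arrays σ 7) (arrays σ 8) (arrays σ 9) →
      Run (addEars ⨾ emitAll) σ (λ τ σ′ → Answer (output σ′) × ∃[ τ₂ ] ∃[ τ₃ ] τ ≡ τ₂ + τ₃ ×
        τ₂ ≤ 5 + (zeros K (arrays σ 9 ∘ ord) * ((100 + n * 15) + (200 + (K * 18 + m * 100))) + m * 100) ×
        τ₃ ≤ 5 + m * (160 + n * 44))
    run-numbered hypothesis closed σ base kept settled = run-seq (Phase.run-add-ears K pos ord order closed σ base kept settled)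
      λ τ₂ σ₂ ((base₂ , _ , settled₂ , none) , halt , paid₂) → run-map
        (λ τ₃ σ₃ (answer , paid₃) → answer , τ₂ , τ₃ , refl , paid₂ , paid₃)
        (run-emission hypothesis σ₂ base₂ settled₂ λ g u v g<m → Phase.NoEars.no-ear none g u v
          (<-≤-trans g<m (subst (_≤ regs σ₂ 5) (InputAt.m≡ base₂) (≮⇒≥ halt))))

  Goal : ℕ → State → Set
  Goal τ σ = Answer (output σ) × τ ≤ m * n * 1162

  run-solver : RootInTwoConnectedCore G e ⊎ ¬ Cycle G →
    Run solver (inputState G e) Goal
  run-solver hypothesis =
    run-seq {Q = Goal} (run-initialise (inputState G e) refl refl refl refl refl refl zero-memory)
    λ τ σ₀ (inv₀ , F≡ , K≡ , τ≡) → run-seq {Q = λ τ′ → Goal (τ + τ′)} (run-grow σ₀ inv₀)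
    λ τ₁ σ₁ ((base₁ , grown , initial) , closed , paid₁) → run-map
      (λ τ′ σ′ (answer , τ₂ , τ₃ , τ′≡ , paid₂ , paid₃) → answer ,
        subst₂ (λ τ τ′ → τ + (τ₁ + τ′) ≤ m * n * 1162) (sym τ≡) (sym τ′≡)
          (time≤ (zeros≤ (regs σ₁ 12) _) (Order.K≤n (Grown.order grown)) (K≤2+m (Grown.order grown) (Grown.tree grown))
            (subst₂ (λ k F → τ₁ ≤ 3 + ((n ∸ k) * (m * 100 + 100) + (m ∸ F) * 100)) K≡ F≡ paid₁) paid₂ paid₃))
      (run-numbered (regs σ₁ 12) (arrays σ₁ 2) (arrays σ₁ 3) (Grown.order grown) hypothesis closed σ₁ base₁ (refl , refl , refl)
        (Settle.settled-initially _ _ _ (Grown.order grown) (Grown.tree grown) initial))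
    where
    zero-memory : ∀ a → 2 ≤ a → arrays (inputState G e) a ≡ λ _ → 0
    zero-memory 1             (s≤s ())
    zero-memory (suc (suc a)) _ = refl

  -- C is a variable because 1162 * (m * n) would unfold into 1162 summands.
  solve : ∀ C → C ≡ 1162 → RootInTwoConnectedCore G e ⊎ ¬ Cycle G → Solved C
  solve C C≡ hypothesis = pack (run-solver hypothesis)
    where
    bound : ∀ {t} → t ≤ m * n * 1162 → t ≤ C * (m * n)
    bound t≤ = ≤-trans t≤ (≤-reflexive (trans (cong (m * n *_) (sym C≡)) (*-comm (m * n) C)))
    pack : Run solver (inputState G e) Goal → Solved C
    pack (t , σ , steps , (B , described , basis , length≤) , t≤) =
      t , σ , B , steps , described , basis , bound t≤ , bound (≤-trans length≤ (≤-trans (output-length steps) t≤))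

theorem1 : (∀ {n m} (G : Graph n m) (e : Fin m) →
    (Cycle G → HasRootedCycleBasis G e → RootInTwoConnectedCore G e) ×
    (RootInTwoConnectedCore G e → HasRootedCycleBasis G e)) ×
    (∃[ P ] ∃[ C ] ∀ {n m} (G : Graph n m) (e : Fin m) →
    HasRootedCycleBasis G e →
    ∃[ t ] ∃[ s ] ∃[ B ]
    P ∣ inputState G e ⇓[ t ] s ×
    Describes (output s) B ×
    IsRootedCycleBasis G e B ×
    t ≤ C * (m * n) ×
    totalLength G B ≤ C * (m * n))
theorem1 =
  -- Existence of a basis is read off the run of the program.
  (λ G e → Core.rooted-basis⇒two-connected-core G e , λ core →
    let _ , _ , B , _ , _ , basis , _ = Solve.solve G e 1162 refl (inj₁ core) in B , basis) ,
  solver , 1162 , λ G e basis → Solve.solve G e 1162 refl (Core.core-or-acyclic G e basis)
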